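{- Consider $A,B,u,v\in\mathbb{Q}$ with $AB\neq0$ such that $x^5+Ax+B$ has the quadratic factor $x^2+ux+v$. Then the polynomial $$\frac{x^{10}+Ax^2+B}{x^4+ux^2+v}$$ has reducibility type $(3,3)$ infinitely often, i.e. for infinitely many such $(A,B,u,v)$ that are pairwise inequivalent up to scaling; these are parametrized by the rational points of the elliptic curve $Y^2=X(X^2+12X-4)$, which has rank $1$ over $\mathbb{Q}$.
   Context: A monic polynomial in $\mathbb{Q}[x]$ has reducibility type $(n_1,\dots,n_k)$, $n_1\le\dots\le n_k$, if it factors as a product of $k$ irreducible polynomials in $\mathbb{Q}[x]$ of degrees $n_1,\dots,n_k$. Trinomials $x^{10}+Ax^2+B$ and $x^{10}+A\lambda^8x^2+B\lambda^{10}$, $\lambda\in\mathbb{Q}\setminus\{0\}$, are regarded as equivalent (scaling); correspondingly $(u,v)$ is replaced by $(\lambda^2u,\lambda^4v)$. -}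

module Defs where

open import Algebra.Bundles using (RawSemiring; RawGroup)
import Algebra.Definitions.RawMonoid as MonoidDefs
import Algebra.Definitions.RawSemiring as SemiringDefs
open import Data.Fin.Base using (Fin)
open import Data.Integer.Base as ℤ using (ℤ; +_; -[1+_])
open import Data.List.Base using (List; []; _∷_; map; foldr)
open import Data.List.Relation.Binary.Pointwise.Base using (Pointwise)
open import Data.List.Relation.Unary.Linked using (Linked)
open import Data.Nat.Base as ℕ using (ℕ; zero; suc)
open import Data.Product.Base using (_×_; _,_; ∃)
open import Data.Rational.Base
  using (ℚ; 0ℚ; 1ℚ; _+_; _*_; _-_; -_; _÷_; 1/_; NonZero; ≢-nonZero; +-*-rawSemiring)
open import Data.Rational.Literals using (fromℤ)
open import Data.Rational.Properties
open import Data.Rational.Solver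
open import Data.Vec.Functional using (Vector)
open import Level using (0ℓ)
open import Relation.Binary.PropositionalEquality
open import Relation.Nullary using (yes; no)

infix 9 #_

#_ : ℕ → ℚ
# n = fromℤ (+ n)

open SemiringDefs +-*-rawSemiring public using () renaming (_^_ to _^ℚ_)

------------------------------------------------------------------------
-- The polynomial ring ℚ[x]

-- Coefficients are listed from the constant term upwards.  Trailing zeros
-- are allowed, so equality of polynomials is _≈ₚ_ and not _≡_.
Poly : Set
Poly = List ℚ

coeff : Poly → ℕ → ℚ
coeff []      _       = 0ℚ
coeff (a ∷ p) zero    = a
coeff (a ∷ p) (suc n) = coeff p n

infix 4 _≈ₚ_

record _≈ₚ_ (p q : Poly) : Set where
  constructor mk≈
  field coeff-≡ : ∀ n → coeff p n ≡ coeff q n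

C : ℚ → Poly
C a = a ∷ []

x : Poly
x = 0ℚ ∷ 1ℚ ∷ []

infixl 6 _+ₚ_
infixl 7 _*ₚ_

_+ₚ_ : Poly → Poly → Poly
[]      +ₚ q       = q
(a ∷ p) +ₚ []      = a ∷ p
(a ∷ p) +ₚ (b ∷ q) = (a + b) ∷ (p +ₚ q)

_*ₚ_ : Poly → Poly → Poly
[]      *ₚ q = []
(a ∷ p) *ₚ q = map (a *_) q +ₚ (0ℚ ∷ (p *ₚ q))

ℚ[x] : RawSemiring 0ℓ 0ℓ
ℚ[x] = record
  { Carrier = Poly
  ; _≈_     = _≈ₚ_
  ; _+_     = _+ₚ_
  ; _*_     = _*ₚ_
  ; 0#      = []
  ; 1#      = C 1ℚ
  }

open SemiringDefs ℚ[x] public using (Irreducible) renaming (_^_ to _^ₚ_; _∣_ to _∣ₚ_)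

HasDegree : Poly → ℕ → Set
HasDegree p n = coeff p n ≢ 0ℚ × (∀ m → n ℕ.< m → coeff p m ≡ 0ℚ)

-- Factors are not required to be monic; rescaling by units turns any
-- such factorization of a monic polynomial into one with monic factors.
HasReducibilityType : Poly → List ℕ → Set
HasReducibilityType p ns =
  Linked ℕ._≤_ ns ×
  ∃ λ (fs : List Poly) →
    Pointwise (λ f n → Irreducible f × HasDegree f n) fs ns ×
    p ≈ₚ foldr _*ₚ_ (C 1ℚ) fs

------------------------------------------------------------------------
-- Trinomials x¹⁰ + A x² + B for which x⁵ + A x + B has the factor x² + u x + v

record Quadruple : Set where
  constructor quad
  field A B u v : ℚ

quintic : Quadruple → Poly
quintic (quad A B u v) = x ^ₚ 5 +ₚ C A *ₚ x +ₚ C B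

quadratic : Quadruple → Poly
quadratic (quad A B u v) = x ^ₚ 2 +ₚ C u *ₚ x +ₚ C v

decic : Quadruple → Poly
decic (quad A B u v) = x ^ₚ 10 +ₚ C A *ₚ x ^ₚ 2 +ₚ C B

quartic : Quadruple → Poly
quartic (quad A B u v) = x ^ₚ 4 +ₚ C u *ₚ x ^ₚ 2 +ₚ C v

Admissible : Quadruple → Set
Admissible t = A * B ≢ 0ℚ × quadratic t ∣ₚ quintic t
  where open Quadruple t

-- The quartic is monic, so the quotient q is unique.
QuotientHasType : Quadruple → List ℕ → Set
QuotientHasType t ns =
  ∃ λ q → q *ₚ quartic t ≈ₚ decic t × HasReducibilityType q ns

IsType33 : Quadruple → Set
IsType33 t = Admissible t × QuotientHasType t (3 ∷ 3 ∷ [])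

infix 4 _∼_

_∼_ : Quadruple → Quadruple → Set
quad A B u v ∼ quad A′ B′ u′ v′ =
  ∃ λ l → l ≢ 0ℚ ×
    A′ ≡ A * l ^ℚ 8 × B′ ≡ B * l ^ℚ 10 × u′ ≡ l ^ℚ 2 * u × v′ ≡ l ^ℚ 4 * v

------------------------------------------------------------------------
-- Ranks of abelian groups

module Rank (G : RawGroup 0ℓ 0ℓ) where
  open RawGroup G
  open MonoidDefs rawMonoid using (sum) renaming (_×_ to _×ᴳ_)

  infixr 8 _·_

  _·_ : ℤ → Carrier → Carrier
  (+ n)    · g = n ×ᴳ g
  -[1+ n ] · g = (suc n ×ᴳ g) ⁻¹

  Relation : ∀ {n} → Vector ℤ n → Vector Carrier n → Set
  Relation k g = sum (λ i → k i · g i) ≈ ε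

  LinearlyIndependent LinearlyDependent : ∀ {n} → Vector Carrier n → Set
  LinearlyIndependent {n} g = ∀ k → Relation k g → ∀ (i : Fin n) → k i ≡ ℤ.0ℤ
  LinearlyDependent   {n} g = ∃ λ k → Relation k g × ∃ λ (i : Fin n) → k i ≢ ℤ.0ℤ

  -- The largest number of ℤ-linearly independent elements is r.
  HasRank : ℕ → Set
  HasRank r =
    (∃ λ (g : Vector Carrier r) → LinearlyIndependent g) ×
    (∀ (g : Vector Carrier (suc r)) → LinearlyDependent g)

------------------------------------------------------------------------
-- Elliptic curves Y² = X³ + a X² + b X + c over ℚ

record EllipticCurve : Set where
  field
    a b c : ℚ
    -- the discriminant of the cubic
    disc≢0 : a ^ℚ 2 * b ^ℚ 2 - # 4 * b ^ℚ 3 - # 4 * a ^ℚ 3 * c - # 27 * c ^ℚ 2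
               + # 18 * a * b * c ≢ 0ℚ

  rhs : ℚ → ℚ
  rhs X = X * X * X + a * X * X + b * X + c

  OnCurve : ℚ → ℚ → Set
  OnCurve X Y = Y * Y ≡ rhs X

module MordellWeil (E : EllipticCurve) where
  open EllipticCurve E

  data Point : Set where
    ∞      : Point
    affine : ∀ X Y → .(OnCurve X Y) → Point

  neg-onCurve : ∀ X Y → OnCurve X Y → OnCurve X (- Y)
  neg-onCurve X Y p = trans (solve 1 (λ Y → (:- Y) :* (:- Y) := Y :* Y) refl Y) p
    where open +-*-Solver

  ⊖_ : Point → Point
  ⊖ ∞            = ∞
  ⊖ affine X Y p = affine X (- Y) (neg-onCurve X Y p)

  -- (rhs X₂ - rhs X₁) / (X₂ - X₁)
  secant : ℚ → ℚ → ℚ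
  secant X₁ X₂ = X₁ * X₁ + X₁ * X₂ + X₂ * X₂ + a * (X₁ + X₂) + b

  thirdX : (m X₁ X₂ : ℚ) → ℚ
  thirdX m X₁ X₂ = m * m - a - X₁ - X₂

  thirdY : (m X₁ Y₁ X₃ : ℚ) → ℚ
  thirdY m X₁ Y₁ X₃ = m * (X₁ - X₃) - Y₁

  third-onCurve : ∀ m X₁ Y₁ X₂ Y₂ → OnCurve X₁ Y₁ →
    m * (X₂ - X₁) ≡ Y₂ - Y₁ → m * (Y₁ + Y₂) ≡ secant X₁ X₂ →
    OnCurve (thirdX m X₁ X₂) (thirdY m X₁ Y₁ (thirdX m X₁ X₂))
  third-onCurve m X₁ Y₁ X₂ Y₂ p₁ line slope = sym (begin
    rhs X₃
      ≡⟨ solve 6 (λ a b c X₁ X₂ X₃ →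
           X₃ :* X₃ :* X₃ :+ a :* X₃ :* X₃ :+ b :* X₃ :+ c :=
           (X₁ :* X₁ :* X₁ :+ a :* X₁ :* X₁ :+ b :* X₁ :+ c) :+
           (X₃ :- X₁) :* ((X₁ :* X₁ :+ X₁ :* X₂ :+ X₂ :* X₂ :+ a :* (X₁ :+ X₂) :+ b)
                          :+ (X₃ :- X₂) :* (X₃ :+ a :+ X₁ :+ X₂)))
           refl a b c X₁ X₂ X₃ ⟩
    rhs X₁ + (X₃ - X₁) * (secant X₁ X₂ + (X₃ - X₂) * (X₃ + a + X₁ + X₂))
      ≡⟨ cong₂ (λ r s → r + (X₃ - X₁) * s) (sym p₁)
           (cong₂ (λ h k → h + (X₃ - X₂) * k) (sym slope)
             (solve 4 (λ m a X₁ X₂ → (m :* m :- a :- X₁ :- X₂) :+ a :+ X₁ :+ X₂ := m :* m)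
               refl m a X₁ X₂)) ⟩
    Y₁ * Y₁ + (X₃ - X₁) * (m * (Y₁ + Y₂) + (X₃ - X₂) * (m * m))
      ≡⟨ cong (λ Y → Y₁ * Y₁ + (X₃ - X₁) * (m * (Y₁ + Y) + (X₃ - X₂) * (m * m)))
           (trans (solve 2 (λ Y₁ Y₂ → Y₂ := Y₁ :+ (Y₂ :- Y₁)) refl Y₁ Y₂)
                  (cong (λ d → Y₁ + d) (sym line))) ⟩
    Y₁ * Y₁ + (X₃ - X₁) * (m * (Y₁ + (Y₁ + m * (X₂ - X₁))) + (X₃ - X₂) * (m * m))
      ≡⟨ solve 5 (λ m X₁ Y₁ X₂ X₃ →
           Y₁ :* Y₁ :+ (X₃ :- X₁) :* (m :* (Y₁ :+ (Y₁ :+ m :* (X₂ :- X₁)))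
                                      :+ (X₃ :- X₂) :* (m :* m)) :=
           (m :* (X₁ :- X₃) :- Y₁) :* (m :* (X₁ :- X₃) :- Y₁))
           refl m X₁ Y₁ X₂ X₃ ⟩
    thirdY m X₁ Y₁ X₃ * thirdY m X₁ Y₁ X₃ ∎)
    where
    open ≡-Reasoning
    open +-*-Solver
    X₃ = thirdX m X₁ X₂

  ÷-cancel : ∀ p q (q≢0 : q ≢ 0ℚ) → (_÷_ p q {{≢-nonZero q≢0}}) * q ≡ p
  ÷-cancel p q q≢0 = trans (*-assoc p _ q)
    (trans (cong (p *_) (*-inverseˡ q {{≢-nonZero q≢0}})) (*-identityʳ p))

  *-cancelʳ : ∀ p q r → r ≢ 0ℚ → p * r ≡ q * r → p ≡ q
  *-cancelʳ p q r r≢0 eq =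
    trans (sym (undo p)) (trans (cong (_* 1/ r) eq) (undo q))
    where
    instance
      r-nonZero : NonZero r
      r-nonZero = ≢-nonZero r≢0
    undo : ∀ s → s * r * 1/ r ≡ s
    undo s = trans (*-assoc s r (1/ r))
      (trans (cong (s *_) (*-inverseʳ r)) (*-identityʳ s))

  minus≡0 : ∀ p q → p - q ≡ 0ℚ → p ≡ q
  minus≡0 p q eq = trans (solve 2 (λ p q → p := (p :- q) :+ q) refl p q)
    (trans (cong (_+ q) eq) (+-identityˡ q))
    where open +-*-Solver

  minus≢0 : ∀ {p q} → p ≢ q → q - p ≢ 0ℚ
  minus≢0 {p} {q} p≢q eq = p≢q (sym (minus≡0 q p eq))

  chordSlope : ∀ X₁ Y₁ X₂ Y₂ → X₁ ≢ X₂ → ℚ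
  chordSlope X₁ Y₁ X₂ Y₂ X₁≢X₂ =
    _÷_ (Y₂ - Y₁) (X₂ - X₁) {{≢-nonZero (minus≢0 X₁≢X₂)}}

  -- Used only when (X₁ , Y₁) = (X₂ , Y₂), where the denominator is 2 Y₁.
  tangentSlope : ∀ X₁ Y₁ Y₂ → Y₁ + Y₂ ≢ 0ℚ → ℚ
  tangentSlope X₁ Y₁ Y₂ s≢0 =
    _÷_ (# 3 * X₁ * X₁ + # 2 * a * X₁ + b) (Y₁ + Y₂) {{≢-nonZero s≢0}}

  squares : ∀ X₁ Y₁ X₂ Y₂ → OnCurve X₁ Y₁ → OnCurve X₂ Y₂ →
    (Y₂ - Y₁) * (Y₁ + Y₂) ≡ secant X₁ X₂ * (X₂ - X₁)
  squares X₁ Y₁ X₂ Y₂ p₁ p₂ = begin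
    (Y₂ - Y₁) * (Y₁ + Y₂)
      ≡⟨ solve 2 (λ Y₁ Y₂ → (Y₂ :- Y₁) :* (Y₁ :+ Y₂) := Y₂ :* Y₂ :- Y₁ :* Y₁) refl Y₁ Y₂ ⟩
    Y₂ * Y₂ - Y₁ * Y₁
      ≡⟨ cong₂ _-_ p₂ p₁ ⟩
    rhs X₂ - rhs X₁
      ≡⟨ solve 5 (λ a b c X₁ X₂ →
           (X₂ :* X₂ :* X₂ :+ a :* X₂ :* X₂ :+ b :* X₂ :+ c) :-
           (X₁ :* X₁ :* X₁ :+ a :* X₁ :* X₁ :+ b :* X₁ :+ c) :=
           (X₁ :* X₁ :+ X₁ :* X₂ :+ X₂ :* X₂ :+ a :* (X₁ :+ X₂) :+ b) :* (X₂ :- X₁))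
           refl a b c X₁ X₂ ⟩
    secant X₁ X₂ * (X₂ - X₁) ∎
    where
    open ≡-Reasoning
    open +-*-Solver

  chord-onCurve : ∀ X₁ Y₁ X₂ Y₂ → OnCurve X₁ Y₁ → OnCurve X₂ Y₂ → (ne : X₁ ≢ X₂) →
    let m = chordSlope X₁ Y₁ X₂ Y₂ ne in
    OnCurve (thirdX m X₁ X₂) (thirdY m X₁ Y₁ (thirdX m X₁ X₂))
  chord-onCurve X₁ Y₁ X₂ Y₂ p₁ p₂ ne =
    third-onCurve m X₁ Y₁ X₂ Y₂ p₁ line
      (*-cancelʳ _ _ (X₂ - X₁) (minus≢0 ne) (begin
        m * (Y₁ + Y₂) * (X₂ - X₁)
          ≡⟨ solve 3 (λ m s d → m :* s :* d := m :* d :* s) refl m (Y₁ + Y₂) (X₂ - X₁) ⟩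
        m * (X₂ - X₁) * (Y₁ + Y₂)
          ≡⟨ cong (_* (Y₁ + Y₂)) line ⟩
        (Y₂ - Y₁) * (Y₁ + Y₂)
          ≡⟨ squares X₁ Y₁ X₂ Y₂ p₁ p₂ ⟩
        secant X₁ X₂ * (X₂ - X₁) ∎))
    where
    open ≡-Reasoning
    open +-*-Solver
    m = chordSlope X₁ Y₁ X₂ Y₂ ne
    line : m * (X₂ - X₁) ≡ Y₂ - Y₁
    line = ÷-cancel (Y₂ - Y₁) (X₂ - X₁) (minus≢0 ne)

  tangent-onCurve : ∀ X₁ Y₁ X₂ Y₂ → OnCurve X₁ Y₁ → OnCurve X₂ Y₂ → X₁ ≡ X₂ →
    (s≢0 : Y₁ + Y₂ ≢ 0ℚ) → let m = tangentSlope X₁ Y₁ Y₂ s≢0 in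
    OnCurve (thirdX m X₁ X₂) (thirdY m X₁ Y₁ (thirdX m X₁ X₂))
  tangent-onCurve X₁ Y₁ .X₁ Y₂ p₁ p₂ refl s≢0 =
    third-onCurve m X₁ Y₁ X₁ Y₂ p₁ line
      (trans (÷-cancel (# 3 * X₁ * X₁ + # 2 * a * X₁ + b) (Y₁ + Y₂) s≢0)
        (solve 3 (λ a b X₁ → con (# 3) :* X₁ :* X₁ :+ con (# 2) :* a :* X₁ :+ b :=
           X₁ :* X₁ :+ X₁ :* X₁ :+ X₁ :* X₁ :+ a :* (X₁ :+ X₁) :+ b) refl a b X₁))
    where
    open ≡-Reasoning
    open +-*-Solver
    m = tangentSlope X₁ Y₁ Y₂ s≢0
    m*0≡0 : ∀ k → k * (X₁ - X₁) ≡ 0ℚ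
    m*0≡0 k = trans (cong (k *_) (+-inverseʳ X₁)) (*-zeroʳ k)
    line : m * (X₁ - X₁) ≡ Y₂ - Y₁
    line = trans (m*0≡0 m) (sym (*-cancelʳ (Y₂ - Y₁) 0ℚ (Y₁ + Y₂) s≢0
      (trans (squares X₁ Y₁ X₁ Y₂ p₁ p₂) (trans (m*0≡0 (secant X₁ X₁)) (sym (*-zeroˡ (Y₁ + Y₂)))))))

  infixl 6 _⊕_

  _⊕_ : Point → Point → Point
  ∞ ⊕ Q = Q
  P@(affine _ _ _) ⊕ ∞ = P
  affine X₁ Y₁ p₁ ⊕ affine X₂ Y₂ p₂ with X₁ ≟ X₂ | Y₁ + Y₂ ≟ 0ℚ
  ... | no X₁≢X₂  | _       = let m = chordSlope X₁ Y₁ X₂ Y₂ X₁≢X₂ in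
    affine (thirdX m X₁ X₂) (thirdY m X₁ Y₁ (thirdX m X₁ X₂)) (chord-onCurve X₁ Y₁ X₂ Y₂ p₁ p₂ X₁≢X₂)
  ... | yes _     | yes _   = ∞
  ... | yes X₁≡X₂ | no s≢0  = let m = tangentSlope X₁ Y₁ Y₂ s≢0 in
    affine (thirdX m X₁ X₂) (thirdY m X₁ Y₁ (thirdX m X₁ X₂))
           (tangent-onCurve X₁ Y₁ X₂ Y₂ p₁ p₂ X₁≡X₂ s≢0)

  group : RawGroup 0ℓ 0ℓ
  group = record { Carrier = Point ; _≈_ = _≡_ ; _∙_ = _⊕_ ; ε = ∞ ; _⁻¹ = ⊖_ }

HasMordellWeilRank : EllipticCurve → ℕ → Set
HasMordellWeilRank E = Rank.HasRank (MordellWeil.group E)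

-- Y² = X (X² + 12 X - 4)
E₃₃ : EllipticCurve
E₃₃ = record { a = # 12 ; b = - # 4 ; c = 0ℚ ; disc≢0 = λ () }

------------------------------------------------------------------------
-- The parametrization

-- The quotient is an even sextic
--   x⁶ - u x⁴ + (u² - v) x² + (2uv - u³),
-- so a factorization into two irreducible cubics must have the form
--   (x³ + r x² + s x + t) (x³ - r x² + s x - t),
-- i.e.  u = r² - 2s,  v = u² - s² + 2rt,  t² + 4rut + u³ - 2us² = 0.
-- If r = 0 then t² = 4s³, so s = k², t = 2k³ for some k, and the first cubic
-- has the root -k.  So r ≠ 0, and scaling makes r = 1; completing the square in the
-- equation for t then gives the curve E₃₃ with X = 4s - 2, Y = 4 (t - X).
cubicS : ℚ → ℚ
cubicS X = (X + # 2) ÷ # 4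

cubicT : ℚ → ℚ → ℚ
cubicT X Y = X + Y ÷ # 4

cubic⁺ cubic⁻ : ℚ → ℚ → Poly
cubic⁺ X Y = x ^ₚ 3 +ₚ x ^ₚ 2 +ₚ C (cubicS X) *ₚ x +ₚ C (cubicT X Y)
cubic⁻ X Y = x ^ₚ 3 +ₚ C (- 1ℚ) *ₚ x ^ₚ 2 +ₚ C (cubicS X) *ₚ x +ₚ C (- cubicT X Y)

-- A and B are determined by u and v through
--   x⁵ + A x + B = (x² + u x + v) (x³ - u x² + (u² - v) x + (2uv - u³)).
withQuadratic : ℚ → ℚ → Quadruple
withQuadratic u v = quad (# 3 * u ^ℚ 2 * v - u ^ℚ 4 - v ^ℚ 2) (u * v * (# 2 * v - u ^ℚ 2)) u v

param : ℚ → ℚ → Quadruple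
param X Y = withQuadratic (- X ÷ # 2) ((# 3 * X ^ℚ 2 + # 28 * X - # 4 + # 8 * Y) ÷ # 16)

-- E : Y² = X D with D = X² + 12 X - 4 never zero is mapped injectively into the Jacobi quartic
-- y² = 1 - 6 x² + 10 x⁴ by x = 2 Y / D, y = (X² + 4) / D.  Since 10 is not a square, the addition
-- law of the quartic has no exceptional cases, and the chord-tangent law of E becomes a homomorphism
-- into an abelian group.
--
-- Rank ≤ 1 is an infinite descent on the numerator of x.  If x = b / a in lowest terms, then
-- a⁴ - 6 a² b² + 10 b⁴ = m² forces b = 2 g f with a² + 4 f⁴ = g⁴ + 12 g² f², and then f = r s with
-- g² = r⁴ - 6 r² s² + 10 s⁴ or g² = 2 r⁴ - 6 r² s² + 5 s⁴.  In the first case the point is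
-- ± 2 R (+ T) with x(R) = s / r.  In the second it is ± (2 R ± P₀) (+ T) with
-- x(R) = (r² - s²) / (g ∓ r s), P₀ being the image of (1 , 3), and one of the two choices
-- of the sign has a smaller numerator.  Hence the double of every point is a multiple of P₀.
-- P₀ has infinite order because the numerator of x is always even while a is odd.
--
-- The points (3 n + 1) P₀ all agree modulo 11, where the cubic has no root; this is the infinite family.
--
-- If the sextic quotient is a product of irreducible cubics F and G, comparing coefficients yields
-- G = - F(- x), and the x²-coefficient of F is nonzero and can be scaled to 1.

module Submission where

open import Defs
open import Algebra.Bundles using (AbelianGroup; CommutativeMonoid; RawGroup; RawSemiring)
open import Algebra.Definitions.RawMagma (RawSemiring.*-rawMagma ℚ[x]) using (_,_)
open import Algebra.Definitions.RawMonoid (RawGroup.rawMonoid (MordellWeil.group E₃₃)) using () renaming (_×_ to _·ᴱ_)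
import Algebra.Definitions.RawSemiring ℚ[x] as SemiringDefs
import Algebra.Properties.AbelianGroup
import Algebra.Properties.CommutativeMonoid.Mult
import Algebra.Properties.CommutativeSemigroup
open import Data.Empty using (⊥; ⊥-elim)
open import Data.Fin.Base using (Fin; zero; suc; toℕ; fromℕ<)
import Data.Fin.Properties as Fin
open import Data.Integer.Base as ℤ using (ℤ; +_; -[1+_])
import Data.Integer.DivMod as ℤ
import Data.Integer.Properties as ℤ
import Data.Integer.Tactic.RingSolver as ℤSolver
open import Data.List.Base using ([]; _∷_; map)
open import Data.List.Relation.Binary.Pointwise.Base using ([]; _∷_)
open import Data.List.Relation.Unary.Linked using (_∷_; [-])
open import Data.Nat.Base as ℕ using (ℕ; zero; suc)
open import Data.Nat.Coprimality as Coprimality using (Coprime)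
import Data.Nat.Divisibility as ℕ
import Data.Nat.DivMod as ℕ
open import Data.Nat.GCD using (gcd; gcd[m,n]∣m; gcd[m,n]∣n; gcd-greatest; c*gcd[m,n]≡gcd[cm,cn])
open import Data.Nat.Induction using (<-wellFounded)
open import Data.Nat.Primality using (Prime; prime?; prime[2]; euclidsLemma)
import Data.Nat.Properties as ℕ
import Data.Nat.Tactic.RingSolver as ℕSolver
open import Data.Product.Base using (∃; ∃₂; _×_; _,_; proj₁; proj₂)
open import Data.Rational.Base as ℚ
  using (ℚ; 0ℚ; 1ℚ; _+_; _*_; _-_; -_; _÷_; 1/_; ↥_; ↧_; ↧ₙ_; mkℚ; ≢-nonZero)
open import Data.Rational.Literals using (fromℤ)
import Data.Rational.Properties as ℚ
import Data.Rational.Unnormalised.Base as ℚᵘ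
import Data.Rational.Unnormalised.Properties as ℚᵘ
open import Data.Sign.Base as Sign using (Sign)
open import Data.Sum.Base using (_⊎_; inj₁; inj₂; [_,_]′)
open import Data.Vec.Functional using (Vector)
open import Function.Bundles using (_⇔_; mk⇔)
open import Induction.WellFounded using (Acc; acc)
open import Level using (0ℓ)
open import Relation.Binary.Definitions as Tri using ()
open import Relation.Binary.PropositionalEquality
open import Relation.Nullary using (¬_; Dec; yes; no; dec⇒maybe; recompute)
open import Relation.Nullary.Decidable using (from-yes; from-no; _→-dec_; _×-dec_)
open import Tactic.RingSolver using (solve-∀)
import Tactic.RingSolver.Core.AlmostCommutativeRing as ACR

open EllipticCurve E₃₃ using (OnCurve)
open MordellWeil E₃₃ hiding (group)
open Rank (MordellWeil.group E₃₃) using (LinearlyIndependent; LinearlyDependent) renaming (_·_ to _·ℤ_)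
open _≈ₚ_

-- The quartic comes from a general correspondence: y² = 1 + c x² + d x⁴ is birational to Y² = X (X²
-- - 2 c X + c² - 4 d) through X = (2 (1 + y) + c x²) / x² and Y = 2 X / x, and c = -6, d = 10 give
-- `E₃₃`. The discriminant of X² + 12 X - 4 is 16 · 10, so the completeness of the addition law on
-- the quartic and the absence of a second rational point of order two on the curve are one and the
-- same fact. The group axioms are proved on the quartic alone. A homomorphism with trivial kernel
-- already carries linear relations in both directions, which is all that the rank asks for. The
-- descent recognizes points by x², hence only up to sign and up to the translation by T = (0 , -1).
-- The statement that is descended therefore concerns 2 P: it does not see T and is stable under
-- negation. For the infinite family, 3 P₀ reduces to the neutral element modulo 11, so that adding
-- it does not change the reduction.

ringℚ : ACR.AlmostCommutativeRing 0ℓ 0ℓ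
ringℚ = ACR.fromCommutativeRing ℚ.+-*-commutativeRing (λ p → dec⇒maybe (0ℚ ℚ.≟ p))

-- Chained uses prove an identity modulo an ideal, given the cofactors k.
modulo : ∀ {p q} → p ≡ q → ∀ k {l r} → l ≡ r + (p - q) * k → l ≡ r
modulo {p} refl k {r = r} eq = trans eq (vanish r k p)
  where
  vanish : ∀ r k p → r + (p - p) * k ≡ r
  vanish = solve-∀ ringℚ

-- Arithmetic in ℚ and irrational square roots

*-cancelˡ : ∀ {p q} r → r ≢ 0ℚ → r * p ≡ r * q → p ≡ q
*-cancelˡ {p} {q} r r≢0 eq = *-cancelʳ p q r r≢0 (trans (ℚ.*-comm p r) (trans eq (ℚ.*-comm r q)))

*-≡0 : ∀ {p q} → p * q ≡ 0ℚ → p ≢ 0ℚ → q ≡ 0ℚ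
*-≡0 {p} {q} eq p≢0 = *-cancelˡ p p≢0 (trans eq (sym (ℚ.*-zeroʳ p)))

*-≡0-⊎ : ∀ {p q} → p * q ≡ 0ℚ → p ≡ 0ℚ ⊎ q ≡ 0ℚ
*-≡0-⊎ {p} eq with p ℚ.≟ 0ℚ
... | yes p≡0 = inj₁ p≡0
... | no p≢0 = inj₂ (*-≡0 eq p≢0)

*-≢0 : ∀ {p q} → p ≢ 0ℚ → q ≢ 0ℚ → p * q ≢ 0ℚ
*-≢0 p≢0 q≢0 eq = q≢0 (*-≡0 eq p≢0)

square-≢0 : ∀ {p} → p ≢ 0ℚ → p * p ≢ 0ℚ
square-≢0 p≢0 = *-≢0 p≢0 p≢0

square-≡0 : ∀ {p} → p * p ≡ 0ℚ → p ≡ 0ℚ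
square-≡0 eq with *-≡0-⊎ eq
... | inj₁ e = e
... | inj₂ e = e

equal-squares : ∀ {p q} → p * p ≡ q * q → p ≡ q ⊎ p ≡ - q
equal-squares {p} {q} eq =
  [ (λ e → inj₁ (minus≡0 p q e)) , (λ e → inj₂ (minus≡0 p (- q) (trans (lemma₂ p q) e))) ]′
  (*-≡0-⊎ {p - q} {p + q} (modulo eq 1ℚ (lemma₁ p q)))
  where
  lemma₁ : ∀ p q → (p - q) * (p + q) ≡ 0ℚ + (p * p - q * q) * 1ℚ
  lemma₁ = solve-∀ ringℚ
  lemma₂ : ∀ p q → p - (- q) ≡ p + q
  lemma₂ = solve-∀ ringℚ

fromℤ-injective : ∀ {m n} → fromℤ m ≡ fromℤ n → m ≡ n
fromℤ-injective = cong ↥_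

fromℤ-+ : ∀ m n → fromℤ (m ℤ.+ n) ≡ fromℤ m + fromℤ n
fromℤ-+ m n = ℚ.toℚᵘ-injective (ℚᵘ.≃-trans (ℚᵘ.*≡* (lemma m n)) (ℚᵘ.≃-sym (ℚ.toℚᵘ-homo-+ (fromℤ m) (fromℤ n))))
  where
  lemma : ∀ m n → (m ℤ.+ n) ℤ.* ℤ.1ℤ ≡ (m ℤ.* ℤ.1ℤ ℤ.+ n ℤ.* ℤ.1ℤ) ℤ.* ℤ.1ℤ
  lemma = ℤSolver.solve-∀

fromℤ-* : ∀ m n → fromℤ (m ℤ.* n) ≡ fromℤ m * fromℤ n
fromℤ-* m n = ℚ.toℚᵘ-injective (ℚᵘ.≃-trans (ℚᵘ.*≡* refl) (ℚᵘ.≃-sym (ℚ.toℚᵘ-homo-* (fromℤ m) (fromℤ n))))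

fromℤ-neg : ∀ m → fromℤ (ℤ.- m) ≡ - fromℤ m
fromℤ-neg (+ zero)  = refl
fromℤ-neg (+ suc n) = refl
fromℤ-neg -[1+ n ]  = refl

*-↧ : ∀ p → p * fromℤ (↧ p) ≡ fromℤ (↥ p)
*-↧ p@(mkℚ _ _ _) = ℚ.toℚᵘ-injective
  (ℚᵘ.≃-trans (ℚ.toℚᵘ-homo-* p (fromℤ (↧ p))) (ℚᵘ.*≡* (lemma (↥ p) (↧ p))))
  where
  lemma : ∀ n d → n ℤ.* d ℤ.* ℤ.1ℤ ≡ n ℤ.* (d ℤ.* ℤ.1ℤ)
  lemma = ℤSolver.solve-∀

↧≢0 : ∀ p → fromℤ (↧ p) ≢ 0ℚ
↧≢0 (mkℚ _ _ _) ()

∣∙∣-coprime : ∀ p → Coprime ℤ.∣ ↥ p ∣ (↧ₙ p)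
∣∙∣-coprime (mkℚ _ _ c) = Coprimality.recompute c

-- n² = N d² with d coprime to n forces d = 1.
integral-root : ∀ p N → p * p ≡ fromℤ N → ∃ λ n → p ≡ fromℤ n
integral-root p N eq = ↥ p , (begin
  p                 ≡⟨ ℚ.*-identityʳ p ⟨
  p * 1ℚ            ≡⟨ cong (λ k → p * fromℤ (+ k)) d≡1 ⟨
  p * fromℤ (↧ p)   ≡⟨ *-↧ p ⟩
  fromℤ (↥ p)       ∎)
  where
  open ≡-Reasoning
  n = ↥ p
  d = ↧ p
  lemma : ∀ p d → (p * d) * (p * d) ≡ (p * p) * (d * d)
  lemma = solve-∀ ringℚ
  n²≡Nd² : n ℤ.* n ≡ N ℤ.* (d ℤ.* d)
  n²≡Nd² = fromℤ-injective (begin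
    fromℤ (n ℤ.* n)                      ≡⟨ fromℤ-* n n ⟩
    fromℤ n * fromℤ n                    ≡⟨ cong₂ _*_ (*-↧ p) (*-↧ p) ⟨
    (p * fromℤ d) * (p * fromℤ d)        ≡⟨ lemma p (fromℤ d) ⟩
    (p * p) * (fromℤ d * fromℤ d)        ≡⟨ cong₂ _*_ eq (sym (fromℤ-* d d)) ⟩
    fromℤ N * fromℤ (d ℤ.* d)            ≡⟨ fromℤ-* N (d ℤ.* d) ⟨
    fromℤ (N ℤ.* (d ℤ.* d))              ∎)
  ∣n∣²≡ : ℤ.∣ n ∣ ℕ.* ℤ.∣ n ∣ ≡ ℤ.∣ N ∣ ℕ.* (↧ₙ p ℕ.* ↧ₙ p)
  ∣n∣²≡ = trans (sym (ℤ.abs-* n n)) (trans (cong ℤ.∣_∣ n²≡Nd²)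
    (trans (ℤ.abs-* N (d ℤ.* d)) (cong (ℤ.∣ N ∣ ℕ.*_) (ℤ.abs-* d d))))
  d∣n² : ↧ₙ p ℕ.∣ ℤ.∣ n ∣ ℕ.* ℤ.∣ n ∣
  d∣n² = ℕ.divides (ℤ.∣ N ∣ ℕ.* ↧ₙ p) (trans ∣n∣²≡ (sym (ℕ.*-assoc (ℤ.∣ N ∣) (↧ₙ p) (↧ₙ p))))
  d∣n : ↧ₙ p ℕ.∣ ℤ.∣ n ∣
  d∣n = Coprimality.coprime-divisor (Coprimality.sym (∣∙∣-coprime p)) d∣n²
  d≡1 : ↧ₙ p ≡ 1
  d≡1 = ∣∙∣-coprime p (d∣n , ℕ.∣-refl)

-- A rational root would be an integer by `integral-root`, and its absolute value a natural root.
irrational-√ : ∀ N → (∀ k → k ℕ.* k ≢ N) → ∀ p → p * p ≢ # N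
irrational-√ N nonsquare p eq = nonsquare ℤ.∣ n ∣ (trans (sym (ℤ.abs-* n n)) (cong ℤ.∣_∣ n²≡N))
  where
  root = integral-root p (+ N) eq
  n = proj₁ root
  n²≡N : n ℤ.* n ≡ + N
  n²≡N = fromℤ-injective (trans (fromℤ-* n n) (trans (cong₂ _*_ (sym (proj₂ root)) (sym (proj₂ root))) eq))

between-squares : ∀ {N} r → r ℕ.* r ℕ.< N → N ℕ.< suc r ℕ.* suc r → ∀ k → k ℕ.* k ≢ N
between-squares r lo hi k refl with k ℕ.≤? r
... | yes k≤r = ℕ.<⇒≱ lo (ℕ.*-mono-≤ k≤r k≤r)
... | no k≰r = ℕ.<⇒≱ hi (ℕ.*-mono-≤ (ℕ.≰⇒> k≰r) (ℕ.≰⇒> k≰r))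

√10-irrational : ∀ p → p * p ≢ # 10
√10-irrational = irrational-√ 10 (between-squares 3 (ℕ.≤ᵇ⇒≤ 10 10 _) (ℕ.≤ᵇ⇒≤ 11 16 _))

√5-irrational : ∀ p → p * p ≢ # 5
√5-irrational = irrational-√ 5 (between-squares 2 (ℕ.≤ᵇ⇒≤ 5 5 _) (ℕ.≤ᵇ⇒≤ 6 9 _))

infixl 7 _/[_,_]

_/[_,_] : ∀ p q → q ≢ 0ℚ → ℚ
p /[ q , q≢0 ] = _÷_ p q {{≢-nonZero q≢0}}

-- The abelian group of the Jacobi quartic

jacobi : ℚ → ℚ
jacobi x = 1ℚ - # 6 * (x * x) + # 10 * ((x * x) * (x * x))

record 𝕁 : Set where
  constructor point
  field
    ξ η : ℚ
    .on-curve : η * η ≡ jacobi ξ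

open 𝕁

on : ∀ P → η P * η P ≡ jacobi (ξ P)
on (point x y p) = recompute (y * y ℚ.≟ jacobi x) p

J-≡ : ∀ {P Q} → ξ P ≡ ξ Q → η P ≡ η Q → P ≡ Q
J-≡ refl refl = refl

den : ℚ → ℚ → ℚ
den x₁ x₂ = 1ℚ - # 10 * ((x₁ * x₁) * (x₂ * x₂))

-- Numerators, over `den` and its square, of the unified addition law of the Jacobi quartic y² = 1 -
-- 2 δ x² + ε x⁴ with δ = 3 and ε = 10. The same formulas cover doubling.
sumX sumY : ℚ → ℚ → ℚ → ℚ → ℚ
sumX x₁ y₁ x₂ y₂ = x₁ * y₂ + x₂ * y₁
sumY x₁ y₁ x₂ y₂ =
  (y₁ * y₂ - # 6 * (x₁ * x₂)) * (1ℚ + # 10 * ((x₁ * x₁) * (x₂ * x₂))) + # 20 * (x₁ * x₂) * (x₁ * x₁ + x₂ * x₂)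

-- Otherwise (10 z)² = 10.
1-10z²≢0 : ∀ z → 1ℚ - # 10 * (z * z) ≢ 0ℚ
1-10z²≢0 z eq = √10-irrational (# 10 * z) (modulo (sym eq) (# 10) (lemma z))
  where
  lemma : ∀ z → # 10 * z * (# 10 * z) ≡ # 10 + (0ℚ - (1ℚ - # 10 * (z * z))) * # 10
  lemma = solve-∀ ringℚ

-- The addition law is complete because 10 is not a square.
den≢0 : ∀ x₁ x₂ → den x₁ x₂ ≢ 0ℚ
den≢0 x₁ x₂ eq = 1-10z²≢0 (x₁ * x₂) (trans (lemma x₁ x₂) eq)
  where
  lemma : ∀ x₁ x₂ → 1ℚ - # 10 * (x₁ * x₂ * (x₁ * x₂)) ≡ 1ℚ - # 10 * ((x₁ * x₁) * (x₂ * x₂))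
  lemma = solve-∀ ringℚ

-- Multiplying by the fourth power of the denominator leaves a polynomial identity modulo the
-- equations of the two points; `lemma₂` gives the two cofactors.
sum-on : ∀ x₁ y₁ x₂ y₂ x y → y₁ * y₁ ≡ jacobi x₁ → y₂ * y₂ ≡ jacobi x₂ →
  x * den x₁ x₂ ≡ sumX x₁ y₁ x₂ y₂ → y * (den x₁ x₂ * den x₁ x₂) ≡ sumY x₁ y₁ x₂ y₂ → y * y ≡ jacobi x
sum-on x₁ y₁ x₂ y₂ x y on₁ on₂ eqX eqY = *-cancelʳ _ _ (D * D * (D * D)) (square-≢0 (square-≢0 (den≢0 x₁ x₂))) (begin
  y * y * (D * D * (D * D))                     ≡⟨ lemma₁ y D ⟩
  y * (D * D) * (y * (D * D))                   ≡⟨ cong₂ _*_ eqY eqY ⟩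
  sumY x₁ y₁ x₂ y₂ * sumY x₁ y₁ x₂ y₂           ≡⟨ modulo on₂ _ (modulo on₁ _ (lemma₂ x₁ y₁ x₂ y₂)) ⟩
  homogenized D (sumX x₁ y₁ x₂ y₂)              ≡⟨ cong (homogenized D) eqX ⟨
  homogenized D (x * D)                         ≡⟨ lemma₃ x D ⟩
  jacobi x * (D * D * (D * D))                  ∎)
  where
  open ≡-Reasoning
  D = den x₁ x₂
  homogenized : ℚ → ℚ → ℚ
  homogenized d n = d * d * (d * d) - # 6 * (d * d * (n * n)) + # 10 * (n * n * (n * n))
  lemma₁ : ∀ y d → y * y * (d * d * (d * d)) ≡ y * (d * d) * (y * (d * d))
  lemma₁ = solve-∀ ringℚ
  lemma₃ : ∀ x d →
    d * d * (d * d) - # 6 * (d * d * (x * d * (x * d))) + # 10 * (x * d * (x * d) * (x * d * (x * d))) ≡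
    (1ℚ - # 6 * (x * x) + # 10 * ((x * x) * (x * x))) * (d * d * (d * d))
  lemma₃ = solve-∀ ringℚ
  lemma₂ : ∀ x₁ y₁ x₂ y₂ →
    let x₁² = x₁ * x₁
        x₂² = x₂ * x₂
        D = 1ℚ - # 10 * ((x₁ * x₁) * (x₂ * x₂))
        X = x₁ * y₂ + x₂ * y₁
        Y = (y₁ * y₂ - # 6 * (x₁ * x₂)) * (1ℚ + # 10 * ((x₁ * x₁) * (x₂ * x₂))) + # 20 * (x₁ * x₂) * (x₁ * x₁ + x₂ * x₂)
    in Y * Y ≡
      D * D * (D * D) - # 6 * (D * D * (X * X)) + # 10 * (X * X * (X * X))
      + (y₂ * y₂ - (1ℚ - # 6 * (x₂ * x₂) + # 10 * ((x₂ * x₂) * (x₂ * x₂))))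
        * (# 10 * x₁² * (x₁² * (# 20 * x₁² * x₂² * (# 5 * x₁² * x₂² - # 2) + # 18 * x₂² - y₂ * y₂) - (# 4 * (x₁ * x₂ * y₁ * y₂ + x₂²))) + # 1)
      + (y₁ * y₁ - (1ℚ - # 6 * (x₁ * x₁) + # 10 * ((x₁ * x₁) * (x₁ * x₁))))
        * (# 2 * x₂² * (# 5 * x₂² * (# 2 * x₁² * (# 5 * x₁² * (y₂ * y₂ + # 6 * x₂² - # 1) - (# 3)) - (y₁ * y₁ + # 1)) + # 3 - (# 20 * y₂ * (x₁² * y₂ + x₁ * x₂ * y₁))) + y₂ * y₂)
  lemma₂ = solve-∀ ringℚ

sumξ sumη : ℚ → ℚ → ℚ → ℚ → ℚ
sumξ x₁ y₁ x₂ y₂ = sumX x₁ y₁ x₂ y₂ /[ den x₁ x₂ , den≢0 x₁ x₂ ]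
sumη x₁ y₁ x₂ y₂ = sumY x₁ y₁ x₂ y₂ /[ den x₁ x₂ * den x₁ x₂ , square-≢0 (den≢0 x₁ x₂) ]

infixl 7 _∙_

opaque
  _∙_ : 𝕁 → 𝕁 → 𝕁
  point x₁ y₁ p₁ ∙ point x₂ y₂ p₂ = point (sumξ x₁ y₁ x₂ y₂) (sumη x₁ y₁ x₂ y₂)
    (sum-on x₁ y₁ x₂ y₂ (sumξ x₁ y₁ x₂ y₂) (sumη x₁ y₁ x₂ y₂) p₁ p₂
      (÷-cancel (sumX x₁ y₁ x₂ y₂) (den x₁ x₂) (den≢0 x₁ x₂))
      (÷-cancel (sumY x₁ y₁ x₂ y₂) (den x₁ x₂ * den x₁ x₂) (square-≢0 (den≢0 x₁ x₂))))

  ξ-∙ : ∀ P Q → ξ (P ∙ Q) * den (ξ P) (ξ Q) ≡ sumX (ξ P) (η P) (ξ Q) (η Q)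
  ξ-∙ P Q = ÷-cancel _ _ (den≢0 (ξ P) (ξ Q))

  η-∙ : ∀ P Q → η (P ∙ Q) * (den (ξ P) (ξ Q) * den (ξ P) (ξ Q)) ≡ sumY (ξ P) (η P) (ξ Q) (η Q)
  η-∙ P Q = ÷-cancel _ _ (square-≢0 (den≢0 (ξ P) (ξ Q)))

-- The denominators never vanish, so the cross-multiplied equations determine the sum. Concrete sums
-- are identified in this way, without unfolding the quotients of the addition law.
∙-unique : ∀ {P Q R} → ξ R * den (ξ P) (ξ Q) ≡ sumX (ξ P) (η P) (ξ Q) (η Q) →
  η R * (den (ξ P) (ξ Q) * den (ξ P) (ξ Q)) ≡ sumY (ξ P) (η P) (ξ Q) (η Q) → P ∙ Q ≡ R
∙-unique {P} {Q} eqX eqY = J-≡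
  (*-cancelʳ _ _ _ (den≢0 (ξ P) (ξ Q)) (trans (ξ-∙ P Q) (sym eqX)))
  (*-cancelʳ _ _ _ (square-≢0 (den≢0 (ξ P) (ξ Q))) (trans (η-∙ P Q) (sym eqY)))

O : 𝕁
O = point 0ℚ 1ℚ refl

infix 8 _⁻¹

_⁻¹ : 𝕁 → 𝕁
P ⁻¹ = point (- ξ P) (η P) (trans (on P) (lemma (ξ P)))
  where
  lemma : ∀ x → 1ℚ - # 6 * (x * x) + # 10 * ((x * x) * (x * x)) ≡
    1ℚ - # 6 * (- x * - x) + # 10 * ((- x * - x) * (- x * - x))
  lemma = solve-∀ ringℚ

∙-comm : ∀ P Q → P ∙ Q ≡ Q ∙ P
∙-comm P Q = ∙-unique {P} {Q}
  (trans (cong (ξ (Q ∙ P) *_) (den-comm (ξ P) (ξ Q))) (trans (ξ-∙ Q P) (X-comm (ξ Q) (η Q) (ξ P) (η P))))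
  (trans (cong (λ d → η (Q ∙ P) * (d * d)) (den-comm (ξ P) (ξ Q)))
    (trans (η-∙ Q P) (Y-comm (ξ Q) (η Q) (ξ P) (η P))))
  where
  den-comm : ∀ x₁ x₂ → 1ℚ - # 10 * ((x₁ * x₁) * (x₂ * x₂)) ≡ 1ℚ - # 10 * ((x₂ * x₂) * (x₁ * x₁))
  den-comm = solve-∀ ringℚ
  X-comm : ∀ x₁ y₁ x₂ y₂ → x₁ * y₂ + x₂ * y₁ ≡ x₂ * y₁ + x₁ * y₂
  X-comm = solve-∀ ringℚ
  Y-comm : ∀ x₁ y₁ x₂ y₂ →
    (y₁ * y₂ - # 6 * (x₁ * x₂)) * (1ℚ + # 10 * ((x₁ * x₁) * (x₂ * x₂))) + # 20 * (x₁ * x₂) * (x₁ * x₁ + x₂ * x₂) ≡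
    (y₂ * y₁ - # 6 * (x₂ * x₁)) * (1ℚ + # 10 * ((x₂ * x₂) * (x₁ * x₁))) + # 20 * (x₂ * x₁) * (x₂ * x₂ + x₁ * x₁)
  Y-comm = solve-∀ ringℚ

∙-identityˡ : ∀ P → O ∙ P ≡ P
∙-identityˡ P = ∙-unique {O} {P} (X-id (ξ P) (η P)) (Y-id (ξ P) (η P))
  where
  X-id : ∀ x y → x * (1ℚ - # 10 * ((0ℚ * 0ℚ) * (x * x))) ≡ 0ℚ * y + x * 1ℚ
  X-id = solve-∀ ringℚ
  Y-id : ∀ x y → let D = 1ℚ - # 10 * ((0ℚ * 0ℚ) * (x * x)) in y * (D * D) ≡
    (1ℚ * y - # 6 * (0ℚ * x)) * (1ℚ + # 10 * ((0ℚ * 0ℚ) * (x * x))) + # 20 * (0ℚ * x) * (0ℚ * 0ℚ + x * x)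
  Y-id = solve-∀ ringℚ

∙-identityʳ : ∀ P → P ∙ O ≡ P
∙-identityʳ P = trans (∙-comm P O) (∙-identityˡ P)

∙-inverseˡ : ∀ P → P ⁻¹ ∙ P ≡ O
∙-inverseˡ P = ∙-unique {P ⁻¹} {P} (X-inv (ξ P) (η P)) (sym (modulo (on P) _ (Y-inv (ξ P) (η P))))
  where
  X-inv : ∀ x y → 0ℚ * (1ℚ - # 10 * ((- x * - x) * (x * x))) ≡ - x * y + x * y
  X-inv = solve-∀ ringℚ
  Y-inv : ∀ x y → let D = 1ℚ - # 10 * ((- x * - x) * (x * x)) in
    (y * y - # 6 * (- x * x)) * (1ℚ + # 10 * ((- x * - x) * (x * x))) + # 20 * (- x * x) * (- x * - x + x * x) ≡
    1ℚ * (D * D)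
    + (y * y - (1ℚ - # 6 * (x * x) + # 10 * ((x * x) * (x * x)))) * (1ℚ + # 10 * ((x * x) * (x * x)))
  Y-inv = solve-∀ ringℚ

∙-inverseʳ : ∀ P → P ∙ P ⁻¹ ≡ O
∙-inverseʳ P = trans (∙-comm P (P ⁻¹)) (∙-inverseˡ P)

-- Numerator and denominator of the x-coordinate of P ∙ Q ∙ R, both multiplied by the square of
-- `den` at P and Q so that they become polynomials in the six coordinates.
tripleX tripleD : ℚ → ℚ → ℚ → ℚ → ℚ → ℚ → ℚ
tripleX x₁ y₁ x₂ y₂ x₃ y₃ = den x₁ x₂ * sumX x₁ y₁ x₂ y₂ * y₃ + x₃ * sumY x₁ y₁ x₂ y₂
tripleD x₁ y₁ x₂ y₂ x₃ y₃ =
  den x₁ x₂ * den x₁ x₂ - # 10 * (sumX x₁ y₁ x₂ y₂ * sumX x₁ y₁ x₂ y₂ * (x₃ * x₃))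

ξ-triple : ∀ P Q R → ξ (P ∙ Q ∙ R) * tripleD (ξ P) (η P) (ξ Q) (η Q) (ξ R) (η R)
  ≡ tripleX (ξ P) (η P) (ξ Q) (η Q) (ξ R) (η R)
ξ-triple P Q R = begin
  ξ (S ∙ R) * (D * D - # 10 * (X * X * (ξ R * ξ R)))
    ≡⟨ cong (λ X → ξ (S ∙ R) * (D * D - # 10 * (X * X * (ξ R * ξ R)))) (ξ-∙ P Q) ⟨
  ξ (S ∙ R) * (D * D - # 10 * (ξ S * D * (ξ S * D) * (ξ R * ξ R)))
    ≡⟨ lemma₁ (ξ (S ∙ R)) D (ξ S) (ξ R) ⟩
  ξ (S ∙ R) * den (ξ S) (ξ R) * (D * D)
    ≡⟨ cong (_* (D * D)) (ξ-∙ S R) ⟩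
  (ξ S * η R + ξ R * η S) * (D * D)
    ≡⟨ lemma₂ D (ξ S) (η S) (ξ R) (η R) ⟩
  D * (ξ S * D) * η R + ξ R * (η S * (D * D))
    ≡⟨ cong₂ (λ X Y → D * X * η R + ξ R * Y) (ξ-∙ P Q) (η-∙ P Q) ⟩
  tripleX (ξ P) (η P) (ξ Q) (η Q) (ξ R) (η R) ∎
  where
  open ≡-Reasoning
  S = P ∙ Q
  D = den (ξ P) (ξ Q)
  X = sumX (ξ P) (η P) (ξ Q) (η Q)
  lemma₁ : ∀ z d s r → z * (d * d - # 10 * (s * d * (s * d) * (r * r))) ≡
    z * (1ℚ - # 10 * ((s * s) * (r * r))) * (d * d)
  lemma₁ = solve-∀ ringℚ
  lemma₂ : ∀ d s t r v → (s * v + r * t) * (d * d) ≡ d * (s * d) * v + r * (t * (d * d))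
  lemma₂ = solve-∀ ringℚ

tripleD≢0 : ∀ P Q R → tripleD (ξ P) (η P) (ξ Q) (η Q) (ξ R) (η R) ≢ 0ℚ
tripleD≢0 P Q R eq = *-≢0 (den≢0 (ξ S) (ξ R)) (square-≢0 (den≢0 (ξ P) (ξ Q)))
  (trans (lemma D (ξ S) (ξ R))
    (trans (cong (λ X → D * D - # 10 * (X * X * (ξ R * ξ R))) (ξ-∙ P Q)) eq))
  where
  S = P ∙ Q
  D = den (ξ P) (ξ Q)
  lemma : ∀ d s r → (1ℚ - # 10 * ((s * s) * (r * r))) * (d * d) ≡ d * d - # 10 * (s * d * (s * d) * (r * r))
  lemma = solve-∀ ringℚ

-- By commutativity the right-hand side is the triple sum of Q, R, P, so that `ξ-triple` applies to
-- both sides. Cross-multiplication leaves one identity modulo the three equations of the points.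
ξ-assoc : ∀ P Q R → ξ (P ∙ Q ∙ R) ≡ ξ (P ∙ (Q ∙ R))
ξ-assoc P Q R = *-cancelʳ _ _ (dₗ * dᵣ) (*-≢0 (tripleD≢0 P Q R) (tripleD≢0 Q R P)) (begin
  ξ (P ∙ Q ∙ R) * (dₗ * dᵣ)      ≡⟨ ℚ.*-assoc (ξ (P ∙ Q ∙ R)) dₗ dᵣ ⟨
  ξ (P ∙ Q ∙ R) * dₗ * dᵣ        ≡⟨ cong (_* dᵣ) (ξ-triple P Q R) ⟩
  nₗ * dᵣ                        ≡⟨ modulo (on P) _ (modulo (on Q) _ (modulo (on R) _
                                      (identity (ξ P) (η P) (ξ Q) (η Q) (ξ R) (η R)))) ⟩
  nᵣ * dₗ                        ≡⟨ cong (_* dₗ) (ξ-triple Q R P) ⟨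
  ξ (Q ∙ R ∙ P) * dᵣ * dₗ        ≡⟨ cong (λ S → ξ S * dᵣ * dₗ) (∙-comm (Q ∙ R) P) ⟩
  ξ (P ∙ (Q ∙ R)) * dᵣ * dₗ      ≡⟨ lemma (ξ (P ∙ (Q ∙ R))) dᵣ dₗ ⟩
  ξ (P ∙ (Q ∙ R)) * (dₗ * dᵣ)    ∎)
  where
  open ≡-Reasoning
  dₗ = tripleD (ξ P) (η P) (ξ Q) (η Q) (ξ R) (η R)
  dᵣ = tripleD (ξ Q) (η Q) (ξ R) (η R) (ξ P) (η P)
  nₗ = tripleX (ξ P) (η P) (ξ Q) (η Q) (ξ R) (η R)
  nᵣ = tripleX (ξ Q) (η Q) (ξ R) (η R) (ξ P) (η P)
  lemma : ∀ z r l → z * r * l ≡ z * (l * r)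
  lemma = solve-∀ ringℚ
  identity : ∀ x₁ y₁ x₂ y₂ x₃ y₃ →
    let x₁² = x₁ * x₁
        x₂² = x₂ * x₂
        D = 1ℚ - # 10 * ((x₁ * x₁) * (x₂ * x₂))
        X = x₁ * y₂ + x₂ * y₁
        Y = (y₁ * y₂ - # 6 * (x₁ * x₂)) * (1ℚ + # 10 * ((x₁ * x₁) * (x₂ * x₂))) + # 20 * (x₁ * x₂) * (x₁ * x₁ + x₂ * x₂)
        x₃² = x₃ * x₃
        D′ = 1ℚ - # 10 * ((x₂ * x₂) * (x₃ * x₃))
        X′ = x₂ * y₃ + x₃ * y₂
        Y′ = (y₂ * y₃ - # 6 * (x₂ * x₃)) * (1ℚ + # 10 * ((x₂ * x₂) * (x₃ * x₃))) + # 20 * (x₂ * x₃) * (x₂ * x₂ + x₃ * x₃)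
    in (D * X * y₃ + x₃ * Y) * (D′ * D′ - # 10 * (X′ * X′ * (x₁ * x₁))) ≡
      (D′ * X′ * y₁ + x₁ * Y′) * (D * D - # 10 * (X * X * (x₃ * x₃)))
      + (y₁ * y₁ - (1ℚ - # 6 * (x₁ * x₁) + # 10 * ((x₁ * x₁) * (x₁ * x₁))))
        * (# 10 * x₃² * (x₁ * (# 2 * x₂ * x₃ * (x₂² * (# 10 * x₃² * (# 1 - y₂ * y₂ - # 3 * x₂²) + # 10 * x₂² - # 3) + y₂ * y₂) + x₂² * y₂ * y₃ * (# 3 - # 10 * x₂² * x₃²)) + x₂² * y₁ * (x₂ * y₃ * (# 1 - # 10 * x₂² * x₃²) + x₃ * y₂ * (# 1 - # 10 * x₂² * x₃²))))
      + (y₂ * y₂ - (1ℚ - # 6 * (x₂ * x₂) + # 10 * ((x₂ * x₂) * (x₂ * x₂))))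
        * (# 20 * (x₁ * (x₂ * x₃ * (# 10 * x₂² * (x₁² * (x₁² * (x₃² * (# 3 - # 10 * x₃²) + y₃ * y₃) + # 3 * x₃² * x₃²) - (x₃² * x₃²)) + x₁² * (# 10 * x₃² * x₃² - y₃ * y₃ - # 6 * x₃²) + x₃²) + # 5 * x₁² * x₂² * x₃² * y₂ * y₃ * (x₁² + x₃²)) + # 5 * x₁² * x₂² * x₃² * y₁ * (x₂ * y₃ * (x₃² - x₁²) - (x₃ * y₂ * (x₁² + x₃²)))))
      + (y₃ * y₃ - (1ℚ - # 6 * (x₃ * x₃) + # 10 * ((x₃ * x₃) * (x₃ * x₃))))
        * (# 10 * x₁² * (x₁ * (# 2 * x₂ * x₃ * (x₂² * (# 10 * x₂² * (x₁² * (# 10 * x₂² - # 3) - (# 2)) + # 9) - (# 1)) + x₂² * y₂ * y₃ * (# 10 * x₁² * x₂² - # 1)) + x₂² * y₁ * (x₂ * y₃ * (# 10 * x₁² * x₂² - # 1) + x₃ * y₂ * (# 10 * x₁² * x₂² - # 3))))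
  identity = solve-∀ ringℚ

-- The x-coordinate is a case of `ξ-assoc`. Only here is a y-coordinate of a triple sum expanded;
-- the case R = Q⁻¹ involves two points instead of three, and `∙-assoc` derives the general
-- y-coordinate from it.
cancelʳ : ∀ P Q → P ∙ Q ∙ Q ⁻¹ ≡ P
cancelʳ P Q = J-≡
  (trans (ξ-assoc P Q (Q ⁻¹)) (cong ξ (trans (cong (P ∙_) (∙-inverseʳ Q)) (∙-identityʳ P))))
  (*-cancelʳ _ _ (E * E) (square-≢0 (tripleD≢0 P Q (Q ⁻¹))) (begin
    η (S ∙ Q ⁻¹) * (E * E)
      ≡⟨ cong (λ X → η (S ∙ Q ⁻¹) * ((D * D - # 10 * (X * X * (- ξ Q * - ξ Q))) * (D * D - # 10 * (X * X * (- ξ Q * - ξ Q))))) (ξ-∙ P Q) ⟨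
    η (S ∙ Q ⁻¹) * ((D * D - # 10 * (ξ S * D * (ξ S * D) * (- ξ Q * - ξ Q)))
                  * (D * D - # 10 * (ξ S * D * (ξ S * D) * (- ξ Q * - ξ Q))))
      ≡⟨ lemma₁ (η (S ∙ Q ⁻¹)) D (ξ S) (- ξ Q) ⟩
    η (S ∙ Q ⁻¹) * (den (ξ S) (- ξ Q) * den (ξ S) (- ξ Q)) * (D * D * (D * D))
      ≡⟨ cong (_* (D * D * (D * D))) (η-∙ S (Q ⁻¹)) ⟩
    sumY (ξ S) (η S) (- ξ Q) (η Q) * (D * D * (D * D))
      ≡⟨ lemma₂ D (ξ S) (η S) (ξ Q) (η Q) ⟩
    homogenized D (ξ S * D) (η S * (D * D)) (ξ Q) (η Q)
      ≡⟨ cong₂ (λ X Y → homogenized D X Y (ξ Q) (η Q)) (ξ-∙ P Q) (η-∙ P Q) ⟩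
    homogenized D X Y (ξ Q) (η Q)
      ≡⟨ modulo (on Q) _ (modulo (on P) _ (identity (ξ P) (η P) (ξ Q) (η Q))) ⟩
    η P * (E * E) ∎))
  where
  open ≡-Reasoning
  S = P ∙ Q
  D = den (ξ P) (ξ Q)
  X = sumX (ξ P) (η P) (ξ Q) (η Q)
  Y = sumY (ξ P) (η P) (ξ Q) (η Q)
  E = tripleD (ξ P) (η P) (ξ Q) (η Q) (- ξ Q) (η Q)
  homogenized : ℚ → ℚ → ℚ → ℚ → ℚ → ℚ
  homogenized d n m x y = (m * y + # 6 * (n * d * x)) * (d * d + # 10 * (n * n * (x * x)))
    - # 20 * (n * d * x) * (n * n + d * d * (x * x))
  lemma₁ : ∀ z d s r →
    z * ((d * d - # 10 * (s * d * (s * d) * (r * r))) * (d * d - # 10 * (s * d * (s * d) * (r * r)))) ≡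
    z * ((1ℚ - # 10 * ((s * s) * (r * r))) * (1ℚ - # 10 * ((s * s) * (r * r)))) * (d * d * (d * d))
  lemma₁ = solve-∀ ringℚ
  lemma₂ : ∀ d s t x y →
    ((t * y - # 6 * (s * - x)) * (1ℚ + # 10 * ((s * s) * (- x * - x)))
      + # 20 * (s * - x) * (s * s + - x * - x)) * (d * d * (d * d)) ≡
    (t * (d * d) * y + # 6 * (s * d * d * x)) * (d * d + # 10 * (s * d * (s * d) * (x * x)))
      - # 20 * (s * d * d * x) * (s * d * (s * d) + d * d * (x * x))
  lemma₂ = solve-∀ ringℚ
  identity : ∀ x₁ y₁ x₂ y₂ →
    let x₁² = x₁ * x₁
        x₂² = x₂ * x₂
        D = 1ℚ - # 10 * ((x₁ * x₁) * (x₂ * x₂))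
        X = x₁ * y₂ + x₂ * y₁
        Y = (y₁ * y₂ - # 6 * (x₁ * x₂)) * (1ℚ + # 10 * ((x₁ * x₁) * (x₂ * x₂))) + # 20 * (x₁ * x₂) * (x₁ * x₁ + x₂ * x₂)
        E = D * D - # 10 * (X * X * (- x₂ * - x₂))
    in (Y * y₂ + # 6 * (X * D * x₂)) * (D * D + # 10 * (X * X * (x₂ * x₂)))
         - # 20 * (X * D * x₂) * (X * X + D * D * (x₂ * x₂)) ≡
      y₁ * (E * E)
      + (y₂ * y₂ - (1ℚ - # 6 * (x₂ * x₂) + # 10 * ((x₂ * x₂) * (x₂ * x₂))))
        * (# 10 * x₂² * y₁ * (x₁² * (# 20 * x₁² * x₂² * (# 3 - # 10 * x₁² * x₂²) + y₂ * y₂ - # 4 - # 6 * x₂²) + x₂²) + y₁ + # 20 * x₁ * x₂ * y₂ * (# 2 * x₁² * x₂² * (# 15 * x₁² - # 50 * x₁² * x₁² * x₂² - # 3) - (x₁²) + x₂²))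
      + (y₁ * y₁ - (1ℚ - # 6 * (x₁ * x₁) + # 10 * ((x₁ * x₁) * (x₁ * x₁))))
        * (# 10 * x₂² * (x₂² * y₁ * (# 2 * x₂² * (# 5 * x₂² * (# 10 * x₁² * x₁² - y₁ * y₁ - # 1) + # 3 - # 25 * x₁² * y₂ * y₂ - # 10 * x₁² - # 20 * x₁ * x₂ * y₁ * y₂) + y₂ * y₂) + # 2 * x₁ * x₂ * y₂ * (# 2 * x₂² * (# 3 - # 5 * x₁² * y₂ * y₂ - # 5 * x₂²) + y₂ * y₂ - # 1)))
  identity = solve-∀ ringℚ

-- x = 0 forces y² = 1, so R has order at most two and translation by it multiplies both coordinates
-- by the sign y.
scale : ∀ P R → ξ R ≡ 0ℚ → ξ (P ∙ R) ≡ ξ P * η R × η (P ∙ R) ≡ η P * η R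
scale P R@(point _ y _) refl = cong ξ eq , cong η eq
  where
  p = on R
  lemma₀ : ∀ x y → x * y * (x * y) ≡ x * x + (y * y - (1ℚ - # 6 * (0ℚ * 0ℚ) + # 10 * ((0ℚ * 0ℚ) * (0ℚ * 0ℚ)))) * (x * x)
  lemma₀ = solve-∀ ringℚ
  on′ : η P * y * (η P * y) ≡ jacobi (ξ P * y)
  on′ = trans (modulo p _ (lemma₀ (η P) y)) (trans (on P)
    (cong (λ s → 1ℚ - # 6 * s + # 10 * (s * s)) (sym (modulo p _ {r = ξ P * ξ P} (lemma₀ (ξ P) y)))))
  X-scale : ∀ x₁ y₁ y → x₁ * y * (1ℚ - # 10 * ((x₁ * x₁) * (0ℚ * 0ℚ))) ≡ x₁ * y + 0ℚ * y₁
  X-scale = solve-∀ ringℚ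
  Y-scale : ∀ x₁ y₁ y → let D = 1ℚ - # 10 * ((x₁ * x₁) * (0ℚ * 0ℚ)) in y₁ * y * (D * D) ≡
    (y₁ * y - # 6 * (x₁ * 0ℚ)) * (1ℚ + # 10 * ((x₁ * x₁) * (0ℚ * 0ℚ))) + # 20 * (x₁ * 0ℚ) * (x₁ * x₁ + 0ℚ * 0ℚ)
  Y-scale = solve-∀ ringℚ
  eq : P ∙ R ≡ point (ξ P * y) (η P * y) on′
  eq = ∙-unique {P} {R} (X-scale (ξ P) (η P) y) (Y-scale (ξ P) (η P) y)

-- The x-coordinates of both sides agree, also after adding R⁻¹; when ξ R ≠ 0 this
-- determines the y-coordinate.
∙-assoc : ∀ P Q R → P ∙ Q ∙ R ≡ P ∙ (Q ∙ R)
∙-assoc P Q R = J-≡ ξ-eq ([ R₀ , (λ e → minus≡0 _ _ e) ]′ (*-≡0-⊎ product≡0))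
  where
  open ≡-Reasoning
  L = P ∙ Q ∙ R
  L′ = P ∙ (Q ∙ R)
  ξ-eq = ξ-assoc P Q R
  shifted : ξ (L ∙ R ⁻¹) ≡ ξ (L′ ∙ R ⁻¹)
  shifted = begin
    ξ (L ∙ R ⁻¹)                ≡⟨ cong ξ (cancelʳ (P ∙ Q) R) ⟩
    ξ (P ∙ Q)                   ≡⟨ cong (λ S → ξ (P ∙ S)) (cancelʳ Q R) ⟨
    ξ (P ∙ (Q ∙ R ∙ R ⁻¹))      ≡⟨ ξ-assoc P (Q ∙ R) (R ⁻¹) ⟨
    ξ (L′ ∙ R ⁻¹)               ∎
  lemma : ∀ x r v y y′ → r * (y - y′) ≡ 0ℚ + (x * v + - r * y - (x * v + - r * y′)) * - 1ℚ
  lemma = solve-∀ ringℚ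
  numerators : ξ L * η R + - ξ R * η L ≡ ξ L * η R + - ξ R * η L′
  numerators = begin
    ξ L * η R + - ξ R * η L                   ≡⟨ ξ-∙ L (R ⁻¹) ⟨
    ξ (L ∙ R ⁻¹) * den (ξ L) (- ξ R)          ≡⟨ cong₂ (λ z w → z * den w (- ξ R)) shifted ξ-eq ⟩
    ξ (L′ ∙ R ⁻¹) * den (ξ L′) (- ξ R)        ≡⟨ ξ-∙ L′ (R ⁻¹) ⟩
    ξ L′ * η R + - ξ R * η L′                 ≡⟨ cong (λ w → w * η R + - ξ R * η L′) ξ-eq ⟨
    ξ L * η R + - ξ R * η L′                  ∎
  product≡0 : ξ R * (η L - η L′) ≡ 0ℚ
  product≡0 = modulo numerators (- 1ℚ) (lemma (ξ L) (ξ R) (η R) (η L) (η L′))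
  R₀ : ξ R ≡ 0ℚ → η L ≡ η L′
  R₀ r≡0 = *-cancelʳ _ _ (den (ξ P) (ξ Q) * den (ξ P) (ξ Q)) (square-≢0 (den≢0 (ξ P) (ξ Q))) (begin
    η L * (D * D)                                  ≡⟨ cong (_* (D * D)) (proj₂ (scale (P ∙ Q) R r≡0)) ⟩
    η (P ∙ Q) * η R * (D * D)                      ≡⟨ lemma₁ (η (P ∙ Q)) (η R) (D * D) ⟩
    η R * (η (P ∙ Q) * (D * D))                    ≡⟨ cong (η R *_) (η-∙ P Q) ⟩
    η R * sumY (ξ P) (η P) (ξ Q) (η Q)             ≡⟨ modulo ε²≡1 _ (lemma₂ (ξ P) (η P) (ξ Q) (η Q) (η R)) ⟩
    sumY (ξ P) (η P) (ξ Q * η R) (η Q * η R)       ≡⟨ cong₂ (sumY (ξ P) (η P)) (proj₁ QR) (proj₂ QR) ⟨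
    sumY (ξ P) (η P) (ξ (Q ∙ R)) (η (Q ∙ R))       ≡⟨ η-∙ P (Q ∙ R) ⟨
    η L′ * (den (ξ P) (ξ (Q ∙ R)) * den (ξ P) (ξ (Q ∙ R)))
      ≡⟨ cong (λ d → η L′ * (d * d)) (trans (cong (den (ξ P)) (proj₁ QR))
           (modulo ε²≡1 _ {r = D} (lemma₃ (ξ P) (ξ Q) (η R)))) ⟩
    η L′ * (D * D)                                 ∎)
    where
    D = den (ξ P) (ξ Q)
    QR = scale Q R r≡0
    ε²≡1 : η R * η R ≡ 1ℚ
    ε²≡1 = trans (on R) (cong jacobi r≡0)
    lemma₁ : ∀ s r d → s * r * d ≡ r * (s * d)
    lemma₁ = solve-∀ ringℚ
    lemma₂ : ∀ x₁ y₁ x₂ y₂ e →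
      e * ((y₁ * y₂ - # 6 * (x₁ * x₂)) * (1ℚ + # 10 * ((x₁ * x₁) * (x₂ * x₂)))
        + # 20 * (x₁ * x₂) * (x₁ * x₁ + x₂ * x₂)) ≡
      (y₁ * (y₂ * e) - # 6 * (x₁ * (x₂ * e))) * (1ℚ + # 10 * ((x₁ * x₁) * (x₂ * e * (x₂ * e))))
        + # 20 * (x₁ * (x₂ * e)) * (x₁ * x₁ + x₂ * e * (x₂ * e))
      + (e * e - 1ℚ)
        * (- e * ((y₁ * y₂ - # 6 * (x₁ * x₂)) * (# 10 * ((x₁ * x₁) * (x₂ * x₂))) + # 20 * (x₁ * x₂) * (x₂ * x₂)))
    lemma₂ = solve-∀ ringℚ
    lemma₃ : ∀ x₁ x₂ e → 1ℚ - # 10 * ((x₁ * x₁) * (x₂ * e * (x₂ * e))) ≡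
      1ℚ - # 10 * ((x₁ * x₁) * (x₂ * x₂)) + (e * e - 1ℚ) * - (# 10 * ((x₁ * x₁) * (x₂ * x₂)))
    lemma₃ = solve-∀ ringℚ

J-group : AbelianGroup 0ℓ 0ℓ
J-group = record
  { Carrier = 𝕁
  ; _≈_ = _≡_
  ; _∙_ = _∙_
  ; ε = O
  ; _⁻¹ = _⁻¹
  ; isAbelianGroup = record
    { isGroup = record
      { isMonoid = record
        { isSemigroup = record
          { isMagma = record { isEquivalence = isEquivalence ; ∙-cong = cong₂ _∙_ }
          ; assoc = ∙-assoc
          }
        ; identity = ∙-identityˡ , ∙-identityʳ
        }
      ; inverse = ∙-inverseˡ , ∙-inverseʳ
      ; ⁻¹-cong = cong _⁻¹
      }
    ; comm = ∙-comm
    }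
  }

open Algebra.Properties.AbelianGroup J-group using (⁻¹-∙-comm)
open Algebra.Properties.CommutativeMonoid.Mult (AbelianGroup.commutativeMonoid J-group)
  using (×-homo-+; ×-assocˡ; ×-distrib-+) renaming (_×_ to _·_)
open Algebra.Properties.CommutativeSemigroup
  (CommutativeMonoid.commutativeSemigroup (AbelianGroup.commutativeMonoid J-group)) using (interchange)

-- The homomorphism from the elliptic curve to the quartic

twist : ℚ → ℚ
twist X = X * X + # 12 * X - # 4

-- (X + 6)² = 40 has no rational solution.
twist≢0 : ∀ X → twist X ≢ 0ℚ
twist≢0 X eq = √10-irrational ((X + # 6) ÷ # 2) (modulo eq _ (lemma X))
  where
  lemma : ∀ X → (X + # 6) * (1/ # 2) * ((X + # 6) * (1/ # 2)) ≡
    # 10 + (X * X + # 12 * X - # 4 - 0ℚ) * (1/ # 4)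
  lemma = solve-∀ ringℚ

curve⇒twist : ∀ X Y → OnCurve X Y → Y * Y ≡ X * twist X
curve⇒twist X Y p = trans p (lemma X)
  where
  lemma : ∀ X → X * X * X + # 12 * X * X + (- # 4) * X + 0ℚ ≡ X * (X * X + # 12 * X - # 4)
  lemma = solve-∀ ringℚ

jξ jη : ℚ → ℚ → ℚ
jξ X Y = (# 2 * Y) /[ twist X , twist≢0 X ]
jη X Y = (X * X + # 4) /[ twist X , twist≢0 X ]

jξ-twist : ∀ X Y → jξ X Y * twist X ≡ # 2 * Y
jξ-twist X Y = ÷-cancel _ _ (twist≢0 X)

jη-twist : ∀ X Y → jη X Y * twist X ≡ X * X + # 4
jη-twist X Y = ÷-cancel _ _ (twist≢0 X)

-- Since Y² = X D, the square of 2 Y / D is 4 X / D: even powers of x depend on X alone.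
ξ²-twist : ∀ X Y → OnCurve X Y → jξ X Y * jξ X Y * twist X ≡ # 4 * X
ξ²-twist X Y p = *-cancelʳ _ _ (twist X) (twist≢0 X) (begin
  jξ X Y * jξ X Y * twist X * twist X        ≡⟨ lemma₁ (jξ X Y) (twist X) ⟩
  jξ X Y * twist X * (jξ X Y * twist X)      ≡⟨ cong₂ _*_ (jξ-twist X Y) (jξ-twist X Y) ⟩
  # 2 * Y * (# 2 * Y)                        ≡⟨ modulo (curve⇒twist X Y p) _ (lemma₂ X Y (twist X)) ⟩
  # 4 * X * twist X                          ∎)
  where
  open ≡-Reasoning
  lemma₁ : ∀ x d → x * x * d * d ≡ x * d * (x * d)
  lemma₁ = solve-∀ ringℚ
  lemma₂ : ∀ X Y d → # 2 * Y * (# 2 * Y) ≡ # 4 * X * d + (Y * Y - X * d) * # 4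
  lemma₂ = solve-∀ ringℚ

j-on : ∀ X Y → OnCurve X Y → jη X Y * jη X Y ≡ jacobi (jξ X Y)
j-on X Y p = *-cancelʳ _ _ (d * d) (square-≢0 (twist≢0 X)) (begin
  jη X Y * jη X Y * (d * d)                  ≡⟨ lemma₁ (jη X Y) d ⟩
  jη X Y * d * (jη X Y * d)                  ≡⟨ cong₂ _*_ (jη-twist X Y) (jη-twist X Y) ⟩
  (X * X + # 4) * (X * X + # 4)              ≡⟨ lemma₂ X ⟩
  d * d - # 6 * (# 4 * X * d) + # 10 * (# 4 * X * (# 4 * X))
    ≡⟨ cong (λ s → d * d - # 6 * (s * d) + # 10 * (s * s)) (ξ²-twist X Y p) ⟨
  d * d - # 6 * (x₀ * x₀ * d * d) + # 10 * (x₀ * x₀ * d * (x₀ * x₀ * d))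
    ≡⟨ lemma₃ x₀ d ⟩
  jacobi (jξ X Y) * (d * d)                  ∎)
  where
  open ≡-Reasoning
  d = twist X
  x₀ = jξ X Y
  lemma₁ : ∀ x d → x * x * (d * d) ≡ x * d * (x * d)
  lemma₁ = solve-∀ ringℚ
  lemma₂ : ∀ X → let d = X * X + # 12 * X - # 4 in (X * X + # 4) * (X * X + # 4) ≡
    d * d - # 6 * (# 4 * X * d) + # 10 * (# 4 * X * (# 4 * X))
  lemma₂ = solve-∀ ringℚ
  lemma₃ : ∀ x d → d * d - # 6 * (x * x * d * d) + # 10 * (x * x * d * (x * x * d)) ≡
    (1ℚ - # 6 * (x * x) + # 10 * ((x * x) * (x * x))) * (d * d)
  lemma₃ = solve-∀ ringℚ

j-affine : ∀ X Y → OnCurve X Y → 𝕁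
j-affine X Y p = point (jξ X Y) (jη X Y) (j-on X Y p)

j-affine-neg : ∀ X Y p q → j-affine X (- Y) q ≡ j-affine X Y p ⁻¹
j-affine-neg X Y p q = J-≡ (*-cancelʳ _ _ (twist X) (twist≢0 X) (begin
  jξ X (- Y) * twist X       ≡⟨ jξ-twist X (- Y) ⟩
  # 2 * - Y                  ≡⟨ lemma₁ Y ⟩
  - (# 2 * Y)                ≡⟨ cong -_ (jξ-twist X Y) ⟨
  - (jξ X Y * twist X)       ≡⟨ lemma₂ (jξ X Y) (twist X) ⟩
  - jξ X Y * twist X         ∎)) refl
  where
  open ≡-Reasoning
  lemma₁ : ∀ Y → # 2 * - Y ≡ - (# 2 * Y)
  lemma₁ = solve-∀ ringℚ
  lemma₂ : ∀ x d → - (x * d) ≡ - x * d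
  lemma₂ = solve-∀ ringℚ

-- Vieta's relations for the points (Xᵢ , m Xᵢ + n) of the curve on a line.
record Collinear (m n X₁ X₂ X₃ : ℚ) : Set where
  field
    e₁ : X₁ + X₂ + X₃ ≡ m * m - # 12
    e₂ : X₁ * X₂ + X₁ * X₃ + X₂ * X₃ ≡ - (# 4) - # 2 * (m * n)
    e₃ : X₁ * X₂ * X₃ ≡ n * n

-- This is x(P₁ + P₂) = - x(P₃) on the quartic with all factors `twist` cleared and a common factor
-- 2 removed. The constant 160 is 10 · 4², from x² D = 4 X. Vieta's relations generate the ideal
-- modulo which it holds.
collinear-ξ : ∀ {m n X₁ X₂ X₃} → Collinear m n X₁ X₂ X₃ →
  ((m * X₁ + n) * (X₂ * X₂ + # 4) + (m * X₂ + n) * (X₁ * X₁ + # 4)) * twist X₃ ≡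
  - (m * X₃ + n) * (twist X₁ * twist X₂ - # 160 * (X₁ * X₂))
collinear-ξ {m} {n} {X₁} {X₂} {X₃} col =
  modulo e₁ _ (modulo e₂ _ (modulo e₃ _ (identity m n X₁ X₂ X₃)))
  where
  open Collinear col
  identity : ∀ m n X₁ X₂ X₃ →
    let D₁ = X₁ * X₁ + # 12 * X₁ - # 4
        D₂ = X₂ * X₂ + # 12 * X₂ - # 4
        D₃ = X₃ * X₃ + # 12 * X₃ - # 4
        α = # 4 * X₃ - X₁ * X₂ * X₃ - # 4 * X₁ - # 4 * X₂
        β = X₁ * X₂ + X₁ * X₃ + X₂ * X₃ + # 12 * (X₁ + X₂) - # 4
    in ((m * X₁ + n) * (X₂ * X₂ + # 4) + (m * X₂ + n) * (X₁ * X₁ + # 4)) * D₃ ≡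
      - (m * X₃ + n) * (D₁ * D₂ - # 160 * (X₁ * X₂))
      + (X₁ + X₂ + X₃ - (m * m - # 12)) * (# 2 * n * α)
      + (X₁ * X₂ + X₁ * X₃ + X₂ * X₃ - (- (# 4) - # 2 * (m * n))) * (m * α + n * β)
      + (X₁ * X₂ * X₃ - n * n) * (# 2 * m * β)
  identity = solve-∀ ringℚ

j-collinear-ξ : ∀ {m n X₁ Y₁ X₂ Y₂ X₃ Y₃} (p₁ : OnCurve X₁ Y₁) (p₂ : OnCurve X₂ Y₂) →
  Collinear m n X₁ X₂ X₃ → Y₁ ≡ m * X₁ + n → Y₂ ≡ m * X₂ + n → Y₃ ≡ m * X₃ + n →
  sumX (jξ X₁ Y₁) (jη X₁ Y₁) (jξ X₂ Y₂) (jη X₂ Y₂) ≡ - jξ X₃ Y₃ * den (jξ X₁ Y₁) (jξ X₂ Y₂)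
j-collinear-ξ {m} {n} {X₁} {Y₁} {X₂} {Y₂} {X₃} {Y₃} p₁ p₂ col refl refl refl =
  *-cancelʳ _ _ (D₁ * D₂ * D₃) (*-≢0 (*-≢0 (twist≢0 X₁) (twist≢0 X₂)) (twist≢0 X₃)) (begin
    (x₁ * y₂ + x₂ * y₁) * (D₁ * D₂ * D₃)
      ≡⟨ lemma₁ x₁ y₁ x₂ y₂ D₁ D₂ D₃ ⟩
    (x₁ * D₁ * (y₂ * D₂) + x₂ * D₂ * (y₁ * D₁)) * D₃
      ≡⟨ cong (_* D₃) (cong₂ _+_ (cong₂ _*_ (jξ-twist X₁ Y₁) (jη-twist X₂ Y₂))
                                 (cong₂ _*_ (jξ-twist X₂ Y₂) (jη-twist X₁ Y₁))) ⟩
    (# 2 * Y₁ * (X₂ * X₂ + # 4) + # 2 * Y₂ * (X₁ * X₁ + # 4)) * D₃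
      ≡⟨ modulo (collinear-ξ col) _ (lemma₂ Y₁ Y₂ Y₃ (X₁ * X₁ + # 4) (X₂ * X₂ + # 4) D₃ (D₁ * D₂ - # 160 * (X₁ * X₂))) ⟩
    - (# 2 * Y₃) * (D₁ * D₂ - # 160 * (X₁ * X₂))
      ≡⟨ lemma₃ Y₃ (D₁ * D₂) X₁ X₂ ⟩
    - (# 2 * Y₃) * (D₁ * D₂ - # 10 * ((# 4 * X₁) * (# 4 * X₂)))
      ≡⟨ cong₂ (λ s t → - s * (D₁ * D₂ - # 10 * t)) (jξ-twist X₃ Y₃) (cong₂ _*_ (ξ²-twist X₁ Y₁ p₁) (ξ²-twist X₂ Y₂ p₂)) ⟨
    - (x₃ * D₃) * (D₁ * D₂ - # 10 * (x₁ * x₁ * D₁ * (x₂ * x₂ * D₂)))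
      ≡⟨ lemma₄ x₁ x₂ x₃ D₁ D₂ D₃ ⟩
    - x₃ * den x₁ x₂ * (D₁ * D₂ * D₃) ∎)
  where
  open ≡-Reasoning
  D₁ = twist X₁
  D₂ = twist X₂
  D₃ = twist X₃
  x₁ = jξ X₁ Y₁
  y₁ = jη X₁ Y₁
  x₂ = jξ X₂ Y₂
  y₂ = jη X₂ Y₂
  x₃ = jξ X₃ Y₃
  lemma₁ : ∀ x₁ y₁ x₂ y₂ d₁ d₂ d₃ → (x₁ * y₂ + x₂ * y₁) * (d₁ * d₂ * d₃) ≡
    (x₁ * d₁ * (y₂ * d₂) + x₂ * d₂ * (y₁ * d₁)) * d₃
  lemma₁ = solve-∀ ringℚ
  lemma₂ : ∀ Y₁ Y₂ Y₃ a b d e → (# 2 * Y₁ * b + # 2 * Y₂ * a) * d ≡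
    - (# 2 * Y₃) * e + ((Y₁ * b + Y₂ * a) * d - - Y₃ * e) * # 2
  lemma₂ = solve-∀ ringℚ
  lemma₃ : ∀ Y d X₁ X₂ → - (# 2 * Y) * (d - # 160 * (X₁ * X₂)) ≡
    - (# 2 * Y) * (d - # 10 * ((# 4 * X₁) * (# 4 * X₂)))
  lemma₃ = solve-∀ ringℚ
  lemma₄ : ∀ x₁ x₂ x₃ d₁ d₂ d₃ → - (x₃ * d₃) * (d₁ * d₂ - # 10 * (x₁ * x₁ * d₁ * (x₂ * x₂ * d₂))) ≡
    - x₃ * (1ℚ - # 10 * ((x₁ * x₁) * (x₂ * x₂))) * (d₁ * d₂ * d₃)
  lemma₄ = solve-∀ ringℚ

Collinear-swap : ∀ {m n X₁ X₂ X₃} → Collinear m n X₁ X₂ X₃ → Collinear m n X₂ X₁ X₃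
Collinear-swap {X₁ = X₁} {X₂} {X₃} col = record
  { e₁ = trans (s₁ X₁ X₂ X₃) e₁ ; e₂ = trans (s₂ X₁ X₂ X₃) e₂ ; e₃ = trans (s₃ X₁ X₂ X₃) e₃ }
  where
  open Collinear col
  s₁ : ∀ a b c → b + a + c ≡ a + b + c
  s₁ = solve-∀ ringℚ
  s₂ : ∀ a b c → b * a + b * c + a * c ≡ a * b + a * c + b * c
  s₂ = solve-∀ ringℚ
  s₃ : ∀ a b c → b * a * c ≡ a * b * c
  s₃ = solve-∀ ringℚ

Collinear-rotate : ∀ {m n X₁ X₂ X₃} → Collinear m n X₁ X₂ X₃ → Collinear m n X₃ X₂ X₁
Collinear-rotate {X₁ = X₁} {X₂} {X₃} col = record
  { e₁ = trans (s₁ X₁ X₂ X₃) e₁ ; e₂ = trans (s₂ X₁ X₂ X₃) e₂ ; e₃ = trans (s₃ X₁ X₂ X₃) e₃ }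
  where
  open Collinear col
  s₁ : ∀ a b c → c + b + a ≡ a + b + c
  s₁ = solve-∀ ringℚ
  s₂ : ∀ a b c → c * b + c * a + b * a ≡ a * b + a * c + b * c
  s₂ = solve-∀ ringℚ
  s₃ : ∀ a b c → c * b * a ≡ a * b * c
  s₃ = solve-∀ ringℚ

-- Subtracting the second point from the sum determines the second coordinate as well.
j-collinear : ∀ {m n X₁ Y₁ X₂ Y₂ X₃ Y₃} (p₁ : OnCurve X₁ Y₁) (p₂ : OnCurve X₂ Y₂) (p₃ : OnCurve X₃ Y₃) →
  Collinear m n X₁ X₂ X₃ → Y₁ ≡ m * X₁ + n → Y₂ ≡ m * X₂ + n → Y₃ ≡ m * X₃ + n →
  ¬ (jξ X₂ Y₂ ≡ 0ℚ) → j-affine X₁ Y₁ p₁ ∙ j-affine X₂ Y₂ p₂ ≡ j-affine X₃ Y₃ p₃ ⁻¹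
j-collinear {m} {n} {X₁} {Y₁} {X₂} {Y₂} {X₃} {Y₃} p₁ p₂ p₃ col l₁ l₂ l₃ x₂≢0 =
  J-≡ ξ-eq (*-cancelˡ x₂ x₂≢0 (modulo difference _ (lemma₂ (ξ S) x₂ y₂ (η S) y₃)))
  where
  open ≡-Reasoning
  S = j-affine X₁ Y₁ p₁ ∙ j-affine X₂ Y₂ p₂
  x₁ = jξ X₁ Y₁
  x₂ = jξ X₂ Y₂
  y₂ = jη X₂ Y₂
  x₃ = jξ X₃ Y₃
  y₃ = jη X₃ Y₃
  ξ-eq : ξ S ≡ - x₃
  ξ-eq = *-cancelʳ _ _ (den x₁ x₂) (den≢0 x₁ x₂)
    (trans (ξ-∙ (j-affine X₁ Y₁ p₁) (j-affine X₂ Y₂ p₂)) (j-collinear-ξ p₁ p₂ col l₁ l₂ l₃))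
  lemma₁ : ∀ s x d → - x * (1ℚ - # 10 * (s * s * d)) ≡ - (x * (1ℚ - # 10 * (- s * - s * d)))
  lemma₁ = solve-∀ ringℚ
  lemma₂ : ∀ s x y t v → x * t ≡ x * v + ((- s * y + x * v) - - (s * y + - x * t)) * - 1ℚ
  lemma₂ = solve-∀ ringℚ
  neg-neg : ∀ x → x ≡ - (- x)
  neg-neg = solve-∀ ringℚ
  even : ∀ x d → 1ℚ - # 10 * (x * x * d) ≡ 1ℚ - # 10 * (- x * - x * d)
  even = solve-∀ ringℚ
  even′ : ∀ x z → 1ℚ - # 10 * (z * z * (x * x)) ≡ 1ℚ - # 10 * (z * z * (- x * - x))
  even′ = solve-∀ ringℚ
  neg-* : ∀ x d → - x * d ≡ - (x * d)
  neg-* = solve-∀ ringℚ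
  difference : - ξ S * y₂ + x₂ * y₃ ≡ - (ξ S * y₂ + - x₂ * η S)
  difference = begin
    - ξ S * y₂ + x₂ * y₃              ≡⟨ cong (λ z → z * y₂ + x₂ * y₃) (trans (cong -_ ξ-eq) (sym (neg-neg x₃))) ⟩
    x₃ * y₂ + x₂ * y₃                 ≡⟨ j-collinear-ξ p₃ p₂ (Collinear-rotate col) l₃ l₂ l₁ ⟩
    - x₁ * den x₃ x₂                  ≡⟨ neg-* x₁ (den x₃ x₂) ⟩
    - (x₁ * den x₃ x₂)                ≡⟨ cong (λ d → - (x₁ * d)) (trans (even x₃ (x₂ * x₂))
                                           (trans (cong (λ z → den z x₂) (sym ξ-eq)) (even′ x₂ (ξ S)))) ⟩
    - (x₁ * den (ξ S) (- x₂))         ≡⟨ cong (λ R → - (ξ R * den (ξ S) (- x₂)))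
                                           (cancelʳ (j-affine X₁ Y₁ p₁) (j-affine X₂ Y₂ p₂)) ⟨
    - (ξ (S ∙ j-affine X₂ Y₂ p₂ ⁻¹) * den (ξ S) (- x₂))   ≡⟨ cong -_ (ξ-∙ S (j-affine X₂ Y₂ p₂ ⁻¹)) ⟩
    - (ξ S * y₂ + - x₂ * η S)         ∎

-- The first relation is the definition of the third abscissa, the second combines the two slope
-- equations, and the third follows from the second and the curve equation at the first point.
third-collinear : ∀ m X₁ Y₁ X₂ Y₂ → OnCurve X₁ Y₁ →
  m * (X₂ - X₁) ≡ Y₂ - Y₁ → m * (Y₁ + Y₂) ≡ secant X₁ X₂ →
  Collinear m (Y₁ - m * X₁) X₁ X₂ (thirdX m X₁ X₂)
third-collinear m X₁ Y₁ X₂ Y₂ p₁ line slope = record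
  { e₁ = lemma₁ m X₁ X₂
  ; e₂ = e₂
  ; e₃ = modulo e₂ _ (modulo p₁ _ (lemma₃ m X₁ Y₁ X₂))
  }
  where
  lemma₁ : ∀ m X₁ X₂ → X₁ + X₂ + (m * m - # 12 - X₁ - X₂) ≡ m * m - # 12
  lemma₁ = solve-∀ ringℚ
  lemma₂ : ∀ m X₁ Y₁ X₂ Y₂ → let X₃ = m * m - # 12 - X₁ - X₂ in
    X₁ * X₂ + X₁ * X₃ + X₂ * X₃ ≡ - (# 4) - # 2 * (m * (Y₁ - m * X₁))
    + (m * (X₂ - X₁) - (Y₂ - Y₁)) * m
    + (m * (Y₁ + Y₂) - (X₁ * X₁ + X₁ * X₂ + X₂ * X₂ + # 12 * (X₁ + X₂) + - (# 4))) * 1ℚ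
  lemma₂ = solve-∀ ringℚ
  lemma₃ : ∀ m X₁ Y₁ X₂ →
    let X₃ = m * m - # 12 - X₁ - X₂
        n = Y₁ - m * X₁
    in X₁ * X₂ * X₃ ≡ n * n
      + (X₁ * X₂ + X₁ * X₃ + X₂ * X₃ - (- (# 4) - # 2 * (m * n))) * X₁
      + (Y₁ * Y₁ - (X₁ * X₁ * X₁ + # 12 * X₁ * X₁ + (- # 4) * X₁ + 0ℚ)) * - 1ℚ
  lemma₃ = solve-∀ ringℚ
  e₂ = modulo line _ (modulo slope _ (lemma₂ m X₁ Y₁ X₂ Y₂))

jξ≡0 : ∀ X Y → jξ X Y ≡ 0ℚ → Y ≡ 0ℚ
jξ≡0 X Y eq = *-≡0 {# 2} (trans (sym (jξ-twist X Y)) (trans (cong (_* twist X) eq) (ℚ.*-zeroˡ (twist X)))) (λ ())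

⁻¹-involutive : ∀ P → P ⁻¹ ⁻¹ ≡ P
⁻¹-involutive P = J-≡ (lemma (ξ P)) refl
  where
  lemma : ∀ x → - (- x) ≡ x
  lemma = solve-∀ ringℚ

-- `j-collinear` divides by the x-coordinate of the point that it subtracts. If this is zero, the
-- two points are exchanged, which fails only for Y₁ = Y₂ = 0.
collinear-∙ : ∀ m n X₁ Y₁ X₂ Y₂ X₃ Y₃ p₁ p₂ p₃ → Collinear m n X₁ X₂ X₃ →
  Y₁ ≡ m * X₁ + n → Y₂ ≡ m * X₂ + n → - Y₃ ≡ m * X₃ + n → ¬ (Y₁ ≡ 0ℚ × Y₂ ≡ 0ℚ) →
  j-affine X₁ Y₁ p₁ ∙ j-affine X₂ Y₂ p₂ ≡ j-affine X₃ Y₃ p₃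
collinear-∙ m n X₁ Y₁ X₂ Y₂ X₃ Y₃ p₁ p₂ p₃ col l₁ l₂ l₃ Y≢0 = begin
  P₁ ∙ P₂              ≡⟨ go (jξ X₂ Y₂ ℚ.≟ 0ℚ) (jξ X₁ Y₁ ℚ.≟ 0ℚ) ⟩
  P₃′ ⁻¹               ≡⟨ cong _⁻¹ (j-affine-neg X₃ Y₃ p₃ q₃) ⟩
  P₃ ⁻¹ ⁻¹             ≡⟨ ⁻¹-involutive P₃ ⟩
  P₃                   ∎
  where
  open ≡-Reasoning
  q₃ = neg-onCurve X₃ Y₃ p₃
  P₁ = j-affine X₁ Y₁ p₁
  P₂ = j-affine X₂ Y₂ p₂
  P₃ = j-affine X₃ Y₃ p₃
  P₃′ = j-affine X₃ (- Y₃) q₃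
  go : Dec (jξ X₂ Y₂ ≡ 0ℚ) → Dec (jξ X₁ Y₁ ≡ 0ℚ) → P₁ ∙ P₂ ≡ P₃′ ⁻¹
  go (no x₂≢0) _ = j-collinear p₁ p₂ q₃ col l₁ l₂ l₃ x₂≢0
  go _ (no x₁≢0) = trans (∙-comm P₁ P₂) (j-collinear p₂ p₁ q₃ (Collinear-swap col) l₂ l₁ l₃ x₁≢0)
  go (yes x₂≡0) (yes x₁≡0) = ⊥-elim (Y≢0 (jξ≡0 X₁ Y₁ x₁≡0 , jξ≡0 X₂ Y₂ x₂≡0))

third-∙ : ∀ m X₁ Y₁ X₂ Y₂ p₁ p₂ →
  m * (X₂ - X₁) ≡ Y₂ - Y₁ → m * (Y₁ + Y₂) ≡ secant X₁ X₂ → ¬ (Y₁ ≡ 0ℚ × Y₂ ≡ 0ℚ) →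
  ∀ p₃ → j-affine X₁ Y₁ p₁ ∙ j-affine X₂ Y₂ p₂ ≡ j-affine (thirdX m X₁ X₂) (thirdY m X₁ Y₁ (thirdX m X₁ X₂)) p₃
third-∙ m X₁ Y₁ X₂ Y₂ p₁ p₂ line slope Y≢0 p₃ =
  collinear-∙ m (Y₁ - m * X₁) X₁ Y₁ X₂ Y₂ (thirdX m X₁ X₂) (thirdY m X₁ Y₁ (thirdX m X₁ X₂)) p₁ p₂ p₃
    (third-collinear m X₁ Y₁ X₂ Y₂ p₁ line slope)
    (line₁ m X₁ Y₁) (modulo line _ (line₂ m X₁ Y₁ X₂ Y₂)) (line₃ m X₁ Y₁ (thirdX m X₁ X₂)) Y≢0
  where
  line₁ : ∀ m X Y → Y ≡ m * X + (Y - m * X)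
  line₁ = solve-∀ ringℚ
  line₂ : ∀ m X₁ Y₁ X₂ Y₂ → Y₂ ≡ m * X₂ + (Y₁ - m * X₁) + (m * (X₂ - X₁) - (Y₂ - Y₁)) * - 1ℚ
  line₂ = solve-∀ ringℚ
  line₃ : ∀ m X₁ Y₁ X₃ → - (m * (X₁ - X₃) - Y₁) ≡ m * X₃ + (Y₁ - m * X₁)
  line₃ = solve-∀ ringℚ

-- Chord and tangent slopes satisfy the same two equations, so that both cases are treated at once.
-- The exclusion of Y₁ = Y₂ = 0 is the hypothesis of `collinear-∙`.
data Addition (X₁ Y₁ X₂ Y₂ : ℚ) : Point → Set where
  opposite : X₁ ≡ X₂ → Y₁ + Y₂ ≡ 0ℚ → Addition X₁ Y₁ X₂ Y₂ ∞
  secant-or-tangent : ∀ m .p₃ → m * (X₂ - X₁) ≡ Y₂ - Y₁ → m * (Y₁ + Y₂) ≡ secant X₁ X₂ →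
    ¬ (Y₁ ≡ 0ℚ × Y₂ ≡ 0ℚ) →
    Addition X₁ Y₁ X₂ Y₂ (affine (thirdX m X₁ X₂) (thirdY m X₁ Y₁ (thirdX m X₁ X₂)) p₃)

chord-line : ∀ X₁ Y₁ X₂ Y₂ (X₁≢X₂ : X₁ ≢ X₂) → chordSlope X₁ Y₁ X₂ Y₂ X₁≢X₂ * (X₂ - X₁) ≡ Y₂ - Y₁
chord-line X₁ Y₁ X₂ Y₂ X₁≢X₂ = ÷-cancel (Y₂ - Y₁) (X₂ - X₁) (minus≢0 X₁≢X₂)

chord-slope : ∀ X₁ Y₁ X₂ Y₂ (X₁≢X₂ : X₁ ≢ X₂) → OnCurve X₁ Y₁ → OnCurve X₂ Y₂ →
  chordSlope X₁ Y₁ X₂ Y₂ X₁≢X₂ * (Y₁ + Y₂) ≡ secant X₁ X₂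
chord-slope X₁ Y₁ X₂ Y₂ X₁≢X₂ p₁ p₂ = *-cancelʳ _ _ (X₂ - X₁) (minus≢0 X₁≢X₂) (begin
  m * (Y₁ + Y₂) * (X₂ - X₁)      ≡⟨ lemma m (Y₁ + Y₂) (X₂ - X₁) ⟩
  m * (X₂ - X₁) * (Y₁ + Y₂)      ≡⟨ cong (_* (Y₁ + Y₂)) (chord-line X₁ Y₁ X₂ Y₂ X₁≢X₂) ⟩
  (Y₂ - Y₁) * (Y₁ + Y₂)          ≡⟨ squares X₁ Y₁ X₂ Y₂ p₁ p₂ ⟩
  secant X₁ X₂ * (X₂ - X₁)       ∎)
  where
  open ≡-Reasoning
  m = chordSlope X₁ Y₁ X₂ Y₂ X₁≢X₂
  lemma : ∀ m s d → m * s * d ≡ m * d * s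
  lemma = solve-∀ ringℚ

tangent-slope : ∀ X₁ Y₁ X₂ Y₂ (s≢0 : Y₁ + Y₂ ≢ 0ℚ) → X₁ ≡ X₂ → tangentSlope X₁ Y₁ Y₂ s≢0 * (Y₁ + Y₂) ≡ secant X₁ X₂
tangent-slope X₁ Y₁ .X₁ Y₂ s≢0 refl = trans (÷-cancel _ (Y₁ + Y₂) s≢0) (lemma X₁)
  where
  lemma : ∀ X → # 3 * X * X + # 2 * # 12 * X + - (# 4) ≡ X * X + X * X + X * X + # 12 * (X + X) + - (# 4)
  lemma = solve-∀ ringℚ

tangent-line : ∀ X₁ Y₁ X₂ Y₂ (s≢0 : Y₁ + Y₂ ≢ 0ℚ) → X₁ ≡ X₂ → OnCurve X₁ Y₁ → OnCurve X₂ Y₂ →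
  tangentSlope X₁ Y₁ Y₂ s≢0 * (X₂ - X₁) ≡ Y₂ - Y₁
tangent-line X₁ Y₁ .X₁ Y₂ s≢0 refl p₁ p₂ = trans (m*0≡0 (tangentSlope X₁ Y₁ Y₂ s≢0))
  (sym (*-cancelʳ (Y₂ - Y₁) 0ℚ (Y₁ + Y₂) s≢0
    (trans (squares X₁ Y₁ X₁ Y₂ p₁ p₂) (trans (m*0≡0 (secant X₁ X₁)) (sym (ℚ.*-zeroˡ (Y₁ + Y₂)))))))
  where
  m*0≡0 : ∀ k → k * (X₁ - X₁) ≡ 0ℚ
  m*0≡0 k = trans (cong (k *_) (ℚ.+-inverseʳ X₁)) (ℚ.*-zeroʳ k)

sum-nonzero⇒ : ∀ {Y₁ Y₂} → Y₁ + Y₂ ≢ 0ℚ → ¬ (Y₁ ≡ 0ℚ × Y₂ ≡ 0ℚ)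
sum-nonzero⇒ s≢0 (refl , refl) = s≢0 refl

Y≡0⇒X≡0 : ∀ {X} → OnCurve X 0ℚ → X ≡ 0ℚ
Y≡0⇒X≡0 {X} p = [ (λ e → e) , (λ e → ⊥-elim (twist≢0 X e)) ]′ (*-≡0-⊎ (sym (curve⇒twist X 0ℚ p)))

X-distinct⇒ : ∀ {X₁ Y₁ X₂ Y₂} → OnCurve X₁ Y₁ → OnCurve X₂ Y₂ → X₁ ≢ X₂ → ¬ (Y₁ ≡ 0ℚ × Y₂ ≡ 0ℚ)
X-distinct⇒ p₁ p₂ X₁≢X₂ (refl , refl) = X₁≢X₂ (trans (Y≡0⇒X≡0 p₁) (sym (Y≡0⇒X≡0 p₂)))

addition : ∀ X₁ Y₁ X₂ Y₂ (p₁ : OnCurve X₁ Y₁) (p₂ : OnCurve X₂ Y₂) →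
  Addition X₁ Y₁ X₂ Y₂ (affine X₁ Y₁ p₁ ⊕ affine X₂ Y₂ p₂)
addition X₁ Y₁ X₂ Y₂ p₁ p₂ with X₁ ℚ.≟ X₂ | Y₁ + Y₂ ℚ.≟ 0ℚ
... | no X₁≢X₂  | _       = secant-or-tangent (chordSlope X₁ Y₁ X₂ Y₂ X₁≢X₂) _
  (chord-line X₁ Y₁ X₂ Y₂ X₁≢X₂) (chord-slope X₁ Y₁ X₂ Y₂ X₁≢X₂ p₁ p₂) (X-distinct⇒ p₁ p₂ X₁≢X₂)
... | yes X₁≡X₂ | yes s≡0 = opposite X₁≡X₂ s≡0
... | yes X₁≡X₂ | no s≢0  = secant-or-tangent (tangentSlope X₁ Y₁ Y₂ s≢0) _
  (tangent-line X₁ Y₁ X₂ Y₂ s≢0 X₁≡X₂ p₁ p₂) (tangent-slope X₁ Y₁ X₂ Y₂ s≢0 X₁≡X₂) (sum-nonzero⇒ s≢0)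

recompute-on : ∀ X Y → .(OnCurve X Y) → OnCurve X Y
recompute-on X Y p = recompute (Y * Y ℚ.≟ EllipticCurve.rhs E₃₃ X) p

j : Point → 𝕁
j ∞              = O
j (affine X Y p) = j-affine X Y (recompute-on X Y p)

j-addition : ∀ X₁ Y₁ X₂ Y₂ p₁ p₂ {S} → Addition X₁ Y₁ X₂ Y₂ S → j S ≡ j-affine X₁ Y₁ p₁ ∙ j-affine X₂ Y₂ p₂
j-addition X₁ Y₁ .X₁ Y₂ p₁ p₂ (opposite refl s≡0) = sym
  (trans (cong (j-affine X₁ Y₁ p₁ ∙_) (go Y₂ p₂ (minus≡0 Y₂ (- Y₁) (trans (lemma Y₁ Y₂) s≡0))))
    (∙-inverseʳ (j-affine X₁ Y₁ p₁)))
  where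
  lemma : ∀ a b → b - - a ≡ a + b
  lemma = solve-∀ ringℚ
  go : ∀ Y q → Y ≡ - Y₁ → j-affine X₁ Y q ≡ j-affine X₁ Y₁ p₁ ⁻¹
  go _ q refl = j-affine-neg X₁ Y₁ p₁ q
j-addition X₁ Y₁ X₂ Y₂ p₁ p₂ (secant-or-tangent m p₃ line slope Y≢0) =
  sym (third-∙ m X₁ Y₁ X₂ Y₂ p₁ p₂ line slope Y≢0 (recompute-on (thirdX m X₁ X₂) (thirdY m X₁ Y₁ (thirdX m X₁ X₂)) p₃))

j-⊕ : ∀ P Q → j (P ⊕ Q) ≡ j P ∙ j Q
j-⊕ ∞ Q = sym (∙-identityˡ (j Q))
j-⊕ P@(affine _ _ _) ∞ = sym (∙-identityʳ (j P))
j-⊕ (affine X₁ Y₁ p₁) (affine X₂ Y₂ p₂) =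
  j-addition X₁ Y₁ X₂ Y₂ q₁ q₂ (addition X₁ Y₁ X₂ Y₂ q₁ q₂)
  where
  q₁ = recompute-on X₁ Y₁ p₁
  q₂ = recompute-on X₂ Y₂ p₂

j-⊖ : ∀ P → j (⊖ P) ≡ j P ⁻¹
j-⊖ ∞ = refl
j-⊖ (affine X Y p) = j-affine-neg X Y (recompute-on X Y p) (recompute-on X (- Y) (neg-onCurve X Y p))

-- Eliminating X from the definitions of x and y leaves twist X (y - 1 + 3 x²) = 8.
twist-relation : ∀ X Y → OnCurve X Y → twist X * (jη X Y - 1ℚ + # 3 * (jξ X Y * jξ X Y)) ≡ # 8
twist-relation X Y p = begin
  d * (y₀ - 1ℚ + # 3 * (x₀ * x₀))           ≡⟨ lemma₁ x₀ y₀ d ⟩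
  y₀ * d - d + # 3 * (x₀ * x₀ * d)          ≡⟨ cong₂ (λ s t → s - d + # 3 * t) (jη-twist X Y) (ξ²-twist X Y p) ⟩
  X * X + # 4 - d + # 3 * (# 4 * X)         ≡⟨ lemma₂ X ⟩
  # 8                                       ∎
  where
  open ≡-Reasoning
  d = twist X
  x₀ = jξ X Y
  y₀ = jη X Y
  lemma₁ : ∀ x y d → d * (y - 1ℚ + # 3 * (x * x)) ≡ y * d - d + # 3 * (x * x * d)
  lemma₁ = solve-∀ ringℚ
  lemma₂ : ∀ X → X * X + # 4 - (X * X + # 12 * X - # 4) + # 3 * (# 4 * X) ≡ # 8
  lemma₂ = solve-∀ ringℚ

-- At x = 0, y = 1 the left-hand side of `twist-relation` is 0 instead of 8, so no affine point is
-- sent to `O`.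
j-kernel : ∀ P → j P ≡ O → P ≡ ∞
j-kernel ∞ _ = refl
j-kernel (affine X Y p) eq = ⊥-elim (8≢0 (trans (sym (twist-relation X Y (recompute-on X Y p)))
  (trans (cong₂ (λ a b → twist X * (b - 1ℚ + # 3 * (a * a))) (cong ξ eq) (cong η eq)) (ℚ.*-zeroʳ (twist X)))))
  where
  8≢0 : # 8 ≢ 0ℚ
  8≢0 ()

-- The descent over the natural numbers

infix 4 _≈_[mod_]

-- Encoded as an equation solved for a, so that matching on `refl` turns compatibility with sums and
-- products into ring identities.
record _≈_[mod_] (a b : ℤ) (n : ℕ) : Set where
  constructor congruent
  field
    multiple : ℤ
    equality : a ≡ b ℤ.+ multiple ℤ.* + n

≈-refl : ∀ {n} a → a ≈ a [mod n ]
≈-refl {n} a = congruent ℤ.0ℤ (lemma a (+ n))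
  where
  lemma : ∀ a n → a ≡ a ℤ.+ ℤ.0ℤ ℤ.* n
  lemma = ℤSolver.solve-∀

≈-+ : ∀ {n a a′ b b′} → a ≈ a′ [mod n ] → b ≈ b′ [mod n ] → a ℤ.+ b ≈ a′ ℤ.+ b′ [mod n ]
≈-+ {n} {_} {a} {_} {b} (congruent k refl) (congruent l refl) = congruent (k ℤ.+ l) (lemma a b k l (+ n))
  where
  lemma : ∀ a b k l n → a ℤ.+ k ℤ.* n ℤ.+ (b ℤ.+ l ℤ.* n) ≡ a ℤ.+ b ℤ.+ (k ℤ.+ l) ℤ.* n
  lemma = ℤSolver.solve-∀

≈-* : ∀ {n a a′ b b′} → a ≈ a′ [mod n ] → b ≈ b′ [mod n ] → a ℤ.* b ≈ a′ ℤ.* b′ [mod n ]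
≈-* {n} {_} {a} {_} {b} (congruent k refl) (congruent l refl) = congruent (k ℤ.* b ℤ.+ a ℤ.* l ℤ.+ k ℤ.* l ℤ.* + n) (lemma a b k l (+ n))
  where
  lemma : ∀ a b k l n → (a ℤ.+ k ℤ.* n) ℤ.* (b ℤ.+ l ℤ.* n) ≡
    a ℤ.* b ℤ.+ (k ℤ.* b ℤ.+ a ℤ.* l ℤ.+ k ℤ.* l ℤ.* n) ℤ.* n
  lemma = ℤSolver.solve-∀

≈-residue : ∀ n .{{_ : ℕ.NonZero n}} a → ∃ λ (r : Fin n) → a ≈ + toℕ r [mod n ]
≈-residue n a = fromℕ< a%n<n , congruent (a ℤ./ℕ n)
  (trans (ℤ.a≡a%ℕn+[a/ℕn]*n a n) (cong (λ r → + r ℤ.+ (a ℤ./ℕ n) ℤ.* + n) (sym (Fin.toℕ-fromℕ< a%n<n))))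
  where
  a%n<n = ℤ.n%ℕd<d a n

≈0⇒∣ : ∀ {n a b} → a ≈ b [mod n ] → a ≡ ℤ.0ℤ → n ℕ.∣ ℤ.∣ b ∣
≈0⇒∣ {n} {_} {b} (congruent k refl) eq = ℕ.divides ℤ.∣ k ∣ (begin
  ℤ.∣ b ∣                            ≡⟨ cong ℤ.∣_∣ (lemma b (k ℤ.* + n)) ⟩
  ℤ.∣ (b ℤ.+ k ℤ.* + n) ℤ.- k ℤ.* + n ∣  ≡⟨ cong (λ z → ℤ.∣ z ℤ.- k ℤ.* + n ∣) eq ⟩
  ℤ.∣ ℤ.0ℤ ℤ.- k ℤ.* + n ∣           ≡⟨ cong ℤ.∣_∣ (ℤ.+-identityˡ (ℤ.- (k ℤ.* + n))) ⟩
  ℤ.∣ ℤ.- (k ℤ.* + n) ∣              ≡⟨ ℤ.∣-i∣≡∣i∣ (k ℤ.* + n) ⟩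
  ℤ.∣ k ℤ.* + n ∣                    ≡⟨ ℤ.abs-* k (+ n) ⟩
  ℤ.∣ k ∣ ℕ.* n                      ∎)
  where
  open ≡-Reasoning
  lemma : ∀ b k → b ≡ (b ℤ.+ k) ℤ.- k
  lemma = ℤSolver.solve-∀

∣-≈ : ∀ {n a r} → a ≈ + r [mod n ] → ∀ {d} → d ℕ.∣ n → d ℕ.∣ r → d ℕ.∣ ℤ.∣ a ∣
∣-≈ {n} (congruent k refl) (ℕ.divides q refl) (ℕ.divides s refl) = ℕ.divides ℤ.∣ + s ℤ.+ k ℤ.* + q ∣ (trans
  (cong ℤ.∣_∣ (trans (cong₂ (λ a b → a ℤ.+ k ℤ.* b) (ℤ.pos-* s _) (ℤ.pos-* q _)) (lemma (+ s) k (+ q) _)))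
  (ℤ.abs-* (+ s ℤ.+ k ℤ.* + q) _))
  where
  lemma : ∀ s k q d → s ℤ.* d ℤ.+ k ℤ.* (q ℤ.* d) ≡ (s ℤ.+ k ℤ.* q) ℤ.* d
  lemma = ℤSolver.solve-∀

-- Coprime factors of squares and fourth powers

coprime-∣ : ∀ {d m n} → d ℕ.∣ m → Coprime m n → Coprime d n
coprime-∣ d∣m c (e∣d , e∣n) = c (ℕ.∣-trans e∣d d∣m , e∣n)

coprime-* : ∀ {a b n} → Coprime a n → Coprime b n → Coprime (a ℕ.* b) n
coprime-* ca cb (e∣ab , e∣n) =
  cb (Coprimality.coprime-divisor (coprime-∣ e∣n (Coprimality.sym ca)) e∣ab , e∣n)

square-injective : ∀ m n → m ℕ.* m ≡ n ℕ.* n → m ≡ n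
square-injective m n eq with ℕ.<-cmp m n
... | Tri.tri< m<n _ _ = ⊥-elim (ℕ.<⇒≢ (ℕ.*-mono-< m<n m<n) eq)
... | Tri.tri≈ _ m≡n _ = m≡n
... | Tri.tri> _ _ n<m = ⊥-elim (ℕ.<⇒≢ (ℕ.*-mono-< n<m n<m) (sym eq))

-- Put r = gcd(u, w). Then r² divides u v = w² and is coprime to v, hence divides u. Conversely u
-- divides w u and w², hence gcd(w u, w²) = w r, and then also gcd(r u, r w) = r².
coprime-square-factor : ∀ {u v w} → Coprime u v → u ℕ.* v ≡ w ℕ.* w → u ≡ gcd u w ℕ.* gcd u w
coprime-square-factor {u} {v} {w} c uv≡w² = ℕ.∣-antisym u∣r² r²∣u
  where
  r = gcd u w
  r∣u = gcd[m,n]∣m u w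
  r∣w = gcd[m,n]∣n u w
  c′ : Coprime r v
  c′ = coprime-∣ r∣u c
  r²∣u : r ℕ.* r ℕ.∣ u
  r²∣u = Coprimality.coprime-divisor (coprime-* c′ c′)
    (subst (r ℕ.* r ℕ.∣_) (trans (sym uv≡w²) (ℕ.*-comm u v)) (ℕ.*-pres-∣ r∣w r∣w))
  u∣rw : u ℕ.∣ r ℕ.* w
  u∣rw = subst (u ℕ.∣_) (trans (sym (c*gcd[m,n]≡gcd[cm,cn] w u w)) (ℕ.*-comm w r))
    (gcd-greatest (ℕ.n∣m*n w) (ℕ.divides v (trans (sym uv≡w²) (ℕ.*-comm u v))))
  u∣r² : u ℕ.∣ r ℕ.* r
  u∣r² = subst (u ℕ.∣_) (sym (c*gcd[m,n]≡gcd[cm,cn] r u w)) (gcd-greatest (ℕ.n∣m*n r) u∣rw)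

coprime-square : ∀ {u v w} → Coprime u v → u ℕ.* v ≡ w ℕ.* w →
  ∃₂ λ r s → u ≡ r ℕ.* r × v ≡ s ℕ.* s × w ≡ r ℕ.* s
coprime-square {u} {v} {w} c uv≡w² = r , s , u≡r² , v≡s² ,
  square-injective w (r ℕ.* s) (trans (sym uv≡w²) (trans (cong₂ ℕ._*_ u≡r² v≡s²) (lemma r s)))
  where
  r = gcd u w
  s = gcd v w
  u≡r² = coprime-square-factor c uv≡w²
  v≡s² = coprime-square-factor (Coprimality.sym c) (trans (ℕ.*-comm v u) uv≡w²)
  lemma : ∀ r s → r ℕ.* r ℕ.* (s ℕ.* s) ≡ r ℕ.* s ℕ.* (r ℕ.* s)
  lemma = ℕSolver.solve-∀

infixl 8 _⁴

_⁴ : ℕ → ℕ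
n ⁴ = n ℕ.* n ℕ.* (n ℕ.* n)

coprime-fourth-power : ∀ {u v w} → Coprime u v → u ℕ.* v ≡ w ⁴ →
  ∃₂ λ r s → u ≡ r ⁴ × v ≡ s ⁴ × w ≡ r ℕ.* s × Coprime r s
coprime-fourth-power {u} {v} {w} c eq with coprime-square {w = w ℕ.* w} c eq
... | r , s , refl , refl , w²≡rs with coprime-square {r} {s} {w} c′ (sym w²≡rs)
  where
  c′ = coprime-∣ (ℕ.m∣m*n r) (Coprimality.sym (coprime-∣ (ℕ.m∣m*n s) (Coprimality.sym c)))
... | r′ , s′ , refl , refl , w≡ = r′ , s′ , refl , refl , w≡ ,
  coprime-∣ (∣-⁴ r′) (Coprimality.sym (coprime-∣ (∣-⁴ s′) (Coprimality.sym c)))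
  where
  ∣-⁴ : ∀ n → n ℕ.∣ n ⁴
  ∣-⁴ n = ℕ.∣-trans (ℕ.m∣m*n n) (ℕ.m∣m*n (n ℕ.* n))

∣-square : ∀ {p} → Prime p → ∀ n → p ℕ.∣ n ℕ.* n → p ℕ.∣ n
∣-square pr n p∣n² = [ (λ e → e) , (λ e → e) ]′ (euclidsLemma n n pr p∣n²)

prime[5] : Prime 5
prime[5] = from-yes (prime? 5)

coprime⇒¬∣ : ∀ {d m n} → Coprime m n → d ≢ 1 → d ℕ.∣ m → ¬ d ℕ.∣ n
coprime⇒¬∣ c d≢1 d∣m d∣n = d≢1 (c (d∣m , d∣n))

odd-square : ∀ n → ¬ 2 ℕ.∣ n → ∃ λ k → n ℕ.* n ≡ 1 ℕ.+ 4 ℕ.* k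
odd-square n odd = q ℕ.* q ℕ.+ q , trans (cong (λ m → m ℕ.* m) n≡) (lemma q)
  where
  q = n ℕ./ 2
  r = n ℕ.% 2
  r≡1 : ∀ r → r ℕ.< 2 → r ≢ 0 → r ≡ 1
  r≡1 0 _ r≢0 = ⊥-elim (r≢0 refl)
  r≡1 1 _ _ = refl
  r≡1 (suc (suc _)) (ℕ.s≤s (ℕ.s≤s ())) _
  n≡ : n ≡ 1 ℕ.+ q ℕ.* 2
  n≡ = trans (ℕ.m≡m%n+[m/n]*n n 2)
    (cong (ℕ._+ q ℕ.* 2) (r≡1 r (ℕ.m%n<n n 2) (λ r≡0 → odd (ℕ.m%n≡0⇒n∣m n 2 r≡0))))
  lemma : ∀ q → (1 ℕ.+ q ℕ.* 2) ℕ.* (1 ℕ.+ q ℕ.* 2) ≡ 1 ℕ.+ 4 ℕ.* (q ℕ.* q ℕ.+ q)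
  lemma = ℕSolver.solve-∀

-- An odd b is excluded modulo 8.
numerator-even : ∀ a b m → m ℕ.* m ℕ.+ 6 ℕ.* (a ℕ.* a ℕ.* (b ℕ.* b)) ≡ a ⁴ ℕ.+ 10 ℕ.* b ⁴ → 2 ℕ.∣ b
numerator-even a b m eq = ∣-≈ (proj₂ rb) {2} (ℕ.divides 4 refl)
  (table (proj₁ ra) (proj₁ rb) (proj₁ rm) (≈0⇒∣ (form-≈ (proj₂ ra) (proj₂ rb) (proj₂ rm)) form≡0))
  where
  ra = ≈-residue 8 (+ a)
  rb = ≈-residue 8 (+ b)
  rm = ≈-residue 8 (+ m)
  form : ℤ → ℤ → ℤ → ℤ
  form a b m = m ℤ.* m ℤ.+ + 6 ℤ.* (a ℤ.* a ℤ.* (b ℤ.* b))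
    ℤ.+ -[1+ 0 ] ℤ.* (a ℤ.* a ℤ.* (a ℤ.* a) ℤ.+ + 10 ℤ.* (b ℤ.* b ℤ.* (b ℤ.* b)))
  form-≈ : ∀ {a b m a′ b′ m′} → a ≈ a′ [mod 8 ] → b ≈ b′ [mod 8 ] → m ≈ m′ [mod 8 ] →
    form a b m ≈ form a′ b′ m′ [mod 8 ]
  form-≈ a b m = ≈-+ (≈-+ (≈-* m m) (≈-* (≈-refl (+ 6)) (≈-* a² b²)))
    (≈-* (≈-refl -[1+ 0 ]) (≈-+ (≈-* a² a²) (≈-* (≈-refl (+ 10)) (≈-* b² b²))))
    where
    a² = ≈-* a a
    b² = ≈-* b b
  table : ∀ (ra rb rm : Fin 8) → 8 ℕ.∣ ℤ.∣ form (+ toℕ ra) (+ toℕ rb) (+ toℕ rm) ∣ → 2 ℕ.∣ toℕ rb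
  table = from-yes (Fin.all? λ (ra : Fin 8) → Fin.all? λ (rb : Fin 8) → Fin.all? λ (rm : Fin 8) →
    (8 ℕ.∣? ℤ.∣ form (+ toℕ ra) (+ toℕ rb) (+ toℕ rm) ∣) →-dec (2 ℕ.∣? toℕ rb))
  lemma : ∀ x → x ℤ.+ -[1+ 0 ] ℤ.* x ≡ ℤ.0ℤ
  lemma = ℤSolver.solve-∀
  pos-⁴ : ∀ n → + (n ⁴) ≡ + n ℤ.* + n ℤ.* (+ n ℤ.* + n)
  pos-⁴ n = trans (ℤ.pos-* (n ℕ.* n) (n ℕ.* n)) (cong₂ ℤ._*_ (ℤ.pos-* n n) (ℤ.pos-* n n))
  lhs≡ : + (m ℕ.* m ℕ.+ 6 ℕ.* (a ℕ.* a ℕ.* (b ℕ.* b))) ≡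
    + m ℤ.* + m ℤ.+ + 6 ℤ.* (+ a ℤ.* + a ℤ.* (+ b ℤ.* + b))
  lhs≡ = cong₂ ℤ._+_ (ℤ.pos-* m m) (trans (ℤ.pos-* 6 (a ℕ.* a ℕ.* (b ℕ.* b)))
    (cong (+ 6 ℤ.*_) (trans (ℤ.pos-* (a ℕ.* a) (b ℕ.* b)) (cong₂ ℤ._*_ (ℤ.pos-* a a) (ℤ.pos-* b b)))))
  rhs≡ : + (a ⁴ ℕ.+ 10 ℕ.* b ⁴) ≡
    + a ℤ.* + a ℤ.* (+ a ℤ.* + a) ℤ.+ + 10 ℤ.* (+ b ℤ.* + b ℤ.* (+ b ℤ.* + b))
  rhs≡ = cong₂ ℤ._+_ (pos-⁴ a) (trans (ℤ.pos-* 10 (b ⁴)) (cong (+ 10 ℤ.*_) (pos-⁴ b)))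
  form≡0 : form (+ a) (+ b) (+ m) ≡ ℤ.0ℤ
  form≡0 = trans (cong₂ (λ l r → l ℤ.+ -[1+ 0 ] ℤ.* r) (sym lhs≡) (trans (sym rhs≡) (cong +_ (sym eq)))) (lemma (+ (m ℕ.* m ℕ.+ 6 ℕ.* (a ℕ.* a ℕ.* (b ℕ.* b)))))

-- For f ≠ 0, X = g² / f² is the abscissa of a point of `E₃₃` with D = a² / f⁴ and Y = ± g a / f³,
-- whose image on the quartic has x = ± b / a. The record thus says that, up to sign and translation
-- by (0 , 0), every abscissa is a square.
record Halving (a b : ℕ) : Set where
  field
    g f     : ℕ
    b≡      : b ≡ 2 ℕ.* (g ℕ.* f)
    a²≡     : a ℕ.* a ℕ.+ 4 ℕ.* f ⁴ ≡ g ⁴ ℕ.+ 12 ℕ.* (g ℕ.* g ℕ.* (f ℕ.* f))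
    coprime : Coprime g f
    g-odd   : ¬ 2 ℕ.∣ g
    a-odd   : ¬ 2 ℕ.∣ a

∣difference∣ : ∀ s t → (∃ λ w → s ≡ t ℕ.+ w) ⊎ (∃ λ w → t ≡ s ℕ.+ w)
∣difference∣ s t with ℕ.≤-total t s
... | inj₁ t≤s = inj₁ (s ℕ.∸ t , sym (ℕ.m+[n∸m]≡n t≤s))
... | inj₂ s≤t = inj₂ (t ℕ.∸ s , sym (ℕ.m+[n∸m]≡n s≤t))

-- From (m - w)(m + w) = t² with t even: m = p + q and w = p - q with p q = (t / 2)².
factor-difference : ∀ m w t → m ℕ.* m ≡ w ℕ.* w ℕ.+ 4 ℕ.* t →
  ∃ λ q → m ≡ q ℕ.+ w ℕ.+ q × q ℕ.* (q ℕ.+ w) ≡ t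
factor-difference m w t eq with ℕ.<-cmp m w
... | Tri.tri< m<w _ _ = ⊥-elim (ℕ.<⇒≱ (ℕ.*-mono-< m<w m<w) (subst (w ℕ.* w ℕ.≤_) (sym eq) (ℕ.m≤m+n (w ℕ.* w) (4 ℕ.* t))))
... | Tri.tri≈ _ refl _ = 0 , sym (ℕ.+-identityʳ m) , sym (ℕ.m*n≡0⇒m≡0 t 4 (trans (ℕ.*-comm t 4)
  (ℕ.+-cancelˡ-≡ (m ℕ.* m) _ 0 (trans (sym eq) (sym (ℕ.+-identityʳ _))))))
... | Tri.tri> _ _ w<m with m ℕ.∸ w | sym (ℕ.m+[n∸m]≡n (ℕ.<⇒≤ w<m))
-- d = m - w satisfies d² + 2 w d = 4 t, hence is even; q is half of it.
... | d | refl with ∣-square prime[2] d (ℕ.∣m+n∣m⇒∣n {m = 2 ℕ.* (w ℕ.* d)} (ℕ.divides (t ℕ.* 2) dd≡) (ℕ.m∣m*n (w ℕ.* d)))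
  where
  lemma : ∀ w d → (w ℕ.+ d) ℕ.* (w ℕ.+ d) ≡ w ℕ.* w ℕ.+ (2 ℕ.* (w ℕ.* d) ℕ.+ d ℕ.* d)
  lemma = ℕSolver.solve-∀
  lemma′ : ∀ t → 4 ℕ.* t ≡ t ℕ.* 2 ℕ.* 2
  lemma′ = ℕSolver.solve-∀
  dd≡ : 2 ℕ.* (w ℕ.* d) ℕ.+ d ℕ.* d ≡ t ℕ.* 2 ℕ.* 2
  dd≡ = trans (ℕ.+-cancelˡ-≡ (w ℕ.* w) _ _ (trans (sym (lemma w d)) eq)) (lemma′ t)
... | ℕ.divides q refl = q , lemma₁ w q , ℕ.*-cancelˡ-≡ _ _ 4
  (ℕ.+-cancelˡ-≡ (w ℕ.* w) _ _ (trans (lemma₂ w q) eq))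
  where
  lemma₁ : ∀ w q → w ℕ.+ q ℕ.* 2 ≡ q ℕ.+ w ℕ.+ q
  lemma₁ = ℕSolver.solve-∀
  lemma₂ : ∀ w q → w ℕ.* w ℕ.+ 4 ℕ.* (q ℕ.* (q ℕ.+ w)) ≡ (w ℕ.+ q ℕ.* 2) ℕ.* (w ℕ.+ q ℕ.* 2)
  lemma₂ = ℕSolver.solve-∀

-- m² = (a² - 3 b²)² + b⁴ with b = 2 c and s = c².
difference-of-squares : ∀ m A s w → m ℕ.* m ℕ.+ 24 ℕ.* (A ℕ.* s) ≡ A ℕ.* A ℕ.+ 160 ℕ.* (s ℕ.* s) →
  A ≡ 12 ℕ.* s ℕ.+ w ⊎ 12 ℕ.* s ≡ A ℕ.+ w → m ℕ.* m ≡ w ℕ.* w ℕ.+ 4 ℕ.* (4 ℕ.* (s ℕ.* s))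
difference-of-squares m _ s w eq (inj₁ refl) =
  ℕ.+-cancelʳ-≡ (24 ℕ.* ((12 ℕ.* s ℕ.+ w) ℕ.* s)) _ _ (trans eq (lemma s w))
  where
  lemma : ∀ s w → (12 ℕ.* s ℕ.+ w) ℕ.* (12 ℕ.* s ℕ.+ w) ℕ.+ 160 ℕ.* (s ℕ.* s) ≡
    w ℕ.* w ℕ.+ 4 ℕ.* (4 ℕ.* (s ℕ.* s)) ℕ.+ 24 ℕ.* ((12 ℕ.* s ℕ.+ w) ℕ.* s)
  lemma = ℕSolver.solve-∀
difference-of-squares m A s w eq (inj₂ 12s≡) = ℕ.+-cancelʳ-≡ (24 ℕ.* (A ℕ.* s)) _ _ (begin
  m ℕ.* m ℕ.+ 24 ℕ.* (A ℕ.* s)                                              ≡⟨ eq ⟩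
  A ℕ.* A ℕ.+ 160 ℕ.* (s ℕ.* s)                                             ≡⟨ lemma₁ A s ⟩
  A ℕ.* A ℕ.+ 16 ℕ.* (s ℕ.* s) ℕ.+ (12 ℕ.* s) ℕ.* (12 ℕ.* s)                ≡⟨ cong (λ z → A ℕ.* A ℕ.+ 16 ℕ.* (s ℕ.* s) ℕ.+ z ℕ.* z) 12s≡ ⟩
  A ℕ.* A ℕ.+ 16 ℕ.* (s ℕ.* s) ℕ.+ (A ℕ.+ w) ℕ.* (A ℕ.+ w)                  ≡⟨ lemma₂ A s w ⟩
  w ℕ.* w ℕ.+ 4 ℕ.* (4 ℕ.* (s ℕ.* s)) ℕ.+ 2 ℕ.* A ℕ.* (A ℕ.+ w)             ≡⟨ cong (λ z → w ℕ.* w ℕ.+ 4 ℕ.* (4 ℕ.* (s ℕ.* s)) ℕ.+ 2 ℕ.* A ℕ.* z) 12s≡ ⟨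
  w ℕ.* w ℕ.+ 4 ℕ.* (4 ℕ.* (s ℕ.* s)) ℕ.+ 2 ℕ.* A ℕ.* (12 ℕ.* s)            ≡⟨ lemma₃ A s w ⟩
  w ℕ.* w ℕ.+ 4 ℕ.* (4 ℕ.* (s ℕ.* s)) ℕ.+ 24 ℕ.* (A ℕ.* s)                  ∎)
  where
  open ≡-Reasoning
  lemma₁ : ∀ A s → A ℕ.* A ℕ.+ 160 ℕ.* (s ℕ.* s) ≡
    A ℕ.* A ℕ.+ 16 ℕ.* (s ℕ.* s) ℕ.+ (12 ℕ.* s) ℕ.* (12 ℕ.* s)
  lemma₁ = ℕSolver.solve-∀
  lemma₂ : ∀ A s w → A ℕ.* A ℕ.+ 16 ℕ.* (s ℕ.* s) ℕ.+ (A ℕ.+ w) ℕ.* (A ℕ.+ w) ≡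
    w ℕ.* w ℕ.+ 4 ℕ.* (4 ℕ.* (s ℕ.* s)) ℕ.+ 2 ℕ.* A ℕ.* (A ℕ.+ w)
  lemma₂ = ℕSolver.solve-∀
  lemma₃ : ∀ A s w → w ℕ.* w ℕ.+ 4 ℕ.* (4 ℕ.* (s ℕ.* s)) ℕ.+ 2 ℕ.* A ℕ.* (12 ℕ.* s) ≡
    w ℕ.* w ℕ.+ 4 ℕ.* (4 ℕ.* (s ℕ.* s)) ℕ.+ 24 ℕ.* (A ℕ.* s)
  lemma₃ = ℕSolver.solve-∀

-- p and q are (m ± (A - 12 s)) / 2, and m² - (A - 12 s)² = 16 s². Subtraction is avoided by
-- distinguishing which of A and 12 s is larger.
halving-factors : ∀ m A s → m ℕ.* m ℕ.+ 24 ℕ.* (A ℕ.* s) ≡ A ℕ.* A ℕ.+ 160 ℕ.* (s ℕ.* s) →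
  ∃₂ λ p q → p ℕ.* q ≡ 4 ℕ.* (s ℕ.* s) × p ℕ.+ 12 ℕ.* s ≡ q ℕ.+ A
halving-factors m A s eq = go (∣difference∣ A (12 ℕ.* s))
  where
  lemma₁ : ∀ q w t → q ℕ.+ w ℕ.+ t ≡ q ℕ.+ (t ℕ.+ w)
  lemma₁ = ℕSolver.solve-∀
  go : (∃ λ w → A ≡ 12 ℕ.* s ℕ.+ w) ⊎ (∃ λ w → 12 ℕ.* s ≡ A ℕ.+ w) →
    ∃₂ λ p q → p ℕ.* q ≡ 4 ℕ.* (s ℕ.* s) × p ℕ.+ 12 ℕ.* s ≡ q ℕ.+ A
  go (inj₁ (w , A≡)) with factor-difference m w _ (difference-of-squares m A s w eq (inj₁ A≡))
  ... | q , _ , qp≡ = q ℕ.+ w , q , trans (ℕ.*-comm (q ℕ.+ w) q) qp≡ ,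
    trans (lemma₁ q w (12 ℕ.* s)) (cong (q ℕ.+_) (sym A≡))
  go (inj₂ (w , 12s≡)) with factor-difference m w _ (difference-of-squares m A s w eq (inj₂ 12s≡))
  ... | q , _ , qp≡ = q , q ℕ.+ w , qp≡ ,
    trans (cong (q ℕ.+_) 12s≡) (sym (lemma₁ q w A))

divisor-of-4 : ∀ e → e ℕ.∣ 4 → ¬ 2 ℕ.∣ e → e ≡ 1
divisor-of-4 0 0∣4 _ = ⊥-elim (from-no (0 ℕ.∣? 4) 0∣4)
divisor-of-4 1 _ _ = refl
divisor-of-4 2 _ odd = ⊥-elim (odd (ℕ.divides 1 refl))
divisor-of-4 3 3∣4 _ = ⊥-elim (from-no (3 ℕ.∣? 4) 3∣4)
divisor-of-4 4 _ odd = ⊥-elim (odd (ℕ.divides 2 refl))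
divisor-of-4 e@(suc (suc (suc (suc (suc _))))) e∣4 _ = ⊥-elim (ℕ.<⇒≱ (ℕ.≤ᵇ⇒≤ 5 e _) (ℕ.∣⇒≤ e∣4))

-- By coprimality u is odd, so v contains the whole factor 4, and u and v / 4 are coprime with
-- product k⁴.
even-factor : ∀ {u v} k → Coprime u v → u ℕ.* v ≡ 4 ℕ.* k ⁴ → 2 ℕ.∣ v →
  ∃₂ λ g f → u ≡ g ⁴ × v ≡ 4 ℕ.* f ⁴ × k ≡ g ℕ.* f × Coprime g f
even-factor {u} {v} k uv-coprime uv≡ (ℕ.divides l v≡) = go₁ l-even
  where
  lemma₁ : ∀ u l → 2 ℕ.* (u ℕ.* l) ≡ u ℕ.* (l ℕ.* 2)
  lemma₁ = ℕSolver.solve-∀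
  lemma₂ : ∀ n → 4 ℕ.* n ≡ 2 ℕ.* (n ℕ.* 2)
  lemma₂ = ℕSolver.solve-∀
  lemma₃ : ∀ u i → u ℕ.* (i ℕ.* 2) ≡ u ℕ.* i ℕ.* 2
  lemma₃ = ℕSolver.solve-∀
  lemma₄ : ∀ i → i ℕ.* 2 ℕ.* 2 ≡ 4 ℕ.* i
  lemma₄ = ℕSolver.solve-∀
  Goal = ∃₂ λ g f → u ≡ g ⁴ × v ≡ 4 ℕ.* f ⁴ × k ≡ g ℕ.* f × Coprime g f
  ul≡ : u ℕ.* l ≡ k ⁴ ℕ.* 2
  ul≡ = ℕ.*-cancelˡ-≡ _ _ 2 (trans (lemma₁ u l) (trans (cong (u ℕ.*_) (sym v≡)) (trans uv≡ (lemma₂ (k ⁴)))))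
  l-even : 2 ℕ.∣ l
  l-even = [ (λ 2∣u → ⊥-elim (coprime⇒¬∣ (Coprimality.sym uv-coprime) (λ ()) (ℕ.divides l v≡) 2∣u)) , (λ e → e) ]′
    (euclidsLemma u l prime[2] (ℕ.divides (k ⁴) ul≡))
  go₁ : 2 ℕ.∣ l → Goal
  go₁ (ℕ.divides i l≡) = go₂ (coprime-fourth-power {u} {i} {k}
    (Coprimality.sym (coprime-∣ (ℕ.divides 4 v≡4i) (Coprimality.sym uv-coprime)))
    (ℕ.*-cancelʳ-≡ _ _ 2 (trans (sym (lemma₃ u i)) (trans (cong (u ℕ.*_) (sym l≡)) ul≡))))
    where
    v≡4i : v ≡ 4 ℕ.* i
    v≡4i = trans v≡ (trans (cong (ℕ._* 2) l≡) (lemma₄ i))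
    go₂ : (∃₂ λ g f → u ≡ g ⁴ × i ≡ f ⁴ × k ≡ g ℕ.* f × Coprime g f) → Goal
    go₂ (g , f , u≡ , i≡ , k≡ , gf-coprime) = g , f , u≡ , trans v≡4i (cong (4 ℕ.*_) i≡) , k≡ , gf-coprime

odd-root : ∀ {u} g → u ≡ g ⁴ → ¬ 2 ℕ.∣ u → ¬ 2 ℕ.∣ g
odd-root g u≡ u-odd 2∣g = u-odd (subst (2 ℕ.∣_) (sym u≡) (ℕ.∣m⇒∣m*n (g ℕ.* g) (ℕ.∣m⇒∣m*n g 2∣g)))

-- Each odd square is 1 modulo 4, so the sum is 2.
sum-of-odd-squares : ∀ m n → ¬ 2 ℕ.∣ m → ¬ 2 ℕ.∣ n → ¬ 4 ℕ.∣ m ℕ.* m ℕ.+ n ℕ.* n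
sum-of-odd-squares m n m-odd n-odd 4∣ = go (odd-square m m-odd) (odd-square n n-odd)
  where
  lemma : ∀ l i → 1 ℕ.+ 4 ℕ.* l ℕ.+ (1 ℕ.+ 4 ℕ.* i) ≡ 4 ℕ.* (l ℕ.+ i) ℕ.+ 2
  lemma = ℕSolver.solve-∀
  go : (∃ λ k → m ℕ.* m ≡ 1 ℕ.+ 4 ℕ.* k) → (∃ λ k → n ℕ.* n ≡ 1 ℕ.+ 4 ℕ.* k) → ⊥
  go (l , m²≡) (i , n²≡) = from-no (4 ℕ.∣? 2) (ℕ.∣m+n∣m⇒∣n {4} {4 ℕ.* (l ℕ.+ i)}
    (subst (4 ℕ.∣_) (trans (cong₂ ℕ._+_ m²≡ n²≡) (lemma l i)) 4∣) (ℕ.m∣m*n (l ℕ.+ i)))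

module HalvingFactors {a b k p q : ℕ} (c : Coprime b a) (b≡ : b ≡ k ℕ.* 2)
  (pq≡ : p ℕ.* q ≡ 4 ℕ.* k ⁴) (difference : p ℕ.+ 12 ℕ.* (k ℕ.* k) ≡ q ℕ.+ a ℕ.* a) where

  a-odd : ¬ 2 ℕ.∣ a
  a-odd = coprime⇒¬∣ c (λ ()) (ℕ.divides k b≡)

  -- A common divisor of p, q and k divides a² by `difference` and divides b, which is coprime to a.
  coprime-to-k : ∀ {e} → e ℕ.∣ p → e ℕ.∣ q → Coprime e k
  coprime-to-k e∣p e∣q {d} (d∣e , d∣k) = c (ℕ.∣-trans d∣k k∣b ,
    Coprimality.coprime-divisor (coprime-∣ (ℕ.∣-trans d∣k k∣b) c)
      (ℕ.∣m+n∣m⇒∣n (subst (d ℕ.∣_) difference (ℕ.∣m∣n⇒∣m+n (ℕ.∣-trans d∣e e∣p) (ℕ.∣n⇒∣m*n 12 (ℕ.∣m⇒∣m*n k d∣k))))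
        (ℕ.∣-trans d∣e e∣q)))
    where
    k∣b : k ℕ.∣ b
    k∣b = ℕ.divides 2 (trans b≡ (ℕ.*-comm k 2))

  not-both-even : ¬ (2 ℕ.∣ p × 2 ℕ.∣ q)
  not-both-even (2∣p , 2∣q) = a-odd (∣-square prime[2] a (ℕ.∣m+n∣m⇒∣n (subst (2 ℕ.∣_) difference
    (ℕ.∣m∣n⇒∣m+n 2∣p (ℕ.∣m⇒∣m*n (k ℕ.* k) (ℕ.divides 6 refl)))) 2∣q))

  -- A common divisor divides 4 k⁴ and is coprime to k, so it divides 4; it is odd, because p and q
  -- cannot both be even.
  pq-coprime : Coprime p q
  pq-coprime {e} (e∣p , e∣q) = divisor-of-4 e
    (Coprimality.coprime-divisor (Coprimality.sym (coprime-* k²c k²c))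
      (subst (e ℕ.∣_) (trans pq≡ (ℕ.*-comm 4 (k ⁴))) (ℕ.∣m⇒∣m*n q e∣p)))
    (λ 2∣e → not-both-even (ℕ.∣-trans 2∣e e∣p , ℕ.∣-trans 2∣e e∣q))
    where
    kc = Coprimality.sym (coprime-to-k e∣p e∣q)
    k²c = coprime-* kc kc

  q-even : 2 ℕ.∣ q → (∃₂ λ g f → p ≡ g ⁴ × q ≡ 4 ℕ.* f ⁴ × k ≡ g ℕ.* f × Coprime g f) → Halving a b
  q-even 2∣q (g , f , p≡ , q≡ , k≡ , gf-coprime) = record
    { g = g ; f = f
    ; b≡ = trans b≡ (trans (ℕ.*-comm k 2) (cong (2 ℕ.*_) k≡))
    ; a²≡ = trans (ℕ.+-comm (a ℕ.* a) (4 ℕ.* f ⁴)) (trans (cong (ℕ._+ a ℕ.* a) (sym q≡)) (trans (sym difference)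
        (cong₂ ℕ._+_ p≡ (trans (cong (λ z → 12 ℕ.* (z ℕ.* z)) k≡) (lemma g f)))))
    ; coprime = gf-coprime
    ; g-odd = odd-root g p≡ (coprime⇒¬∣ (Coprimality.sym pq-coprime) (λ ()) 2∣q)
    ; a-odd = a-odd
    }
    where
    lemma : ∀ g f → 12 ℕ.* (g ℕ.* f ℕ.* (g ℕ.* f)) ≡ 12 ℕ.* (g ℕ.* g ℕ.* (f ℕ.* f))
    lemma = ℕSolver.solve-∀

  -- 4 f⁴ + 12 f² g² = g⁴ + a² is impossible modulo 4.
  p-odd : 2 ℕ.∣ p → ¬ (∃₂ λ g f → q ≡ g ⁴ × p ≡ 4 ℕ.* f ⁴ × k ≡ g ℕ.* f × Coprime g f)
  p-odd 2∣p (g , f , q≡ , p≡ , _ , _) = sum-of-odd-squares (g ℕ.* g) a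
    (λ 2∣g² → odd-root g q≡ (coprime⇒¬∣ pq-coprime (λ ()) 2∣p) (∣-square prime[2] g 2∣g²)) a-odd
    (subst (4 ℕ.∣_) (trans (cong (ℕ._+ 12 ℕ.* (k ℕ.* k)) (sym p≡)) (trans difference (cong (ℕ._+ a ℕ.* a) q≡)))
      (ℕ.∣m∣n⇒∣m+n (ℕ.m∣m*n (f ⁴)) (ℕ.∣m⇒∣m*n (k ℕ.* k) (ℕ.divides 3 refl))))

  halved : Halving a b
  halved = [ (λ 2∣p → ⊥-elim (p-odd 2∣p (even-factor k (Coprimality.sym pq-coprime) (trans (ℕ.*-comm q p) pq≡) 2∣p)))
           , (λ 2∣q → q-even 2∣q (even-factor k pq-coprime pq≡ 2∣q)) ]′
    (euclidsLemma p q prime[2] (ℕ.divides (2 ℕ.* k ⁴) (trans pq≡ (lemma (k ⁴)))))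
    where
    lemma : ∀ n → 4 ℕ.* n ≡ 2 ℕ.* n ℕ.* 2
    lemma = ℕSolver.solve-∀

halving : ∀ a b m → Coprime b a → m ℕ.* m ℕ.+ 6 ℕ.* (a ℕ.* a ℕ.* (b ℕ.* b)) ≡ a ⁴ ℕ.+ 10 ℕ.* b ⁴ → Halving a b
halving a b m c eq = go₁ (numerator-even a b m eq)
  where
  lemma₁ : ∀ A k → 24 ℕ.* (A ℕ.* (k ℕ.* k)) ≡ 6 ℕ.* (A ℕ.* (k ℕ.* 2 ℕ.* (k ℕ.* 2)))
  lemma₁ = ℕSolver.solve-∀
  lemma₂ : ∀ k → 10 ℕ.* (k ℕ.* 2 ℕ.* (k ℕ.* 2) ℕ.* (k ℕ.* 2 ℕ.* (k ℕ.* 2))) ≡ 160 ℕ.* (k ℕ.* k ℕ.* (k ℕ.* k))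
  lemma₂ = ℕSolver.solve-∀
  go₁ : 2 ℕ.∣ b → Halving a b
  go₁ (ℕ.divides k b≡) = go₂ (halving-factors m (a ℕ.* a) (k ℕ.* k)
    (trans (cong (m ℕ.* m ℕ.+_) (lemma₁ (a ℕ.* a) k))
      (trans (subst (λ b → m ℕ.* m ℕ.+ 6 ℕ.* (a ℕ.* a ℕ.* (b ℕ.* b)) ≡ a ⁴ ℕ.+ 10 ℕ.* b ⁴) b≡ eq)
        (cong (a ⁴ ℕ.+_) (lemma₂ k)))))
    where
    go₂ : (∃₂ λ p q → p ℕ.* q ≡ 4 ℕ.* k ⁴ × p ℕ.+ 12 ℕ.* (k ℕ.* k) ≡ q ℕ.+ a ℕ.* a) → Halving a b
    go₂ (p , q , pq≡ , difference) = HalvingFactors.halved {k = k} {p} c b≡ pq≡ difference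

-- The curve g² + 6 f² = κ r⁴ + μ s⁴, f = r s, κ μ = 10, obtained by splitting 10 f⁴ = ((h - a) / 2) ((h + a) / 2).
record Splitting (κ μ a g f : ℕ) : Set where
  constructor splitting
  field
    r s    : ℕ
    f≡     : f ≡ r ℕ.* s
    sum≡   : g ℕ.* g ℕ.+ 6 ℕ.* (f ℕ.* f) ≡ κ ℕ.* r ⁴ ℕ.+ μ ℕ.* s ⁴
    diff≡  : a ℕ.+ κ ℕ.* r ⁴ ≡ μ ℕ.* s ⁴ ⊎ a ℕ.+ μ ℕ.* s ⁴ ≡ κ ℕ.* r ⁴

square-divides-10 : ∀ e → e ℕ.* e ℕ.∣ 10 → e ≡ 1
square-divides-10 0 0∣10 = ⊥-elim (from-no (0 ℕ.∣? 10) 0∣10)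
square-divides-10 1 _ = refl
square-divides-10 2 4∣10 = ⊥-elim (from-no (4 ℕ.∣? 10) 4∣10)
square-divides-10 3 9∣10 = ⊥-elim (from-no (9 ℕ.∣? 10) 9∣10)
square-divides-10 e@(suc (suc (suc (suc _)))) e²∣10 =
  ⊥-elim (ℕ.<⇒≱ (ℕ.≤ᵇ⇒≤ 11 16 _) (ℕ.≤-trans (ℕ.*-mono-≤ 4≤e 4≤e) (ℕ.∣⇒≤ e²∣10)))
  where
  4≤e : 4 ℕ.≤ e
  4≤e = ℕ.s≤s (ℕ.s≤s (ℕ.s≤s (ℕ.s≤s ℕ.z≤n)))

module SplittingFactors {a g f u v : ℕ} (gf-coprime : Coprime g f) (uv≡ : u ℕ.* v ≡ 10 ℕ.* f ⁴)
  (u≡v+a : u ≡ v ℕ.+ a) (sum≡ : u ℕ.+ v ≡ g ℕ.* g ℕ.+ 6 ℕ.* (f ℕ.* f)) where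

  -- A common divisor e is coprime to f, since a common divisor of e and f divides u + v - 6 f² =
  -- g². As e² divides u v = 10 f⁴, it divides 10, which is squarefree.
  uv-coprime : Coprime u v
  uv-coprime {e} (e∣u , e∣v) = square-divides-10 e (Coprimality.coprime-divisor
    (coprime-* (coprime-f² e∣u e∣v) (coprime-f² e∣u e∣v))
    (subst (e ℕ.* e ℕ.∣_) (trans uv≡ (ℕ.*-comm 10 (f ⁴))) (ℕ.*-pres-∣ e∣u e∣v)))
    where
    coprime-f : ∀ {e} → e ℕ.∣ u → e ℕ.∣ v → Coprime e f
    coprime-f e∣u e∣v {d} (d∣e , d∣f) = gf-coprime (Coprimality.coprime-divisor
      (coprime-∣ d∣f (Coprimality.sym gf-coprime))
      (ℕ.∣m+n∣m⇒∣n {m = 6 ℕ.* (f ℕ.* f)} (subst (d ℕ.∣_) (trans sum≡ (ℕ.+-comm (g ℕ.* g) (6 ℕ.* (f ℕ.* f))))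
        (ℕ.∣m∣n⇒∣m+n (ℕ.∣-trans d∣e e∣u) (ℕ.∣-trans d∣e e∣v)))
        (ℕ.∣n⇒∣m*n 6 (ℕ.∣m⇒∣m*n f d∣f))) , d∣f)
    coprime-f² : ∀ {e} → e ℕ.∣ u → e ℕ.∣ v → Coprime e (f ⁴)
    coprime-f² e∣u e∣v = Coprimality.sym (coprime-* f² f²)
      where
      f¹ = Coprimality.sym (coprime-f e∣u e∣v)
      f² = coprime-* f¹ f¹

  split : ∀ κ μ x y → u ≡ κ ℕ.* x → v ≡ μ ℕ.* y → κ ℕ.* μ ≡ 10 → Splitting κ μ a g f
  split κ μ x y u≡ v≡ κμ≡ = go (coprime-fourth-power {x} {y} {f}
      (coprime-∣ (ℕ.divides κ u≡) (Coprimality.sym (coprime-∣ (ℕ.divides μ v≡) (Coprimality.sym uv-coprime))))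
      (ℕ.*-cancelˡ-≡ _ _ 10 (trans (cong (ℕ._* (x ℕ.* y)) (sym κμ≡))
        (trans (lemma κ μ x y) (trans (cong₂ ℕ._*_ (sym u≡) (sym v≡)) uv≡)))))
    where
    lemma : ∀ κ μ x y → κ ℕ.* μ ℕ.* (x ℕ.* y) ≡ κ ℕ.* x ℕ.* (μ ℕ.* y)
    lemma = ℕSolver.solve-∀
    go : (∃₂ λ r s → x ≡ r ⁴ × y ≡ s ⁴ × f ≡ r ℕ.* s × Coprime r s) → Splitting κ μ a g f
    go (r , s , x≡ , y≡ , f≡ , _) = record
      { r = r ; s = s ; f≡ = f≡
      ; sum≡ = trans (sym sum≡) (cong₂ ℕ._+_ u≡κr⁴ v≡μs⁴)
      ; diff≡ = inj₂ (trans (ℕ.+-comm a (μ ℕ.* s ⁴)) (trans (cong (ℕ._+ a) (sym v≡μs⁴)) (trans (sym u≡v+a) u≡κr⁴)))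
      }
      where
      u≡κr⁴ = trans u≡ (cong (κ ℕ.*_) x≡)
      v≡μs⁴ = trans v≡ (cong (μ ℕ.*_) y≡)

  Result = Splitting 1 10 a g f ⊎ Splitting 2 5 a g f

  flip : ∀ {κ μ} → Splitting κ μ a g f → Splitting μ κ a g f
  flip {κ} {μ} (splitting r s f≡ sum≡ diff≡) = splitting s r (trans f≡ (ℕ.*-comm r s))
    (trans sum≡ (ℕ.+-comm (κ ℕ.* r ⁴) (μ ℕ.* s ⁴))) ([ inj₂ , inj₁ ]′ diff≡)

  5∣-quotient : ∀ q → 5 ℕ.∣ q ℕ.* 2 → 5 ℕ.∣ q
  5∣-quotient q 5∣2q = [ (λ e → e) , (λ 5∣2 → ⊥-elim (from-no (5 ℕ.∣? 2) 5∣2)) ]′ (euclidsLemma q 2 prime[5] 5∣2q)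

  -- Each of the primes 2 and 5 divides u or v. The four distributions are identified in pairs by
  -- `flip`, which is possible because `Splitting` leaves open which of κ r⁴ and μ s⁴ is the larger.
  result : Result
  result = cases
    (euclidsLemma u v prime[2] (ℕ.divides (5 ℕ.* f ⁴) (trans uv≡ (lemma₁ (f ⁴)))))
    (euclidsLemma u v prime[5] (ℕ.divides (2 ℕ.* f ⁴) (trans uv≡ (lemma₂ (f ⁴)))))
    where
    lemma₁ : ∀ n → 10 ℕ.* n ≡ 5 ℕ.* n ℕ.* 2
    lemma₁ = ℕSolver.solve-∀
    lemma₂ : ∀ n → 10 ℕ.* n ≡ 2 ℕ.* n ℕ.* 5
    lemma₂ = ℕSolver.solve-∀
    lemma₃ : ∀ k → k ℕ.* 5 ℕ.* 2 ≡ 10 ℕ.* k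
    lemma₃ = ℕSolver.solve-∀
    ten : ∀ {n} q → n ≡ q ℕ.* 2 → 5 ℕ.∣ q → ∃ λ k → n ≡ 10 ℕ.* k
    ten q n≡ (ℕ.divides k q≡) = k , trans n≡ (trans (cong (ℕ._* 2) q≡) (lemma₃ k))
    go-u : (∃ λ k → u ≡ 10 ℕ.* k) → Result
    go-u (k , u≡) = inj₁ (flip (split 10 1 k v u≡ (sym (ℕ.*-identityˡ v)) refl))
    go-v : (∃ λ k → v ≡ 10 ℕ.* k) → Result
    go-v (k , v≡) = inj₁ (split 1 10 u k (sym (ℕ.*-identityˡ u)) v≡ refl)
    cases : 2 ℕ.∣ u ⊎ 2 ℕ.∣ v → 5 ℕ.∣ u ⊎ 5 ℕ.∣ v → Result
    cases (inj₁ (ℕ.divides q u≡)) (inj₁ 5∣u) = go-u (ten q u≡ (5∣-quotient q (subst (5 ℕ.∣_) u≡ 5∣u)))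
    cases (inj₂ (ℕ.divides q v≡)) (inj₂ 5∣v) = go-v (ten q v≡ (5∣-quotient q (subst (5 ℕ.∣_) v≡ 5∣v)))
    cases (inj₁ (ℕ.divides q u≡)) (inj₂ (ℕ.divides k v≡)) =
      inj₂ (split 2 5 q k (trans u≡ (ℕ.*-comm q 2)) (trans v≡ (ℕ.*-comm k 5)) refl)
    cases (inj₂ (ℕ.divides q v≡)) (inj₁ (ℕ.divides k u≡)) =
      inj₂ (flip (split 5 2 k q (trans u≡ (ℕ.*-comm k 5)) (trans v≡ (ℕ.*-comm q 2)) refl))

-- (g² + 6 f²)² = a² + 40 f⁴.
halving-splits : ∀ {a b} (H : Halving a b) → let open Halving H in Splitting 1 10 a g f ⊎ Splitting 2 5 a g f
halving-splits {a} {b} H = go (factor-difference h a (10 ℕ.* f ⁴) h²≡)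
  where
  open Halving H
  open ≡-Reasoning
  h = g ℕ.* g ℕ.+ 6 ℕ.* (f ℕ.* f)
  lemma₁ : ∀ g f → (g ℕ.* g ℕ.+ 6 ℕ.* (f ℕ.* f)) ℕ.* (g ℕ.* g ℕ.+ 6 ℕ.* (f ℕ.* f)) ≡
    g ℕ.* g ℕ.* (g ℕ.* g) ℕ.+ 12 ℕ.* (g ℕ.* g ℕ.* (f ℕ.* f)) ℕ.+ 36 ℕ.* (f ℕ.* f ℕ.* (f ℕ.* f))
  lemma₁ = ℕSolver.solve-∀
  lemma₂ : ∀ A F → A ℕ.+ 4 ℕ.* F ℕ.+ 36 ℕ.* F ≡ A ℕ.+ 4 ℕ.* (10 ℕ.* F)
  lemma₂ = ℕSolver.solve-∀
  h²≡ : h ℕ.* h ≡ a ℕ.* a ℕ.+ 4 ℕ.* (10 ℕ.* f ⁴)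
  h²≡ = trans (lemma₁ g f) (trans (cong (ℕ._+ 36 ℕ.* f ⁴) (sym a²≡)) (lemma₂ (a ℕ.* a) (f ⁴)))
  go : (∃ λ v → h ≡ v ℕ.+ a ℕ.+ v × v ℕ.* (v ℕ.+ a) ≡ 10 ℕ.* f ⁴) → Splitting 1 10 a g f ⊎ Splitting 2 5 a g f
  go (v , h≡ , vu≡) = SplittingFactors.result {u = v ℕ.+ a} {v} coprime (trans (ℕ.*-comm (v ℕ.+ a) v) vu≡) refl (sym h≡)

-- The descent on the quartic

#-+ : ∀ m n → # (m ℕ.+ n) ≡ # m + # n
#-+ m n = fromℤ-+ (+ m) (+ n)

#-* : ∀ m n → # (m ℕ.* n) ≡ # m * # n
#-* m n = trans (cong fromℤ (ℤ.pos-* m n)) (fromℤ-* (+ m) (+ n))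

#-injective : ∀ {m n} → # m ≡ # n → m ≡ n
#-injective eq = ℤ.+-injective (fromℤ-injective eq)

#-≢0 : ∀ {n} → n ≢ 0 → # n ≢ 0ℚ
#-≢0 n≢0 eq = n≢0 (#-injective eq)

infixl 6 _⊞_
infixl 7 _⊠_
infixl 8 _⊠⁴

-- With `_⊠_` and `_⊠⁴`, it lets a proof that `#` commutes with a whole expression be written in the
-- shape of that expression.
_⊞_ : ∀ {m n p q} → # m ≡ p → # n ≡ q → # (m ℕ.+ n) ≡ p + q
_⊞_ {m} {n} h k = trans (#-+ m n) (cong₂ _+_ h k)

_⊠_ : ∀ {m n p q} → # m ≡ p → # n ≡ q → # (m ℕ.* n) ≡ p * q
_⊠_ {m} {n} h k = trans (#-* m n) (cong₂ _*_ h k)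

ν : ∀ n → # n ≡ # n
ν n = refl

_⊠⁴ : ∀ {n p} → # n ≡ p → # (n ⁴) ≡ p * p * (p * p)
h ⊠⁴ = h ⊠ h ⊠ (h ⊠ h)

∣∙∣-square : ∀ i → # ℤ.∣ i ∣ * # ℤ.∣ i ∣ ≡ fromℤ i * fromℤ i
∣∙∣-square (+ n) = refl
∣∙∣-square -[1+ n ] = lemma (# (suc n))
  where
  lemma : ∀ x → x * x ≡ - x * - x
  lemma = solve-∀ ringℚ

-- For p ≠ 0, k is the factor cancelled when B / A is brought to lowest terms. The equation for A
-- keeps the factor ∣ `↥ p` ∣ because p may be 0.
numerator-∣ : ∀ p A B → p * fromℤ A ≡ fromℤ B → ∃ λ k → ℤ.∣ B ∣ ≡ ℤ.∣ ↥ p ∣ ℕ.* k × ℤ.∣ ↥ p ∣ ℕ.* ℤ.∣ A ∣ ≡ ℤ.∣ ↥ p ∣ ℕ.* (↧ₙ p ℕ.* k)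
numerator-∣ p A B eq = go (Coprimality.coprime-divisor (∣∙∣-coprime p) (ℕ.divides ℤ.∣ A ∣ d∣B∣≡))
  where
  open ≡-Reasoning
  n = ℤ.∣ ↥ p ∣
  lemma : ∀ p a d → p * d * a ≡ p * a * d
  lemma = solve-∀ ringℚ
  nA≡Bd : ↥ p ℤ.* A ≡ B ℤ.* ↧ p
  nA≡Bd = fromℤ-injective (begin
    fromℤ (↥ p ℤ.* A)             ≡⟨ fromℤ-* (↥ p) A ⟩
    fromℤ (↥ p) * fromℤ A         ≡⟨ cong (_* fromℤ A) (*-↧ p) ⟨
    p * fromℤ (↧ p) * fromℤ A     ≡⟨ lemma p (fromℤ A) (fromℤ (↧ p)) ⟩
    p * fromℤ A * fromℤ (↧ p)     ≡⟨ cong (_* fromℤ (↧ p)) eq ⟩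
    fromℤ B * fromℤ (↧ p)         ≡⟨ fromℤ-* B (↧ p) ⟨
    fromℤ (B ℤ.* ↧ p)             ∎)
  nA≡dB : n ℕ.* ℤ.∣ A ∣ ≡ ℤ.∣ B ∣ ℕ.* ↧ₙ p
  nA≡dB = trans (sym (ℤ.abs-* (↥ p) A)) (trans (cong ℤ.∣_∣ nA≡Bd) (ℤ.abs-* B (↧ p)))
  d∣B∣≡ : ↧ₙ p ℕ.* ℤ.∣ B ∣ ≡ ℤ.∣ A ∣ ℕ.* n
  d∣B∣≡ = trans (ℕ.*-comm (↧ₙ p) ℤ.∣ B ∣) (trans (sym nA≡dB) (ℕ.*-comm n ℤ.∣ A ∣))
  lemma′ : ∀ n k d → n ℕ.* k ℕ.* d ≡ n ℕ.* (d ℕ.* k)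
  lemma′ = ℕSolver.solve-∀
  go : n ℕ.∣ ℤ.∣ B ∣ → ∃ λ k → ℤ.∣ B ∣ ≡ n ℕ.* k × n ℕ.* ℤ.∣ A ∣ ≡ n ℕ.* (↧ₙ p ℕ.* k)
  go (ℕ.divides k B≡) = k , trans B≡ (ℕ.*-comm k n) , trans nA≡dB
    (trans (cong (ℕ._* ↧ₙ p) (trans B≡ (ℕ.*-comm k n))) (lemma′ n k (↧ₙ p)))

numerator-≤ : ∀ p m n → n ≢ 0 → p * # m ≡ # n → ℤ.∣ ↥ p ∣ ℕ.≤ n
numerator-≤ p m n n≢0 eq = ℕ.∣⇒≤ {{ℕ.≢-nonZero n≢0}} (ℕ.divides (proj₁ h) (trans (proj₁ (proj₂ h)) (ℕ.*-comm _ (proj₁ h))))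
  where
  h = numerator-∣ p (+ m) (+ n) eq

-- With p = B / A₁ and q = B / A₂ in lowest terms, no prime power of B is cancelled
-- by both A₁ and A₂ beyond its multiplicity in A₁ A₂.
numerators-∣ : ∀ p q A₁ A₂ B K → B ≢ ℤ.0ℤ → p * fromℤ A₁ ≡ fromℤ B → q * fromℤ A₂ ≡ fromℤ B →
  A₁ ℤ.* A₂ ≡ K ℤ.* B → ℤ.∣ ↥ p ∣ ℕ.* ℤ.∣ ↥ q ∣ ℕ.∣ ℤ.∣ B ∣
numerators-∣ p q A₁ A₂ B K B≢0 eq₁ eq₂ A₁A₂≡ = subst (n₁ ℕ.* n₂ ℕ.∣_) (trans (ℕ.*-comm k₂ n₂) (sym B≡₂)) (ℕ.*-pres-∣ n₁∣k₂ (ℕ.∣-refl {n₂}))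
  where
  n₁ = ℤ.∣ ↥ p ∣
  n₂ = ℤ.∣ ↥ q ∣
  h₁ = numerator-∣ p A₁ B eq₁
  h₂ = numerator-∣ q A₂ B eq₂
  k₁ = proj₁ h₁
  k₂ = proj₁ h₂
  B≡₁ = proj₁ (proj₂ h₁)
  B≡₂ = proj₁ (proj₂ h₂)
  ∣B∣≢0 : ℤ.∣ B ∣ ≢ 0
  ∣B∣≢0 eq = B≢0 (ℤ.∣i∣≡0⇒i≡0 eq)
  instance
    n₁≢0 : ℕ.NonZero n₁
    n₁≢0 = ℕ.≢-nonZero (λ e → ∣B∣≢0 (trans B≡₁ (cong (ℕ._* k₁) e)))
    n₂≢0 : ℕ.NonZero n₂
    n₂≢0 = ℕ.≢-nonZero (λ e → ∣B∣≢0 (trans B≡₂ (cong (ℕ._* k₂) e)))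
    k₁≢0 : ℕ.NonZero k₁
    k₁≢0 = ℕ.≢-nonZero (λ e → ∣B∣≢0 (trans B≡₁ (trans (cong (n₁ ℕ.*_) e) (ℕ.*-zeroʳ n₁))))
  A≡₁ : ℤ.∣ A₁ ∣ ≡ ↧ₙ p ℕ.* k₁
  A≡₁ = ℕ.*-cancelˡ-≡ _ _ n₁ (proj₂ (proj₂ h₁))
  A≡₂ : ℤ.∣ A₂ ∣ ≡ ↧ₙ q ℕ.* k₂
  A≡₂ = ℕ.*-cancelˡ-≡ _ _ n₂ (proj₂ (proj₂ h₂))
  lemma₁ : ∀ d k a → d ℕ.* a ℕ.* k ≡ d ℕ.* k ℕ.* a
  lemma₁ = ℕSolver.solve-∀
  -- Cancelling k₁ in A₁ A₂ = K B leaves d₁ A₂ = K n₁, where d₁ is the denominator of p and so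
  -- coprime to n₁.
  n₁∣A₂ : n₁ ℕ.∣ ℤ.∣ A₂ ∣
  n₁∣A₂ = Coprimality.coprime-divisor (∣∙∣-coprime p) (ℕ.divides ℤ.∣ K ∣ (ℕ.*-cancelʳ-≡ _ _ k₁
    (trans (lemma₁ (↧ₙ p) k₁ ℤ.∣ A₂ ∣) (trans (cong (ℕ._* ℤ.∣ A₂ ∣) (sym A≡₁)) (trans (sym (ℤ.abs-* A₁ A₂))
      (trans (cong ℤ.∣_∣ A₁A₂≡) (trans (ℤ.abs-* K B) (trans (cong (ℤ.∣ K ∣ ℕ.*_) B≡₁) (sym (ℕ.*-assoc ℤ.∣ K ∣ n₁ k₁))))))))))
  -- n₁ divides both A₂ = d₂ k₂ and B = n₂ k₂, and d₂ is coprime to n₂.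
  n₁∣k₂ : n₁ ℕ.∣ k₂
  n₁∣k₂ = Coprimality.coprime-factors (Coprimality.sym (∣∙∣-coprime q))
    (subst (n₁ ℕ.∣_) A≡₂ n₁∣A₂ , subst (n₁ ℕ.∣_) B≡₂ (ℕ.divides k₁ (trans B≡₁ (ℕ.*-comm n₁ k₁))))

-- Points whose double is a multiple of `P₀`

T : 𝕁
T = point 0ℚ (- 1ℚ) refl

-- The image of (1 , 3).
P₀ : 𝕁
P₀ = point (# 2 ÷ # 3) (# 5 ÷ # 9) refl

-- 2 P = (k - l) `P₀`; the difference is spread over both sides so that only natural multiples
-- occur.
record Even (P : 𝕁) : Set where
  constructor even
  field
    k l      : ℕ
    equation : P ∙ P ∙ l · P₀ ≡ k · P₀

even-∙ : ∀ {P Q} → Even P → Even Q → Even (P ∙ Q)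
even-∙ {P} {Q} (even k l eq) (even k′ l′ eq′) = even (k ℕ.+ k′) (l ℕ.+ l′) (begin
  P ∙ Q ∙ (P ∙ Q) ∙ (l ℕ.+ l′) · P₀          ≡⟨ cong₂ _∙_ (interchange P Q P Q) (×-homo-+ P₀ l l′) ⟩
  P ∙ P ∙ (Q ∙ Q) ∙ (l · P₀ ∙ l′ · P₀)       ≡⟨ interchange (P ∙ P) (Q ∙ Q) (l · P₀) (l′ · P₀) ⟩
  P ∙ P ∙ l · P₀ ∙ (Q ∙ Q ∙ l′ · P₀)         ≡⟨ cong₂ _∙_ eq eq′ ⟩
  k · P₀ ∙ k′ · P₀                           ≡⟨ ×-homo-+ P₀ k k′ ⟨
  (k ℕ.+ k′) · P₀                            ∎)
  where open ≡-Reasoning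

even-⁻¹ : ∀ {P} → Even P → Even (P ⁻¹)
even-⁻¹ {P} (even k l eq) = even l k (begin
  P ⁻¹ ∙ P ⁻¹ ∙ k · P₀                       ≡⟨ cong (P ⁻¹ ∙ P ⁻¹ ∙_) eq ⟨
  P ⁻¹ ∙ P ⁻¹ ∙ (P ∙ P ∙ l · P₀)             ≡⟨ ∙-assoc (P ⁻¹ ∙ P ⁻¹) (P ∙ P) (l · P₀) ⟨
  P ⁻¹ ∙ P ⁻¹ ∙ (P ∙ P) ∙ l · P₀             ≡⟨ cong (_∙ l · P₀) (interchange (P ⁻¹) (P ⁻¹) P P) ⟩
  P ⁻¹ ∙ P ∙ (P ⁻¹ ∙ P) ∙ l · P₀             ≡⟨ cong (λ R → R ∙ R ∙ l · P₀) (∙-inverseˡ P) ⟩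
  O ∙ O ∙ l · P₀                             ≡⟨ cong (_∙ l · P₀) (∙-identityˡ O) ⟩
  O ∙ l · P₀                                 ≡⟨ ∙-identityˡ (l · P₀) ⟩
  l · P₀                                     ∎)
  where open ≡-Reasoning

even-O : Even O
even-O = even 0 0 (trans (∙-identityʳ (O ∙ O)) (∙-identityˡ O))

even-T : Even T
even-T = even 0 0 (trans (∙-identityʳ (T ∙ T)) (∙-unique {T} {T} {O} refl refl))

even-P₀ : Even P₀
even-P₀ = even 2 0 (trans (∙-identityʳ (P₀ ∙ P₀)) (cong (P₀ ∙_) (sym (∙-identityʳ P₀))))

even-shift : ∀ {P} → Even (P ∙ P₀ ⁻¹) → Even P
even-shift {P} ev = subst Even (trans (∙-assoc P (P₀ ⁻¹) P₀)
  (trans (cong (P ∙_) (∙-inverseˡ P₀)) (∙-identityʳ P))) (even-∙ {P ∙ P₀ ⁻¹} {P₀} ev even-P₀)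

-- Points with x-coordinates ± x differ by a sign and by T.
even-ξ² : ∀ {S P} → ξ S * ξ S ≡ ξ P * ξ P → Even S → Even P
even-ξ² {S} {P} eq ev = cases (equal-squares (sym eq)) (equal-squares η²)
  where
  η² : η P * η P ≡ η S * η S
  η² = trans (on P) (trans (cong (λ z → 1ℚ - # 6 * z + # 10 * (z * z)) (sym eq)) (sym (on S)))
  lemma₁ : ∀ x → - x * - 1ℚ ≡ x
  lemma₁ = solve-∀ ringℚ
  lemma₂ : ∀ x → x * - 1ℚ ≡ - x
  lemma₂ = solve-∀ ringℚ
  cases : ξ P ≡ ξ S ⊎ ξ P ≡ - ξ S → η P ≡ η S ⊎ η P ≡ - η S → Even P
  cases (inj₁ x≡) (inj₁ y≡) = subst Even (J-≡ (sym x≡) (sym y≡)) ev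
  cases (inj₂ x≡) (inj₁ y≡) = subst Even (J-≡ (sym x≡) (sym y≡)) (even-⁻¹ ev)
  cases (inj₁ x≡) (inj₂ y≡) = subst Even (J-≡
    (trans (proj₁ (scale (S ⁻¹) T refl)) (trans (lemma₁ (ξ S)) (sym x≡)))
    (trans (proj₂ (scale (S ⁻¹) T refl)) (trans (lemma₂ (η S)) (sym y≡)))) (even-∙ (even-⁻¹ ev) even-T)
  cases (inj₂ x≡) (inj₂ y≡) = subst Even (J-≡
    (trans (proj₁ (scale S T refl)) (trans (lemma₂ (ξ S)) (sym x≡)))
    (trans (proj₂ (scale S T refl)) (trans (lemma₂ (η S)) (sym y≡)))) (even-∙ ev even-T)

scaled-jacobi : ∀ a b m → a ≢ 0ℚ → m * m ≡ a * a * (a * a) - # 6 * (a * a * (b * b)) + # 10 * (b * b * (b * b)) →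
  ∃ λ P → ξ P * a ≡ b × η P * (a * a) ≡ m
scaled-jacobi a b m a≢0 eq = point x₀ y₀ p , ÷-cancel b a a≢0 , ÷-cancel m (a * a) (square-≢0 a≢0)
  where
  open ≡-Reasoning
  x₀ = b /[ a , a≢0 ]
  y₀ = m /[ a * a , square-≢0 a≢0 ]
  lemma₁ : ∀ y a → y * y * (a * a * (a * a)) ≡ y * (a * a) * (y * (a * a))
  lemma₁ = solve-∀ ringℚ
  lemma₂ : ∀ x a → a * a * (a * a) - # 6 * (a * a * (x * a * (x * a))) + # 10 * (x * a * (x * a) * (x * a * (x * a))) ≡
    (1ℚ - # 6 * (x * x) + # 10 * ((x * x) * (x * x))) * (a * a * (a * a))
  lemma₂ = solve-∀ ringℚ
  p : y₀ * y₀ ≡ jacobi x₀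
  p = *-cancelʳ _ _ (a * a * (a * a)) (square-≢0 (square-≢0 a≢0)) (begin
    y₀ * y₀ * (a * a * (a * a))            ≡⟨ lemma₁ y₀ a ⟩
    y₀ * (a * a) * (y₀ * (a * a))          ≡⟨ cong₂ _*_ (÷-cancel m (a * a) (square-≢0 a≢0)) (÷-cancel m (a * a) (square-≢0 a≢0)) ⟩
    m * m                                  ≡⟨ eq ⟩
    a * a * (a * a) - # 6 * (a * a * (b * b)) + # 10 * (b * b * (b * b))
      ≡⟨ cong (λ b → a * a * (a * a) - # 6 * (a * a * (b * b)) + # 10 * (b * b * (b * b))) (÷-cancel b a a≢0) ⟨
    a * a * (a * a) - # 6 * (a * a * (x₀ * a * (x₀ * a))) + # 10 * (x₀ * a * (x₀ * a) * (x₀ * a * (x₀ * a)))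
      ≡⟨ lemma₂ x₀ a ⟩
    jacobi x₀ * (a * a * (a * a))          ∎)

double-ξ : ∀ R a b m → ξ R * a ≡ b → η R * (a * a) ≡ m →
  ξ (R ∙ R) * (a * a * (a * a) - # 10 * (b * b * (b * b))) ≡ # 2 * (a * b * m)
double-ξ R a _ _ refl refl = trans (lemma₁ (ξ (R ∙ R)) (ξ R) a)
  (trans (cong (_* (a * a * (a * a))) (ξ-∙ R R)) (lemma₂ (ξ R) (η R) a))
  where
  lemma₁ : ∀ z x a → z * (a * a * (a * a) - # 10 * (x * a * (x * a) * (x * a * (x * a)))) ≡
    z * (1ℚ - # 10 * ((x * x) * (x * x))) * (a * a * (a * a))
  lemma₁ = solve-∀ ringℚ
  lemma₂ : ∀ x y a → (x * y + x * y) * (a * a * (a * a)) ≡ # 2 * (a * (x * a) * (y * (a * a)))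
  lemma₂ = solve-∀ ringℚ

double-den≢0 : ∀ R a b → ξ R * a ≡ b → a ≢ 0ℚ → a * a * (a * a) - # 10 * (b * b * (b * b)) ≢ 0ℚ
double-den≢0 R a _ refl a≢0 eq = *-≢0 (den≢0 (ξ R) (ξ R)) (square-≢0 (square-≢0 a≢0)) (trans (lemma (ξ R) a) eq)
  where
  lemma : ∀ x a → (1ℚ - # 10 * ((x * x) * (x * x))) * (a * a * (a * a)) ≡
    a * a * (a * a) - # 10 * (x * a * (x * a) * (x * a * (x * a)))
  lemma = solve-∀ ringℚ

square-scale : ∀ p q d n → d ≢ 0ℚ → p * d ≡ n → q * q * (d * d) ≡ n * n → p * p ≡ q * q
square-scale p q d _ d≢0 refl eq = *-cancelʳ _ _ (d * d) (square-≢0 d≢0) (trans (lemma p d) (sym eq))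
  where
  lemma : ∀ p d → p * p * (d * d) ≡ p * d * (p * d)
  lemma = solve-∀ ringℚ

-- A point P with x(P) = ± n / δ lies in Even as soon as a certain point with x-coordinate β / α does.
Reduction : (n δ α β : ℚ) → Set
Reduction n δ α β = ∃ λ R → ξ R * α ≡ β × (Even R → ∀ P → ξ P * ξ P * (δ * δ) ≡ n * n → Even P)

-- The hypothesis is the equation of the quartic at x = s / r, y = g / r², and doubling this point R
-- gives x = 2 g r s / (r⁴ - 10 s⁴). The factor `# 1` keeps δ in the common form κ r⁴ - μ s⁴.
class₁ : ∀ r s g → let δ = # 1 * (r * r * (r * r)) - # 10 * (s * s * (s * s)) in r ≢ 0ℚ →
  g * g + # 6 * (r * s * (r * s)) ≡ # 1 * (r * r * (r * r)) + # 10 * (s * s * (s * s)) →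
  Reduction (# 2 * (g * (r * s))) δ r s
class₁ r s g r≢0 eq = R , ξR , λ ev P ξP → even-ξ² {R ∙ R} {P}
  (square-scale (ξ (R ∙ R)) (ξ P) δ (# 2 * (g * (r * s)))
    (λ δ≡0 → double-den≢0 R r s ξR r≢0 (trans (lemma₃ r s) δ≡0))
    (trans (cong (ξ (R ∙ R) *_) (sym (lemma₃ r s))) (trans (double-ξ R r s g ξR ηR) (lemma₂ r s g))) ξP) (even-∙ ev ev)
  where
  δ = # 1 * (r * r * (r * r)) - # 10 * (s * s * (s * s))
  lemma₁ : ∀ r s g → g * g ≡ r * r * (r * r) - # 6 * (r * r * (s * s)) + # 10 * (s * s * (s * s)) +
    (g * g + # 6 * (r * s * (r * s)) - (# 1 * (r * r * (r * r)) + # 10 * (s * s * (s * s)))) * 1ℚ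
  lemma₁ = solve-∀ ringℚ
  lemma₂ : ∀ r s g → # 2 * (r * s * g) ≡ # 2 * (g * (r * s))
  lemma₂ = solve-∀ ringℚ
  lemma₃ : ∀ r s → r * r * (r * r) - # 10 * (s * s * (s * s)) ≡ # 1 * (r * r * (r * r)) - # 10 * (s * s * (s * s))
  lemma₃ = solve-∀ ringℚ
  R×= = scaled-jacobi r s g r≢0 (modulo eq _ (lemma₁ r s g))
  R = proj₁ R×=
  ξR = proj₁ (proj₂ R×=)
  ηR = proj₂ (proj₂ R×=)

-- On the 2-covering g² = 2 r⁴ - 6 r² s² + 5 s⁴ the point P satisfies P - P₀ = 2 R up to sign and T.
class₂ : ∀ r s g → let δ = # 2 * (r * r * (r * r)) - # 5 * (s * s * (s * s)) in
  δ ≢ 0ℚ → g - r * s ≢ 0ℚ →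
  g * g + # 6 * (r * s * (r * s)) ≡ # 2 * (r * r * (r * r)) + # 5 * (s * s * (s * s)) →
  Reduction (# 2 * (g * (r * s))) δ (g - r * s) (r * r - s * s)
class₂ r s g δ≢0 α≢0 eq = R , ξR , λ ev P ξP → even-ξ² {S} {P}
  (square-scale (ξ S) (ξ P) δ n δ≢0 ξS ξP)
  (even-shift {S} (even-ξ² {R ∙ R} {S ∙ P₀ ⁻¹} (cong₂ _*_ double≡ double≡) (even-∙ ev ev)))
  where
  open ≡-Reasoning
  δ = # 2 * (r * r * (r * r)) - # 5 * (s * s * (s * s))
  α = g - r * s
  β = r * r - s * s
  n = # 2 * (g * (r * s))
  -- The y-coordinates will be m / δ² for S and μ / α² for R. Here m = g⁴ + 4 f⁴ with f = r s is the
  -- numerator of (X² + 4) / D at X = g² / f².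
  m = g * g * (g * g) + # 4 * (r * s * (r * s) * (r * s * (r * s)))
  μ = # 2 * (r * r * (r * s)) - # 4 * (r * s * (s * s)) + g * (r * r + s * s)
  on-R : ∀ r s g →
    let r² = r * r
        s² = s * s
        g² = g * g
        α = g - r * s
        β = r * r - s * s
        μ = # 2 * (r * r * (r * s)) - # 4 * (r * s * (s * s)) + g * (r * r + s * s)
    in μ * μ ≡ α * α * (α * α) - # 6 * (α * α * (β * β)) + # 10 * (β * β * (β * β))
      + (g * g + # 6 * (r * s * (r * s)) - (# 2 * (r * r * (r * r)) + # 5 * (s * s * (s * s))))
        * (# 5 * r² * (r² - # 2 * s²) + # 2 * s² * s² + # 4 * g * r * s - g²)
  on-R = solve-∀ ringℚ
  on-S : ∀ r s g →
    let r² = r * r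
        s² = s * s
        g² = g * g
        δ = # 2 * (r * r * (r * r)) - # 5 * (s * s * (s * s))
        n = # 2 * (g * (r * s))
        m = g * g * (g * g) + # 4 * (r * s * (r * s) * (r * s * (r * s)))
    in m * m ≡ δ * δ * (δ * δ) - # 6 * (δ * δ * (n * n)) + # 10 * (n * n * (n * n))
      + (g * g + # 6 * (r * s * (r * s)) - (# 2 * (r * r * (r * r)) + # 5 * (s * s * (s * s))))
        * (# 2 * r² * (s² * (s² * (# 75 * s² * s² * s² - # 30 * g² * s² - (r² * (s² * (# 72 * r² + # 35 * s²) + # 48 * g² + # 14 * r² * r²))) + # 12 * r² * r² * (r² * r² - g²) - (# 3 * g² * g²)) + r² * (# 2 * r² * r² * (g² + # 2 * r² * r²) + g² * g²)) + # 5 * s² * s² * (# 5 * s² * s² * (g² + # 5 * s² * s²) + g² * g²) + g² * g² * g²)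
  on-S = solve-∀ ringℚ
  identity : ∀ r s g →
    let r² = r * r
        s² = s * s
        g² = g * g
        δ = # 2 * (r * r * (r * r)) - # 5 * (s * s * (s * s))
        n = # 2 * (g * (r * s))
        m = g * g * (g * g) + # 4 * (r * s * (r * s) * (r * s * (r * s)))
        α = g - r * s
        β = r * r - s * s
        μ = # 2 * (r * r * (r * s)) - # 4 * (r * s * (s * s)) + g * (r * r + s * s)
    in (# 5 * (δ * n) - # 6 * m) * (α * α * (α * α) - # 10 * (β * β * (β * β))) ≡
      # 2 * (α * β * μ) * (# 9 * (δ * δ) - # 40 * (n * n))
      + (g * g + # 6 * (r * s * (r * s)) - (# 2 * (r * r * (r * r)) + # 5 * (s * s * (s * s))))
        * (# 2 * (r² * (s² * (# 4 * g * r * s * (# 35 * s² * s² - # 15 * g² - (# 26 * r² * (r² + # 3 * s²))) + # 3 * r² * (s² * (# 10 * s² * s² + # 35 * g² + # 86 * r² * s² - # 20 * r² * r²) + # 12 * r² * (g² - r² * r²)) - (# 90 * s² * s² * (g² + # 2 * s² * s²))) + # 34 * g * r * r² * s * (g² + # 2 * r² * r²) + # 6 * g² * r² * (# 3 * r² * r² - g²)) + g * r * s * (# 35 * s² * s² * (g² + # 5 * s² * s²) + # 12 * g² * g²) - (# 3 * g² * (# 5 * s² * s² * (# 3 * s² * s² + g²) + g² * g²))))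
  identity = solve-∀ ringℚ
  R×= = scaled-jacobi α β μ α≢0 (modulo eq _ (on-R r s g))
  R = proj₁ R×=
  ξR = proj₁ (proj₂ R×=)
  ηR = proj₂ (proj₂ R×=)
  S×= = scaled-jacobi δ n m δ≢0 (modulo eq _ (on-S r s g))
  S = proj₁ S×=
  ξS = proj₁ (proj₂ S×=)
  ηS = proj₂ (proj₂ S×=)
  -- x(S - P₀) = (5 δ n - 6 m) / (9 δ² - 40 n²), from x(P₀) = 2 / 3 and y(P₀) = 5 / 9.
  shifted : ∀ x y d n m → x * d ≡ n → y * (d * d) ≡ m → ∀ z →
    z * den x (- ξ P₀) ≡ sumX x y (- ξ P₀) (η P₀) → z * (# 9 * (d * d) - # 40 * (n * n)) ≡ # 5 * (d * n) - # 6 * m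
  shifted x y d _ _ refl refl z h = trans (lemma₁ z x d) (trans (cong (_* (# 9 * (d * d))) h) (lemma₂ x y d))
    where
    lemma₁ : ∀ z x d → z * (# 9 * (d * d) - # 40 * (x * d * (x * d))) ≡
      z * (1ℚ - # 10 * (x * x * (- (# 2 ÷ # 3) * - (# 2 ÷ # 3)))) * (# 9 * (d * d))
    lemma₁ = solve-∀ ringℚ
    lemma₂ : ∀ x y d → (x * (# 5 ÷ # 9) + - (# 2 ÷ # 3) * y) * (# 9 * (d * d)) ≡ # 5 * (d * (x * d)) - # 6 * (y * (d * d))
    lemma₂ = solve-∀ ringℚ
  shifted≢0 : ∀ x d n → x * d ≡ n → d ≢ 0ℚ → # 9 * (d * d) - # 40 * (n * n) ≢ 0ℚ
  shifted≢0 x d _ refl d≢0 e = *-≢0 (den≢0 x (- ξ P₀)) (*-≢0 {# 9} (λ ()) (square-≢0 d≢0)) (trans (lemma x d) e)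
    where
    lemma : ∀ x d → (1ℚ - # 10 * (x * x * (- (# 2 ÷ # 3) * - (# 2 ÷ # 3)))) * (# 9 * (d * d)) ≡
      # 9 * (d * d) - # 40 * (x * d * (x * d))
    lemma = solve-∀ ringℚ
  dₗ = # 9 * (δ * δ) - # 40 * (n * n)
  dᵣ = α * α * (α * α) - # 10 * (β * β * (β * β))
  lemma₃ : ∀ z a b → z * (a * b) ≡ z * a * b
  lemma₃ = solve-∀ ringℚ
  lemma₄ : ∀ z a b → z * a * b ≡ z * (b * a)
  lemma₄ = solve-∀ ringℚ
  double≡ : ξ (R ∙ R) ≡ ξ (S ∙ P₀ ⁻¹)
  double≡ = sym (*-cancelʳ _ _ (dₗ * dᵣ) (*-≢0 (shifted≢0 (ξ S) δ n ξS δ≢0) (double-den≢0 R α β ξR α≢0)) (begin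
    ξ (S ∙ P₀ ⁻¹) * (dₗ * dᵣ)            ≡⟨ lemma₃ (ξ (S ∙ P₀ ⁻¹)) dₗ dᵣ ⟩
    ξ (S ∙ P₀ ⁻¹) * dₗ * dᵣ              ≡⟨ cong (_* dᵣ) (shifted (ξ S) (η S) δ n m ξS ηS (ξ (S ∙ P₀ ⁻¹)) (ξ-∙ S (P₀ ⁻¹))) ⟩
    (# 5 * (δ * n) - # 6 * m) * dᵣ       ≡⟨ modulo eq _ (identity r s g) ⟩
    # 2 * (α * β * μ) * dₗ               ≡⟨ cong (_* dₗ) (double-ξ R α β μ ξR ηR) ⟨
    ξ (R ∙ R) * dᵣ * dₗ                  ≡⟨ lemma₄ (ξ (R ∙ R)) dᵣ dₗ ⟩
    ξ (R ∙ R) * (dₗ * dᵣ)                ∎))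

-- The square of y a² is an integer, so y a² itself is one by `integral-root`; m is its absolute
-- value.
jacobi-ℕ : ∀ P → let a = ↧ₙ (ξ P); b = ℤ.∣ ↥ ξ P ∣ in
  ∃ λ m → m ℕ.* m ℕ.+ 6 ℕ.* (a ℕ.* a ℕ.* (b ℕ.* b)) ≡ a ⁴ ℕ.+ 10 ℕ.* b ⁴
jacobi-ℕ P = ℤ.∣ M ∣ , #-injective (begin
  # (ℤ.∣ M ∣ ℕ.* ℤ.∣ M ∣ ℕ.+ X)          ≡⟨ #-+ (ℤ.∣ M ∣ ℕ.* ℤ.∣ M ∣) X ⟩
  # (ℤ.∣ M ∣ ℕ.* ℤ.∣ M ∣) + # X          ≡⟨ cong (_+ # X) (trans (#-* ℤ.∣ M ∣ ℤ.∣ M ∣) (∣∙∣-square M)) ⟩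
  fromℤ M * fromℤ M + # X                ≡⟨ cong (λ q → q * q + # X) (proj₂ root) ⟨
  p * p + # X                            ≡⟨ p²+X≡Y ⟩
  # Y                                    ∎)
  where
  open ≡-Reasoning
  a = ↧ₙ (ξ P)
  b = ℤ.∣ ↥ ξ P ∣
  X = 6 ℕ.* (a ℕ.* a ℕ.* (b ℕ.* b))
  Y = a ⁴ ℕ.+ 10 ℕ.* b ⁴
  p = η P * (# a * # a)
  lemma₁ : ∀ x y a → y * (a * a) * (y * (a * a)) + # 6 * (a * a * (x * a * (x * a))) ≡
    a * a * (a * a) + # 10 * (x * a * (x * a) * (x * a * (x * a)))
    + (y * y - (1ℚ - # 6 * (x * x) + # 10 * ((x * x) * (x * x)))) * (a * a * (a * a))
  lemma₁ = solve-∀ ringℚ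
  lemma₂ : ∀ p x y → p ≡ y + - x + (p + x - y) * 1ℚ
  lemma₂ = solve-∀ ringℚ
  b² : # b * # b ≡ ξ P * # a * (ξ P * # a)
  b² = trans (∣∙∣-square (↥ ξ P)) (sym (cong₂ _*_ (*-↧ (ξ P)) (*-↧ (ξ P))))
  B² : # (b ℕ.* b) ≡ ξ P * # a * (ξ P * # a)
  B² = trans (#-* b b) b²
  X≡ : # X ≡ # 6 * (# a * # a * (ξ P * # a * (ξ P * # a)))
  X≡ = ν 6 ⊠ (ν a ⊠ ν a ⊠ B²)
  Y≡ : # Y ≡ # a * # a * (# a * # a) + # 10 * (ξ P * # a * (ξ P * # a) * (ξ P * # a * (ξ P * # a)))
  Y≡ = ν a ⊠⁴ ⊞ ν 10 ⊠ (B² ⊠ B²)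
  p²+X≡Y : p * p + # X ≡ # Y
  p²+X≡Y = trans (cong (λ z → p * p + z) X≡) (trans (modulo (on P) _ (lemma₁ (ξ P) (η P) (# a))) (sym Y≡))
  root : ∃ λ n → p ≡ fromℤ n
  root = integral-root p (+ Y ℤ.- + X) (trans (modulo p²+X≡Y _ (lemma₂ (p * p) (# X) (# Y)))
    (sym (trans (fromℤ-+ (+ Y) (ℤ.- + X)) (cong (λ z → # Y + z) (fromℤ-neg (+ X))))))
  M = proj₁ root

fromℤ-difference : ∀ m n → fromℤ (+ m ℤ.- + n) ≡ # m - # n
fromℤ-difference m n = trans (fromℤ-+ (+ m) (ℤ.- + n)) (cong (λ z → # m + z) (fromℤ-neg (+ n)))

-- With z = r / (5 s) equality would read 10 z² = 1.
2r²≢5s² : ∀ r s → s ≢ 0ℚ → # 2 * (r * r) - # 5 * (s * s) ≢ 0ℚ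
2r²≢5s² r s s≢0 eq = 1-10z²≢0 z (*-≡0 (trans (lemma z s) (trans (cong (λ r → # 5 * (s * s) - # 2 * (r * r)) z5s≡r)
    (trans (lemma′ r s) (cong -_ eq)))) (*-≢0 {# 5} (λ ()) (square-≢0 s≢0)))
  where
  5s≢0 = *-≢0 {# 5} {s} (λ ()) s≢0
  z = r /[ # 5 * s , 5s≢0 ]
  z5s≡r : z * (# 5 * s) ≡ r
  z5s≡r = ÷-cancel r (# 5 * s) 5s≢0
  lemma : ∀ z s → # 5 * (s * s) * (1ℚ - # 10 * (z * z)) ≡ # 5 * (s * s) - # 2 * (z * (# 5 * s) * (z * (# 5 * s)))
  lemma = solve-∀ ringℚ
  lemma′ : ∀ r s → # 5 * (s * s) - # 2 * (r * r) ≡ - (# 2 * (r * r) - # 5 * (s * s))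
  lemma′ = solve-∀ ringℚ

splitting-sum : ∀ {κ μ a g f} (S : Splitting κ μ a g f) → let open Splitting S in
  # g * # g + # 6 * (# r * # s * (# r * # s)) ≡ # κ * (# r * # r * (# r * # r)) + # μ * (# s * # s * (# s * # s))
splitting-sum {κ} {μ} {a} {g} {f} S = trans (sym (ν g ⊠ ν g ⊞ ν 6 ⊠ (F ⊠ F)))
  (trans (cong #_ sum≡) (ν κ ⊠ ν r ⊠⁴ ⊞ ν μ ⊠ ν s ⊠⁴))
  where
  open Splitting S
  F : # f ≡ # r * # s
  F = trans (cong #_ f≡) (ν r ⊠ ν s)

splitting-diff : ∀ {κ μ a g f} (S : Splitting κ μ a g f) → let open Splitting S in
  let δ = # κ * (# r * # r * (# r * # r)) - # μ * (# s * # s * (# s * # s)) in δ * δ ≡ # a * # a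
splitting-diff {κ} {μ} {a} S = [ (λ h → go (# a) K N (trans (cong (λ z → # a + z) (sym K≡)) (trans (sym (#-+ a (κ ℕ.* r ⁴))) (trans (cong #_ h) N≡))))
                   , (λ h → go′ (# a) K N (trans (cong (λ z → # a + z) (sym N≡)) (trans (sym (#-+ a (μ ℕ.* s ⁴))) (trans (cong #_ h) K≡)))) ]′ diff≡
  where
  open Splitting S
  K = # κ * (# r * # r * (# r * # r))
  N = # μ * (# s * # s * (# s * # s))
  K≡ : # (κ ℕ.* r ⁴) ≡ K
  K≡ = ν κ ⊠ ν r ⊠⁴
  N≡ : # (μ ℕ.* s ⁴) ≡ N
  N≡ = ν μ ⊠ ν s ⊠⁴
  lemma : ∀ a k → (k - (a + k)) * (k - (a + k)) ≡ a * a
  lemma = solve-∀ ringℚ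
  lemma′ : ∀ a n → (a + n - n) * (a + n - n) ≡ a * a
  lemma′ = solve-∀ ringℚ
  go : ∀ a k n → a + k ≡ n → (k - n) * (k - n) ≡ a * a
  go a k _ refl = lemma a k
  go′ : ∀ a k n → a + n ≡ k → (k - n) * (k - n) ≡ a * a
  go′ a _ n refl = lemma′ a n

-- If both n₁ and n₂ were at least b, then b² ≤ n₁ n₂ ≤ r² + s² ≤ 2 r² s² < 4 r² s² ≤ b².
numerator-bound : ∀ r s → r ≢ 0 → s ≢ 0 → ∀ n₁ n₂ b → n₁ ℕ.* n₂ ℕ.≤ r ℕ.* r ℕ.+ s ℕ.* s → 2 ℕ.* (r ℕ.* s) ℕ.≤ b →
  n₁ ℕ.< b ⊎ n₂ ℕ.< b
numerator-bound r s r≢0 s≢0 n₁ n₂ b small large = go (n₁ ℕ.<? b) (n₂ ℕ.<? b)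
  where
  instance
    r-nonZero : ℕ.NonZero r
    r-nonZero = ℕ.≢-nonZero r≢0
    s-nonZero : ℕ.NonZero s
    s-nonZero = ℕ.≢-nonZero s≢0
    rs-nonZero : ℕ.NonZero (r ℕ.* s)
    rs-nonZero = ℕ.m*n≢0 r s
    r²s²-nonZero : ℕ.NonZero (r ℕ.* s ℕ.* (r ℕ.* s))
    r²s²-nonZero = ℕ.m*n≢0 (r ℕ.* s) (r ℕ.* s)
  r²≤ : r ℕ.* r ℕ.≤ r ℕ.* s ℕ.* (r ℕ.* s)
  r²≤ = ℕ.*-mono-≤ (ℕ.m≤m*n r s) (ℕ.m≤m*n r s)
  s²≤ : s ℕ.* s ℕ.≤ r ℕ.* s ℕ.* (r ℕ.* s)
  s²≤ = ℕ.*-mono-≤ (ℕ.m≤n*m s r) (ℕ.m≤n*m s r)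
  lemma : ∀ t → 2 ℕ.* t ℕ.* (2 ℕ.* t) ≡ t ℕ.* t ℕ.+ t ℕ.* t ℕ.+ 2 ℕ.* (t ℕ.* t)
  lemma = ℕSolver.solve-∀
  t = r ℕ.* s
  strict : r ℕ.* r ℕ.+ s ℕ.* s ℕ.< b ℕ.* b
  strict = ℕ.<-≤-trans (ℕ.≤-<-trans (ℕ.+-mono-≤ r²≤ s²≤)
      (ℕ.m<m+n (t ℕ.* t ℕ.+ t ℕ.* t) (ℕ.>-nonZero⁻¹ (2 ℕ.* (t ℕ.* t)) {{ℕ.m*n≢0 2 (t ℕ.* t)}})))
    (ℕ.≤-trans (ℕ.≤-reflexive (sym (lemma t))) (ℕ.*-mono-≤ large large))
  go : Dec (n₁ ℕ.< b) → Dec (n₂ ℕ.< b) → n₁ ℕ.< b ⊎ n₂ ℕ.< b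
  go (yes n₁<b) _ = inj₁ n₁<b
  go _ (yes n₂<b) = inj₂ n₂<b
  go (no n₁≮b) (no n₂≮b) = ⊥-elim (ℕ.<⇒≱ strict (ℕ.≤-trans (ℕ.*-mono-≤ (ℕ.≮⇒≥ n₁≮b) (ℕ.≮⇒≥ n₂≮b)) small))

-- The induction step on the numerator of x

module Descent {P : 𝕁} (ih : ∀ {R} → ℤ.∣ ↥ ξ R ∣ ℕ.< ℤ.∣ ↥ ξ P ∣ → Even R)
  (H : Halving (↧ₙ (ξ P)) ℤ.∣ ↥ ξ P ∣) (b≢0 : ℤ.∣ ↥ ξ P ∣ ≢ 0) where

  open Halving H

  a = ↧ₙ (ξ P)
  b = ℤ.∣ ↥ ξ P ∣

  g≢0 : g ≢ 0
  g≢0 g≡0 = b≢0 (trans b≡ (cong (λ g → 2 ℕ.* (g ℕ.* f)) g≡0))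

  f≢0 : f ≢ 0
  f≢0 f≡0 = b≢0 (trans b≡ (trans (cong (λ f → 2 ℕ.* (g ℕ.* f)) f≡0) (lemma g)))
    where
    lemma : ∀ g → 2 ℕ.* (g ℕ.* 0) ≡ 0
    lemma = ℕSolver.solve-∀

  2f≤b : 2 ℕ.* f ℕ.≤ b
  2f≤b = subst (2 ℕ.* f ℕ.≤_) (sym b≡) (ℕ.*-monoʳ-≤ 2 (ℕ.m≤n*m f g {{ℕ.≢-nonZero g≢0}}))

  module _ {κ μ : ℕ} (S : Splitting κ μ a g f) where
    open Splitting S

    δ : ℚ
    δ = # κ * (# r * # r * (# r * # r)) - # μ * (# s * # s * (# s * # s))

    δ²≡ : δ * δ ≡ # a * # a
    δ²≡ = splitting-diff S

    δ≢0 : δ ≢ 0ℚ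
    δ≢0 eq = square-≢0 (#-≢0 {a} (λ ())) (trans (sym δ²≡) (cong₂ _*_ eq eq))

    r≢0 : r ≢ 0
    r≢0 r≡0 = f≢0 (trans f≡ (cong (ℕ._* s) r≡0))

    s≢0 : s ≢ 0
    s≢0 s≡0 = f≢0 (trans f≡ (trans (cong (r ℕ.*_) s≡0) (ℕ.*-zeroʳ r)))

    #b≡ : # b ≡ # 2 * (# g * (# r * # s))
    #b≡ = trans (cong #_ b≡) (ν 2 ⊠ (ν g ⊠ trans (cong #_ f≡) (ν r ⊠ ν s)))

    ξP²δ²≡ : ξ P * ξ P * (δ * δ) ≡ # 2 * (# g * (# r * # s)) * (# 2 * (# g * (# r * # s)))
    ξP²δ²≡ = begin
      ξ P * ξ P * (δ * δ)                  ≡⟨ cong (λ z → ξ P * ξ P * z) δ²≡ ⟩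
      ξ P * ξ P * (# a * # a)              ≡⟨ lemma (ξ P) (# a) ⟩
      ξ P * # a * (ξ P * # a)              ≡⟨ cong₂ _*_ (*-↧ (ξ P)) (*-↧ (ξ P)) ⟩
      fromℤ (↥ ξ P) * fromℤ (↥ ξ P)        ≡⟨ ∣∙∣-square (↥ ξ P) ⟨
      # b * # b                            ≡⟨ cong₂ _*_ #b≡ #b≡ ⟩
      # 2 * (# g * (# r * # s)) * (# 2 * (# g * (# r * # s))) ∎
      where
      open ≡-Reasoning
      lemma : ∀ x a → x * x * (a * a) ≡ x * a * (x * a)
      lemma = solve-∀ ringℚ

    s≤f : s ℕ.≤ f
    s≤f = subst (s ℕ.≤_) (sym f≡) (ℕ.m≤n*m s r {{ℕ.≢-nonZero r≢0}})

  f<b : f ℕ.< b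
  f<b = ℕ.<-≤-trans (ℕ.m<m+n f (ℕ.>-nonZero⁻¹ (f ℕ.+ 0) {{ℕ.≢-nonZero (λ e → f≢0 (trans (sym (ℕ.+-identityʳ f)) e))}})) 2f≤b

  case₁ : Splitting 1 10 a g f → Even P
  case₁ S = go (class₁ (# r) (# s) (# g) (#-≢0 (r≢0 S)) (splitting-sum S))
    where
    open Splitting S
    go : Reduction (# 2 * (# g * (# r * # s))) (δ S) (# r) (# s) → Even P
    go (R , ξR , step) = step (ih {R} (ℕ.≤-<-trans (numerator-≤ (ξ R) r s (s≢0 S) ξR) (ℕ.≤-<-trans (s≤f S) f<b))) P (ξP²δ²≡ S)

  module Case₂ (S : Splitting 2 5 a g f) where
    open Splitting S

    -- For r = s the equation becomes g² = r⁴, and δ = - 3 r⁴, so x(P)² = (2 / 3)². This case is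
    -- separate because the denominator g - r s of the general step vanishes in it.
    equal : r ≡ s → Even P
    equal r≡s = even-ξ² {P₀} {P} (sym (*-cancelʳ _ _ (δ S * δ S) (square-≢0 (δ≢0 S)) (begin
      ξ P * ξ P * (δ S * δ S)                                  ≡⟨ ξP²δ²≡ S ⟩
      # 2 * (# g * (# r * # s)) * (# 2 * (# g * (# r * # s)))  ≡⟨ modulo (splitting-sum S) _ (subst (λ s →
          # 2 * (# g * (# r * # s)) * (# 2 * (# g * (# r * # s))) ≡
          (# 2 ÷ # 3) * (# 2 ÷ # 3) * ((# 2 * (# r * # r * (# r * # r)) - # 5 * (# s * # s * (# s * # s))) *
            (# 2 * (# r * # r * (# r * # r)) - # 5 * (# s * # s * (# s * # s))))
          + (# g * # g + # 6 * (# r * # s * (# r * # s)) - (# 2 * (# r * # r * (# r * # r)) + # 5 * (# s * # s * (# s * # s))))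
            * (# 4 * (# r * # r * (# r * # r)))) r≡s (lemma (# g) (# r))) ⟩
      ξ P₀ * ξ P₀ * (δ S * δ S)                                ∎))) even-P₀
      where
      open ≡-Reasoning
      lemma : ∀ g r → # 2 * (g * (r * r)) * (# 2 * (g * (r * r))) ≡
        (# 2 ÷ # 3) * (# 2 ÷ # 3) * ((# 2 * (r * r * (r * r)) - # 5 * (r * r * (r * r))) *
          (# 2 * (r * r * (r * r)) - # 5 * (r * r * (r * r))))
        + (g * g + # 6 * (r * r * (r * r)) - (# 2 * (r * r * (r * r)) + # 5 * (r * r * (r * r))))
          * (# 4 * (r * r * (r * r)))
      lemma = solve-∀ ringℚ

    module Unequal (r≢s : r ≢ s) where
      A₁ A₂ B K : ℤ
      A₁ = + g ℤ.- + (r ℕ.* s)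
      A₂ = + (g ℕ.+ r ℕ.* s)
      B  = + (r ℕ.* r) ℤ.- + (s ℕ.* s)
      K  = + (2 ℕ.* (r ℕ.* r)) ℤ.- + (5 ℕ.* (s ℕ.* s))

      A₁≡ : fromℤ A₁ ≡ # g - # r * # s
      A₁≡ = trans (fromℤ-difference g (r ℕ.* s)) (cong (λ z → # g - z) (#-* r s))

      A₂≡ : fromℤ A₂ ≡ # g + # r * # s
      A₂≡ = ν g ⊞ ν r ⊠ ν s

      B≡ : fromℤ B ≡ # r * # r - # s * # s
      B≡ = trans (fromℤ-difference (r ℕ.* r) (s ℕ.* s)) (cong₂ _-_ (#-* r r) (#-* s s))

      K≡ : fromℤ K ≡ # 2 * (# r * # r) - # 5 * (# s * # s)
      K≡ = trans (fromℤ-difference (2 ℕ.* (r ℕ.* r)) (5 ℕ.* (s ℕ.* s)))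
        (cong₂ _-_ (ν 2 ⊠ (ν r ⊠ ν r)) (ν 5 ⊠ (ν s ⊠ ν s)))

      -- The equation of the covering in factored form. It is the relation A₁ A₂ = K B that
      -- `numerators-∣` needs for the two abscissae (r² - s²) / (g ∓ r s), and as its right-hand
      -- side is nonzero for r ≠ s, neither denominator vanishes.
      product : (# g - # r * # s) * (# g + # r * # s) ≡ (# 2 * (# r * # r) - # 5 * (# s * # s)) * (# r * # r - # s * # s)
      product = modulo (splitting-sum S) _ (lemma (# g) (# r) (# s))
        where
        lemma : ∀ g r s → (g - r * s) * (g + r * s) ≡ (# 2 * (r * r) - # 5 * (s * s)) * (r * r - s * s)
          + (g * g + # 6 * (r * s * (r * s)) - (# 2 * (r * r * (r * r)) + # 5 * (s * s * (s * s)))) * 1ℚ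
        lemma = solve-∀ ringℚ

      A₁A₂≡KB : A₁ ℤ.* A₂ ≡ K ℤ.* B
      A₁A₂≡KB = fromℤ-injective (trans (fromℤ-* A₁ A₂) (trans (cong₂ _*_ A₁≡ A₂≡)
        (trans product (trans (sym (cong₂ _*_ K≡ B≡)) (sym (fromℤ-* K B))))))

      r²-s²≢0 : # r * # r - # s * # s ≢ 0ℚ
      r²-s²≢0 eq = r≢s (square-injective r s (#-injective
        (trans (#-* r r) (trans (minus≡0 (# r * # r) (# s * # s) eq) (sym (#-* s s))))))

      product≢0 : (# g - # r * # s) * (# g + # r * # s) ≢ 0ℚ
      product≢0 eq = *-≢0 (2r²≢5s² (# r) (# s) (#-≢0 (s≢0 S))) r²-s²≢0 (trans (sym product) eq)

      α₁≢0 : # g - # r * # s ≢ 0ℚ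
      α₁≢0 eq = product≢0 (trans (cong (_* (# g + # r * # s)) eq) (ℚ.*-zeroˡ (# g + # r * # s)))

      α₂≢0 : # g + # r * # s ≢ 0ℚ
      α₂≢0 eq = product≢0 (trans (cong (λ z → (# g - # r * # s) * z) eq) (ℚ.*-zeroʳ (# g - # r * # s)))

      ∣B∣≤ : ℤ.∣ B ∣ ℕ.≤ r ℕ.* r ℕ.+ s ℕ.* s
      ∣B∣≤ = subst (λ z → ℤ.∣ B ∣ ℕ.≤ r ℕ.* r ℕ.+ z) (ℤ.∣-i∣≡∣i∣ (+ (s ℕ.* s)))
        (ℤ.∣i+j∣≤∣i∣+∣j∣ (+ (r ℕ.* r)) (ℤ.- + (s ℕ.* s)))

      B≢0 : B ≢ ℤ.0ℤ
      B≢0 eq = r²-s²≢0 (trans (sym B≡) (cong fromℤ eq))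

      Conclusion : ℚ → Set
      Conclusion α = ∃ λ R → ξ R * α ≡ # r * # r - # s * # s × (Even R → Even P)

      conclusion₁ : Conclusion (# g - # r * # s)
      conclusion₁ = go (class₂ (# r) (# s) (# g) (δ≢0 S) α₁≢0 (splitting-sum S))
        where
        go : Reduction (# 2 * (# g * (# r * # s))) (δ S) (# g - # r * # s) (# r * # r - # s * # s) → Conclusion (# g - # r * # s)
        go (R , ξR , step) = R , ξR , λ ev → step ev P (ξP²δ²≡ S)

      -- Replacing s by - s preserves the equation, δ and the square of n, and turns g - r s into g
      -- + r s.
      conclusion₂ : Conclusion (# g + # r * # s)
      conclusion₂ = go (class₂ (# r) (- # s) (# g)
          (λ eq → δ≢0 S (trans (lemma₁ (# r) (# s)) eq)) (λ eq → α₂≢0 (trans (lemma₂ (# g) (# r) (# s)) eq))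
          (trans (cong (λ z → # g * # g + # 6 * z) (lemma₃ (# r) (# s))) (trans (splitting-sum S) (lemma₄ (# r) (# s)))))
        where
        lemma₁ : ∀ r s → # 2 * (r * r * (r * r)) - # 5 * (s * s * (s * s)) ≡ # 2 * (r * r * (r * r)) - # 5 * (- s * - s * (- s * - s))
        lemma₁ = solve-∀ ringℚ
        lemma₂ : ∀ g r s → g + r * s ≡ g - r * - s
        lemma₂ = solve-∀ ringℚ
        lemma₃ : ∀ r s → r * - s * (r * - s) ≡ r * s * (r * s)
        lemma₃ = solve-∀ ringℚ
        lemma₄ : ∀ r s → # 2 * (r * r * (r * r)) + # 5 * (s * s * (s * s)) ≡ # 2 * (r * r * (r * r)) + # 5 * (- s * - s * (- s * - s))
        lemma₄ = solve-∀ ringℚ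
        lemma₅ : ∀ s → - s * - s ≡ s * s
        lemma₅ = solve-∀ ringℚ
        lemma₆ : ∀ g r s → # 2 * (g * (r * s)) * (# 2 * (g * (r * s))) ≡ # 2 * (g * (r * - s)) * (# 2 * (g * (r * - s)))
        lemma₆ = solve-∀ ringℚ
        δ′ = # 2 * (# r * # r * (# r * # r)) - # 5 * (- # s * - # s * (- # s * - # s))
        go : Reduction (# 2 * (# g * (# r * - # s))) δ′ (# g - # r * - # s) (# r * # r - - # s * - # s) → Conclusion (# g + # r * # s)
        go (R , ξR , step) = R ,
          trans (cong (ξ R *_) (lemma₂ (# g) (# r) (# s))) (trans ξR (cong (λ z → # r * # r - z) (lemma₅ (# s)))) ,
          λ ev → step ev P (trans (cong (λ d → ξ P * ξ P * (d * d)) (sym (lemma₁ (# r) (# s))))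
            (trans (ξP²δ²≡ S) (lemma₆ (# g) (# r) (# s))))

      R₁ = proj₁ conclusion₁
      R₂ = proj₁ conclusion₂

      numerators≤ : ℤ.∣ ↥ ξ R₁ ∣ ℕ.* ℤ.∣ ↥ ξ R₂ ∣ ℕ.≤ r ℕ.* r ℕ.+ s ℕ.* s
      numerators≤ = ℕ.≤-trans (ℕ.∣⇒≤ {{ℕ.≢-nonZero (λ e → B≢0 (ℤ.∣i∣≡0⇒i≡0 e))}}
        (numerators-∣ (ξ R₁) (ξ R₂) A₁ A₂ B K B≢0
          (trans (cong (ξ R₁ *_) A₁≡) (trans (proj₁ (proj₂ conclusion₁)) (sym B≡)))
          (trans (cong (ξ R₂ *_) A₂≡) (trans (proj₁ (proj₂ conclusion₂)) (sym B≡))) A₁A₂≡KB)) ∣B∣≤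

      conclude : Even P
      conclude = [ (λ small → proj₂ (proj₂ conclusion₁) (ih {R₁} small)) , (λ small → proj₂ (proj₂ conclusion₂) (ih {R₂} small)) ]′
        (numerator-bound r s (r≢0 S) (s≢0 S) ℤ.∣ ↥ ξ R₁ ∣ ℤ.∣ ↥ ξ R₂ ∣ b numerators≤
          (subst (λ f → 2 ℕ.* f ℕ.≤ b) f≡ 2f≤b))

  case₂ : Splitting 2 5 a g f → Even P
  case₂ S = go (Splitting.r S ℕ.≟ Splitting.s S)
    where
    go : Dec (Splitting.r S ≡ Splitting.s S) → Even P
    go (yes r≡s) = Case₂.equal S r≡s
    go (no r≢s) = Case₂.Unequal.conclude S r≢s

  conclusion : Even P
  conclusion = [ case₁ , case₂ ]′ (halving-splits H)

ξ≡0 : ∀ P → ℤ.∣ ↥ ξ P ∣ ≡ 0 → ξ P ≡ 0ℚ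
ξ≡0 P eq = *-cancelʳ _ _ (fromℤ (↧ ξ P)) (↧≢0 (ξ P)) (trans (*-↧ (ξ P))
  (trans (cong fromℤ (ℤ.∣i∣≡0⇒i≡0 eq)) (sym (ℚ.*-zeroˡ (fromℤ (↧ ξ P))))))

descent : ∀ P → Acc ℕ._<_ ℤ.∣ ↥ ξ P ∣ → Even P
descent P (acc rs) = go (ℤ.∣ ↥ ξ P ∣ ℕ.≟ 0)
  where
  go : Dec (ℤ.∣ ↥ ξ P ∣ ≡ 0) → Even P
  go (yes b≡0) = even-ξ² {O} {P} (sym (cong (λ x → x * x) (ξ≡0 P b≡0))) even-O
  go (no b≢0) = Descent.conclusion {P} (λ {R} small → descent R (rs small))
    (halving (↧ₙ (ξ P)) ℤ.∣ ↥ ξ P ∣ (proj₁ (jacobi-ℕ P)) (∣∙∣-coprime (ξ P)) (proj₂ (jacobi-ℕ P))) b≢0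

all-even : ∀ P → Even P
all-even P = descent P (<-wellFounded ℤ.∣ ↥ ξ P ∣)

-- The rank

-1-nonsquare : ∀ p → p * p ≢ - 1ℚ
-1-nonsquare p eq = go (integral-root p -[1+ 0 ] eq)
  where
  no-root : ∀ n → n ℤ.* n ≢ -[1+ 0 ]
  no-root (+ n) e = positive (trans (ℤ.pos-* n n) e)
    where
    positive : ∀ {m} → + m ≢ -[1+ 0 ]
    positive ()
  no-root -[1+ n ] ()
  go : ¬ (∃ λ n → p ≡ fromℤ n)
  go (n , p≡) = no-root n (fromℤ-injective (trans (fromℤ-* n n) (trans (cong₂ _*_ (sym p≡) (sym p≡)) eq)))

-- 10 (1 - 6 x² + 10 x⁴) = (10 x² - 3)² + 1.
η≢0 : ∀ P → η P ≢ 0ℚ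
η≢0 P eq = -1-nonsquare (# 10 * (ξ P * ξ P) - # 3)
  (modulo (trans (sym (on P)) (cong (λ y → y * y) eq)) _ (lemma (ξ P)))
  where
  lemma : ∀ x → (# 10 * (x * x) - # 3) * (# 10 * (x * x) - # 3) ≡ - 1ℚ
    + (1ℚ - # 6 * (x * x) + # 10 * ((x * x) * (x * x)) - 0ℚ * 0ℚ) * # 10
  lemma = solve-∀ ringℚ

-- The numerator of x(2 R) is 2 x y, and y never vanishes.
double-ξ≡0 : ∀ R → ξ (R ∙ R) ≡ 0ℚ → ξ R ≡ 0ℚ
double-ξ≡0 R eq = [ (λ e → e) , (λ e → ⊥-elim (η≢0 R e)) ]′ (*-≡0-⊎ (*-≡0 {# 2} {ξ R * η R}
  (trans (lemma (ξ R) (η R)) (trans (sym (ξ-∙ R R)) (trans (cong (_* den (ξ R) (ξ R)) eq) (ℚ.*-zeroˡ (den (ξ R) (ξ R)))))) (λ ())))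
  where
  lemma : ∀ x y → # 2 * (x * y) ≡ x * y + x * y
  lemma = solve-∀ ringℚ

numerator-even′ : ∀ P → 2 ℕ.∣ ℤ.∣ ↥ ξ P ∣
numerator-even′ P = numerator-even (↧ₙ (ξ P)) ℤ.∣ ↥ ξ P ∣ (proj₁ (jacobi-ℕ P)) (proj₂ (jacobi-ℕ P))

-- x(2 R)² = 4 / 9 means 9 x² y² = (1 - 10 x⁴)². With x² = t / s and denominators cleared, every
-- term except s⁴ = a⁸ is even because t is; so a would be even, like the coprime numerator.
double-ξ²≢ξP₀² : ∀ R → ξ (R ∙ R) * ξ (R ∙ R) ≢ ξ P₀ * ξ P₀
double-ξ²≢ξP₀² R eq = coprime⇒¬∣ (∣∙∣-coprime (ξ R)) (λ ()) (numerator-even′ R)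
  (∣-square prime[2] a (∣-square prime[2] (a ℕ.* a) (∣-square prime[2] (a ⁴)
    (ℕ.∣m+n∣m⇒∣n {m = 100 ℕ.* (t ℕ.* t ℕ.* (t ℕ.* t)) ℕ.+ 54 ℕ.* (s ℕ.* s ℕ.* (t ℕ.* t))} (subst (2 ℕ.∣_) equation
      (ℕ.∣m⇒∣m*n (9 ℕ.* (s ℕ.* s ℕ.* s) ℕ.+ 90 ℕ.* (s ℕ.* (t ℕ.* t)) ℕ.+ 20 ℕ.* (s ℕ.* s ℕ.* t)) 2∣t))
      (ℕ.∣m∣n⇒∣m+n (ℕ.∣m⇒∣m*n (t ℕ.* t ℕ.* (t ℕ.* t)) (ℕ.divides 50 refl)) (ℕ.∣m⇒∣m*n (s ℕ.* s ℕ.* (t ℕ.* t)) (ℕ.divides 27 refl)))))))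
  where
  a = ↧ₙ (ξ R)
  b = ℤ.∣ ↥ ξ R ∣
  s = a ℕ.* a
  t = b ℕ.* b
  x₀ = ξ R
  2∣t : 2 ℕ.∣ t
  2∣t = ℕ.∣m⇒∣m*n b (numerator-even′ R)
  T₀ : # t ≡ x₀ * x₀ * # s
  T₀ = trans (#-* b b) (trans (∣∙∣-square (↥ ξ R)) (trans (sym (cong₂ _*_ (*-↧ x₀) (*-↧ x₀)))
    (trans (lemma₀ x₀ (# a)) (cong (λ z → x₀ * x₀ * z) (sym (#-* a a))))))
    where
    lemma₀ : ∀ x a → x * a * (x * a) ≡ x * x * (a * a)
    lemma₀ = solve-∀ ringℚ
  x-equation : # 9 * (x₀ * x₀ * jacobi x₀) ≡ den x₀ x₀ * den x₀ x₀
  x-equation = sym (begin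
    den x₀ x₀ * den x₀ x₀
      ≡⟨ modulo eq _ (lemma₁ (ξ (R ∙ R)) (den x₀ x₀)) ⟩
    (# 9 * (1/ # 4)) * (ξ (R ∙ R) * den x₀ x₀ * (ξ (R ∙ R) * den x₀ x₀))
      ≡⟨ cong (λ z → (# 9 * (1/ # 4)) * (z * z)) (ξ-∙ R R) ⟩
    (# 9 * (1/ # 4)) * ((x₀ * η R + x₀ * η R) * (x₀ * η R + x₀ * η R))
      ≡⟨ lemma₂ x₀ (η R) ⟩
    # 9 * (x₀ * x₀ * (η R * η R))
      ≡⟨ cong (λ z → # 9 * (x₀ * x₀ * z)) (on R) ⟩
    # 9 * (x₀ * x₀ * jacobi x₀) ∎)
    where
    open ≡-Reasoning
    lemma₁ : ∀ z d → d * d ≡ (# 9 * (1/ # 4)) * (z * d * (z * d))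
      + (z * z - (# 2 ÷ # 3) * (# 2 ÷ # 3)) * (- (# 9 * (1/ # 4)) * (d * d))
    lemma₁ = solve-∀ ringℚ
    lemma₂ : ∀ x y → (# 9 * (1/ # 4)) * ((x * y + x * y) * (x * y + x * y)) ≡ # 9 * (x * x * (y * y))
    lemma₂ = solve-∀ ringℚ
  lhs rhs : ℕ → ℕ → ℕ
  lhs s t = t ℕ.* (9 ℕ.* (s ℕ.* s ℕ.* s) ℕ.+ 90 ℕ.* (s ℕ.* (t ℕ.* t)) ℕ.+ 20 ℕ.* (s ℕ.* s ℕ.* t))
  rhs s t = 100 ℕ.* (t ℕ.* t ℕ.* (t ℕ.* t)) ℕ.+ 54 ℕ.* (s ℕ.* s ℕ.* (t ℕ.* t)) ℕ.+ s ℕ.* s ℕ.* (s ℕ.* s)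
  #-lhs : ∀ s t → # (lhs s t) ≡ # t * (# 9 * (# s * # s * # s) + # 90 * (# s * (# t * # t)) + # 20 * (# s * # s * # t))
  #-lhs s t = ν t ⊠ (ν 9 ⊠ (ν s ⊠ ν s ⊠ ν s) ⊞ ν 90 ⊠ (ν s ⊠ (ν t ⊠ ν t)) ⊞ ν 20 ⊠ (ν s ⊠ ν s ⊠ ν t))
  #-rhs : ∀ s t → # (rhs s t) ≡ # 100 * (# t * # t * (# t * # t)) + # 54 * (# s * # s * (# t * # t)) + # s * # s * (# s * # s)
  #-rhs s t = ν 100 ⊠ ν t ⊠⁴ ⊞ ν 54 ⊠ (ν s ⊠ ν s ⊠ (ν t ⊠ ν t)) ⊞ ν s ⊠⁴
  equation : lhs s t ≡ rhs s t
  equation = #-injective (begin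
    # (lhs s t)         ≡⟨ #-lhs s t ⟩
    # t * (# 9 * (# s * # s * # s) + # 90 * (# s * (# t * # t)) + # 20 * (# s * # s * # t))
      ≡⟨ modulo T₀ _ (modulo x-equation _ (lemma₃ x₀ (# s) (# t))) ⟩
    # 100 * (# t * # t * (# t * # t)) + # 54 * (# s * # s * (# t * # t)) + # s * # s * (# s * # s)
      ≡⟨ #-rhs s t ⟨
    # (rhs s t) ∎)
    where
    open ≡-Reasoning
    lemma₃ : ∀ x s t → let T = x * x * s in
      t * (# 9 * (s * s * s) + # 90 * (s * (t * t)) + # 20 * (s * s * t)) ≡
      # 100 * (t * t * (t * t)) + # 54 * (s * s * (t * t)) + s * s * (s * s)
      + (t - T) * (# 9 * (s * s * s) + # 90 * (s * (t * t + t * T + T * T)) - # 34 * (s * s * (t + T)) - # 100 * ((t + T) * (t * t + T * T)))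
      + (# 9 * (x * x * (1ℚ - # 6 * (x * x) + # 10 * ((x * x) * (x * x)))) - (1ℚ - # 10 * ((x * x) * (x * x))) * (1ℚ - # 10 * ((x * x) * (x * x)))) * (s * s * (s * s))
    lemma₃ = solve-∀ ringℚ

half : ∀ n → ∃ λ k → n ≡ k ℕ.+ k ⊎ n ≡ suc (k ℕ.+ k)
half zero = 0 , inj₁ refl
half (suc n) = go (half n)
  where
  go : (∃ λ k → n ≡ k ℕ.+ k ⊎ n ≡ suc (k ℕ.+ k)) → ∃ λ k → suc n ≡ k ℕ.+ k ⊎ suc n ≡ suc (k ℕ.+ k)
  go (k , inj₁ n≡) = k , inj₂ (cong suc n≡)
  go (k , inj₂ n≡) = suc k , inj₁ (cong suc (trans n≡ (sym (ℕ.+-suc k k))))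

-- If U = P₀ + 2 R had x = 0, then U would be `O` or `T`, and P₀ = U - 2 R would have the same x² as
-- 2 R.
odd-multiple : ∀ R → ξ (P₀ ∙ (R ∙ R)) ≢ 0ℚ
odd-multiple R eq = double-ξ²≢ξP₀² R (sym (begin
  ξ P₀ * ξ P₀                                ≡⟨ cong (λ S → ξ S * ξ S) (trans (sym (cancelʳ P₀ (R ∙ R))) (∙-comm U ((R ∙ R) ⁻¹))) ⟩
  ξ ((R ∙ R) ⁻¹ ∙ U) * ξ ((R ∙ R) ⁻¹ ∙ U)    ≡⟨ cong (λ z → z * z) (proj₁ (scale ((R ∙ R) ⁻¹) U eq)) ⟩
  - ξ (R ∙ R) * η U * (- ξ (R ∙ R) * η U)    ≡⟨ modulo η²≡1 _ (lemma (ξ (R ∙ R)) (η U)) ⟩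
  ξ (R ∙ R) * ξ (R ∙ R)                      ∎))
  where
  open ≡-Reasoning
  U = P₀ ∙ (R ∙ R)
  η²≡1 : η U * η U ≡ 1ℚ
  η²≡1 = trans (on U) (cong jacobi eq)
  lemma : ∀ x y → - x * y * (- x * y) ≡ x * x + (y * y - 1ℚ) * (x * x)
  lemma = solve-∀ ringℚ

-- Even n are halved, since x(2 Q) = 0 implies x(Q) = 0, and odd n are excluded by `odd-multiple`.
-- The claim x ≠ 0 is used instead of n P₀ ≠ `O` because 2 Q = `O` would only give Q = `O` or Q =
-- `T`.
multiple-ξ≢0 : ∀ n → Acc ℕ._<_ n → n ≢ 0 → ξ (n · P₀) ≢ 0ℚ
multiple-ξ≢0 n (acc rs) n≢0 eq = go (half n)
  where
  go : ¬ (∃ λ k → n ≡ k ℕ.+ k ⊎ n ≡ suc (k ℕ.+ k))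
  go (zero , inj₁ n≡) = n≢0 n≡
  go (k@(suc _) , inj₁ n≡) = multiple-ξ≢0 k (rs (subst (k ℕ.<_) (sym n≡) (ℕ.m<m+n k ℕ.z<s))) (λ ())
    (double-ξ≡0 (k · P₀) (trans (cong ξ (trans (sym (×-homo-+ P₀ k k)) (cong (_· P₀) (sym n≡)))) eq))
  go (k , inj₂ n≡) = odd-multiple (k · P₀) (trans (cong (λ S → ξ (P₀ ∙ S)) (sym (×-homo-+ P₀ k k)))
    (trans (cong (λ n → ξ (n · P₀)) (sym n≡)) eq))

P₀-torsion-free : ∀ n → n · P₀ ≡ O → n ≡ 0
P₀-torsion-free n eq = go (n ℕ.≟ 0)
  where
  go : Dec (n ≡ 0) → n ≡ 0
  go (yes n≡0) = n≡0
  go (no n≢0) = ⊥-elim (multiple-ξ≢0 n (<-wellFounded n) n≢0 (cong ξ eq))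

j-· : ∀ n P → j (n ·ᴱ P) ≡ n · j P
j-· zero P = refl
j-· (suc n) P = trans (j-⊕ P (n ·ᴱ P)) (cong (j P ∙_) (j-· n P))

signed : Sign → 𝕁 → 𝕁
signed Sign.+ A = A
signed Sign.- A = A ⁻¹

⁻¹-· : ∀ n A → (n · A) ⁻¹ ≡ n · (A ⁻¹)
⁻¹-· zero A = J-≡ refl refl
⁻¹-· (suc n) A = trans (sym (⁻¹-∙-comm A (n · A))) (cong (A ⁻¹ ∙_) (⁻¹-· n A))

j-◃ : ∀ s n P → j ((s ℤ.◃ n) ·ℤ P) ≡ n · signed s (j P)
j-◃ Sign.+ zero P = refl
j-◃ Sign.- zero P = refl
j-◃ Sign.+ (suc n) P = j-· (suc n) P
j-◃ Sign.- (suc n) P = trans (j-⊖ (suc n ·ᴱ P)) (trans (cong _⁻¹ (j-· (suc n) P)) (⁻¹-· (suc n) (j P)))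

signed-opposite : ∀ s A → signed (Sign.opposite s) A ≡ signed s A ⁻¹
signed-opposite Sign.+ A = refl
signed-opposite Sign.- A = sym (⁻¹-involutive A)

cancel-common : ∀ S l n → S ∙ l · P₀ ≡ (l ℕ.+ n) · P₀ → S ≡ n · P₀
cancel-common S l n eq = begin
  S                                       ≡⟨ cancelʳ S (l · P₀) ⟨
  S ∙ l · P₀ ∙ (l · P₀) ⁻¹                ≡⟨ cong (_∙ (l · P₀) ⁻¹) (trans eq (trans (×-homo-+ P₀ l n) (∙-comm (l · P₀) (n · P₀)))) ⟩
  n · P₀ ∙ l · P₀ ∙ (l · P₀) ⁻¹           ≡⟨ cancelʳ (n · P₀) (l · P₀) ⟩
  n · P₀                                  ∎
  where open ≡-Reasoning

-- The sign is chosen so that the multiple k - l from `Even` becomes a natural number.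
signed-double : ∀ A → ∃₂ λ s n → signed s A ∙ signed s A ≡ n · P₀
signed-double A = go (all-even A)
  where
  go : Even A → ∃₂ λ s n → signed s A ∙ signed s A ≡ n · P₀
  go ev@(even k l eq) = cases (∣difference∣ k l)
    where
    cases : (∃ λ n → k ≡ l ℕ.+ n) ⊎ (∃ λ n → l ≡ k ℕ.+ n) → ∃₂ λ s n → signed s A ∙ signed s A ≡ n · P₀
    cases (inj₁ (n , k≡)) = Sign.+ , n , cancel-common (A ∙ A) l n (trans eq (cong (_· P₀) k≡))
    cases (inj₂ (n , l≡)) = Sign.- , n , cancel-common (A ⁻¹ ∙ A ⁻¹) k n
      (trans (Even.equation (even-⁻¹ ev)) (cong (_· P₀) l≡))

common-multiple : ∀ A B m n → A ∙ A ≡ n · P₀ → B ∙ B ≡ m · P₀ → (m ℕ.+ m) · A ≡ (n ℕ.+ n) · B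
common-multiple A B m n A²≡ B²≡ = begin
  (m ℕ.+ m) · A          ≡⟨ ×-homo-+ A m m ⟩
  m · A ∙ m · A          ≡⟨ ×-distrib-+ A A m ⟨
  m · (A ∙ A)            ≡⟨ cong (m ·_) A²≡ ⟩
  m · (n · P₀)           ≡⟨ ×-assocˡ P₀ m n ⟩
  (m ℕ.* n) · P₀         ≡⟨ cong (_· P₀) (ℕ.*-comm m n) ⟩
  (n ℕ.* m) · P₀         ≡⟨ ×-assocˡ P₀ n m ⟨
  n · (m · P₀)           ≡⟨ cong (n ·_) B²≡ ⟨
  n · (B ∙ B)            ≡⟨ ×-distrib-+ B B n ⟩
  n · B ∙ n · B          ≡⟨ ×-homo-+ B n n ⟨
  (n ℕ.+ n) · B          ∎
  where open ≡-Reasoning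

-- Independence of one point and dependence of any two

generator : Point
generator = affine 1ℚ (# 3) refl

j-generator : j generator ≡ P₀
j-generator = J-≡ refl refl

independent : LinearlyIndependent {1} (λ _ → generator)
independent k relation zero = go (k zero) (trans (sym (∙-identityʳ (j (k zero ·ℤ generator))))
    (trans (sym (j-⊕ (k zero ·ℤ generator) ∞)) (cong j relation)))
  where
  go : ∀ k → j (k ·ℤ generator) ≡ O → k ≡ ℤ.0ℤ
  go (+ n) eq = cong +_ (P₀-torsion-free n (trans (cong (n ·_) (sym j-generator)) (trans (sym (j-· n generator)) eq)))
  go -[1+ n ] eq = ⊥-elim (contra (P₀-torsion-free (suc n) (begin
    suc n · P₀               ≡⟨ cong (suc n ·_) j-generator ⟨
    suc n · j generator             ≡⟨ j-· (suc n) generator ⟨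
    j (suc n ·ᴱ generator)          ≡⟨ ⁻¹-involutive (j (suc n ·ᴱ generator)) ⟨
    j (suc n ·ᴱ generator) ⁻¹ ⁻¹    ≡⟨ cong _⁻¹ (trans (sym (j-⊖ (suc n ·ᴱ generator))) eq) ⟩
    O ⁻¹                     ≡⟨ J-≡ refl refl ⟩
    O                        ∎)))
    where
    open ≡-Reasoning
    contra : suc n ≢ 0
    contra ()

-- From ± 2 A = n P₀ and ± 2 B = m P₀ follows 2 m (± A) = 2 n (± B). Both coefficients vanish only
-- if m = n = 0, and then 2 A = `O` is itself a relation.
dependent : ∀ (g : Vector Point 2) → LinearlyDependent g
dependent g = go (signed-double A) (signed-double B)
  where
  open ≡-Reasoning
  A = j (g zero)
  B = j (g (suc zero))
  coefficients : ℤ → ℤ → Vector ℤ 2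
  coefficients c d zero = c
  coefficients c d (suc zero) = d
  j-relation : ∀ c d → j (c ·ℤ g zero) ∙ j (d ·ℤ g (suc zero)) ≡ O → c ·ℤ g zero ⊕ (d ·ℤ g (suc zero) ⊕ ∞) ≡ ∞
  j-relation c d eq = j-kernel _ (trans (j-⊕ (c ·ℤ g zero) (d ·ℤ g (suc zero) ⊕ ∞))
    (trans (cong (j (c ·ℤ g zero) ∙_) (trans (j-⊕ (d ·ℤ g (suc zero)) ∞) (∙-identityʳ (j (d ·ℤ g (suc zero)))))) eq))
  ◃≢0 : ∀ s n → n ≢ 0 → s ℤ.◃ (n ℕ.+ n) ≢ ℤ.0ℤ
  ◃≢0 s zero n≢0 _ = n≢0 refl
  ◃≢0 Sign.+ (suc n) _ ()
  ◃≢0 Sign.- (suc n) _ ()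
  go : (∃₂ λ s n → signed s A ∙ signed s A ≡ n · P₀) → (∃₂ λ s n → signed s B ∙ signed s B ≡ n · P₀) → LinearlyDependent g
  go (s , n , A²≡) (s′ , m , B²≡) = decide (m ℕ.≟ 0) (n ℕ.≟ 0)
    where
    c = s ℤ.◃ (m ℕ.+ m)
    d = Sign.opposite s′ ℤ.◃ (n ℕ.+ n)
    relation : j (c ·ℤ g zero) ∙ j (d ·ℤ g (suc zero)) ≡ O
    relation = begin
      j (c ·ℤ g zero) ∙ j (d ·ℤ g (suc zero))
        ≡⟨ cong₂ _∙_ (j-◃ s (m ℕ.+ m) (g zero)) (j-◃ (Sign.opposite s′) (n ℕ.+ n) (g (suc zero))) ⟩
      (m ℕ.+ m) · signed s A ∙ (n ℕ.+ n) · signed (Sign.opposite s′) B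
        ≡⟨ cong₂ _∙_ (common-multiple (signed s A) (signed s′ B) m n A²≡ B²≡)
             (trans (cong ((n ℕ.+ n) ·_) (signed-opposite s′ B)) (sym (⁻¹-· (n ℕ.+ n) (signed s′ B)))) ⟩
      (n ℕ.+ n) · signed s′ B ∙ ((n ℕ.+ n) · signed s′ B) ⁻¹
        ≡⟨ ∙-inverseʳ ((n ℕ.+ n) · signed s′ B) ⟩
      O ∎
    trivial : n ≡ 0 → j ((s ℤ.◃ 2) ·ℤ g zero) ∙ j (ℤ.0ℤ ·ℤ g (suc zero)) ≡ O
    trivial n≡0 = begin
      j ((s ℤ.◃ 2) ·ℤ g zero) ∙ O                    ≡⟨ ∙-identityʳ (j ((s ℤ.◃ 2) ·ℤ g zero)) ⟩
      j ((s ℤ.◃ 2) ·ℤ g zero)                        ≡⟨ j-◃ s 2 (g zero) ⟩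
      signed s A ∙ (signed s A ∙ O)                  ≡⟨ cong (signed s A ∙_) (∙-identityʳ (signed s A)) ⟩
      signed s A ∙ signed s A                        ≡⟨ trans A²≡ (cong (_· P₀) n≡0) ⟩
      O                                              ∎
    2≢0 : ∀ s → s ℤ.◃ 2 ≢ ℤ.0ℤ
    2≢0 Sign.+ ()
    2≢0 Sign.- ()
    decide : Dec (m ≡ 0) → Dec (n ≡ 0) → LinearlyDependent g
    decide (no m≢0) _ = coefficients c d , j-relation c d relation , zero , ◃≢0 s m m≢0
    decide _ (no n≢0) = coefficients c d , j-relation c d relation , suc zero , ◃≢0 (Sign.opposite s′) n n≢0
    decide (yes _) (yes n≡0) = coefficients (s ℤ.◃ 2) ℤ.0ℤ ,
      j-relation (s ℤ.◃ 2) ℤ.0ℤ (trivial n≡0) , zero , 2≢0 s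

rank-one : HasMordellWeilRank E₃₃ 1
rank-one = ((λ _ → generator) , independent) , dependent

-- Polynomials over ℚ

≈-sym : ∀ {p q} → p ≈ₚ q → q ≈ₚ p
≈-sym h = mk≈ λ n → sym (coeff-≡ h n)

≈-trans : ∀ {p q r} → p ≈ₚ q → q ≈ₚ r → p ≈ₚ r
≈-trans h k = mk≈ λ n → trans (coeff-≡ h n) (coeff-≡ k n)

coeff-+ : ∀ p q n → coeff (p +ₚ q) n ≡ coeff p n + coeff q n
coeff-+ []      q       n       = sym (ℚ.+-identityˡ (coeff q n))
coeff-+ (a ∷ p) []      n       = sym (ℚ.+-identityʳ (coeff (a ∷ p) n))
coeff-+ (a ∷ p) (b ∷ q) zero    = refl
coeff-+ (a ∷ p) (b ∷ q) (suc n) = coeff-+ p q n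

coeff-map : ∀ a p n → coeff (map (a *_) p) n ≡ a * coeff p n
coeff-map a []      n       = sym (ℚ.*-zeroʳ a)
coeff-map a (b ∷ p) zero    = refl
coeff-map a (b ∷ p) (suc n) = coeff-map a p n

coeff-∷-* : ∀ a p q n → coeff ((a ∷ p) *ₚ q) n ≡ a * coeff q n + coeff (0ℚ ∷ p *ₚ q) n
coeff-∷-* a p q n = trans (coeff-+ (map (a *_) q) (0ℚ ∷ p *ₚ q) n) (cong (_+ coeff (0ℚ ∷ p *ₚ q) n) (coeff-map a q n))

coeff-C-* : ∀ a p n → coeff (C a *ₚ p) n ≡ a * coeff p n
coeff-C-* a p n = trans (coeff-∷-* a [] p n) (trans (cong (λ c → a * coeff p n + c) (zeros n)) (ℚ.+-identityʳ (a * coeff p n)))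
  where
  zeros : ∀ n → coeff (0ℚ ∷ []) n ≡ 0ℚ
  zeros zero = refl
  zeros (suc n) = refl

IsZero : Poly → Set
IsZero p = ∀ n → coeff p n ≡ 0ℚ

zero-*ˡ : ∀ p q → IsZero p → IsZero (p *ₚ q)
zero-*ˡ []      q h n = refl
zero-*ˡ (a ∷ p) q h n = trans (coeff-∷-* a p q n) (trans (cong₂ (λ a c → a * coeff q n + c) (h 0) (tail n))
    (trans (cong (_+ 0ℚ) (ℚ.*-zeroˡ (coeff q n))) refl))
  where
  tail : ∀ n → coeff (0ℚ ∷ p *ₚ q) n ≡ 0ℚ
  tail zero    = refl
  tail (suc n) = zero-*ˡ p q (λ m → h (suc m)) n

zero-*ʳ : ∀ p q → IsZero q → IsZero (p *ₚ q)
zero-*ʳ []      q h n = refl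
zero-*ʳ (a ∷ p) q h n = trans (coeff-∷-* a p q n) (trans (cong₂ (λ b c → a * b + c) (h n) (tail n))
    (trans (cong (_+ 0ℚ) (ℚ.*-zeroʳ a)) refl))
  where
  tail : ∀ n → coeff (0ℚ ∷ p *ₚ q) n ≡ 0ℚ
  tail zero    = refl
  tail (suc n) = zero-*ʳ p q h n

*-congʳ : ∀ p {q r} → q ≈ₚ r → p *ₚ q ≈ₚ p *ₚ r
*-congʳ p {q} {r} h = mk≈ (go p)
  where
  go : ∀ p n → coeff (p *ₚ q) n ≡ coeff (p *ₚ r) n
  go []      n = refl
  go (a ∷ p) n = trans (coeff-∷-* a p q n) (trans (cong₂ (λ b c → a * b + c) (coeff-≡ h n) (tail n)) (sym (coeff-∷-* a p r n)))
    where
    tail : ∀ n → coeff (0ℚ ∷ p *ₚ q) n ≡ coeff (0ℚ ∷ p *ₚ r) n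
    tail zero    = refl
    tail (suc n) = go p n

*-congˡ : ∀ {p q} r → p ≈ₚ q → p *ₚ r ≈ₚ q *ₚ r
*-congˡ {p} {q} r h = mk≈ (go p q (coeff-≡ h))
  where
  go : ∀ p q → (∀ n → coeff p n ≡ coeff q n) → ∀ n → coeff (p *ₚ r) n ≡ coeff (q *ₚ r) n
  go []      q       h n = sym (zero-*ˡ q r (λ m → sym (h m)) n)
  go (a ∷ p) []      h n = zero-*ˡ (a ∷ p) r h n
  go (a ∷ p) (b ∷ q) h n = trans (coeff-∷-* a p r n)
      (trans (cong₂ (λ a c → a * coeff r n + c) (h 0) (tail n)) (sym (coeff-∷-* b q r n)))
    where
    tail : ∀ n → coeff (0ℚ ∷ p *ₚ r) n ≡ coeff (0ℚ ∷ q *ₚ r) n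
    tail zero    = refl
    tail (suc n) = go p q (λ m → h (suc m)) n

-- Evaluation of polynomials

eval : Poly → ℚ → ℚ
eval []      z = 0ℚ
eval (a ∷ p) z = a + z * eval p z

eval-zero : ∀ p z → IsZero p → eval p z ≡ 0ℚ
eval-zero []      z h = refl
eval-zero (a ∷ p) z h = trans (cong₂ (λ a e → a + z * e) (h 0) (eval-zero p z (λ n → h (suc n))))
  (trans (ℚ.+-identityˡ (z * 0ℚ)) (ℚ.*-zeroʳ z))

eval-cong : ∀ {p q} → p ≈ₚ q → ∀ z → eval p z ≡ eval q z
eval-cong {p} {q} h z = go p q (coeff-≡ h)
  where
  go : ∀ p q → (∀ n → coeff p n ≡ coeff q n) → eval p z ≡ eval q z
  go []      q       h = sym (eval-zero q z (λ n → sym (h n)))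
  go (a ∷ p) []      h = eval-zero (a ∷ p) z h
  go (a ∷ p) (b ∷ q) h = cong₂ (λ a e → a + z * e) (h 0) (go p q (λ n → h (suc n)))

eval-+ : ∀ p q z → eval (p +ₚ q) z ≡ eval p z + eval q z
eval-+ []      q       z = sym (ℚ.+-identityˡ (eval q z))
eval-+ (a ∷ p) []      z = sym (ℚ.+-identityʳ (eval (a ∷ p) z))
eval-+ (a ∷ p) (b ∷ q) z = trans (cong (λ e → a + b + z * e) (eval-+ p q z)) (lemma a b z (eval p z) (eval q z))
  where
  lemma : ∀ a b z p q → a + b + z * (p + q) ≡ a + z * p + (b + z * q)
  lemma = solve-∀ ringℚ

eval-map : ∀ a p z → eval (map (a *_) p) z ≡ a * eval p z
eval-map a []      z = sym (ℚ.*-zeroʳ a)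
eval-map a (b ∷ p) z = trans (cong (λ e → a * b + z * e) (eval-map a p z)) (lemma a b z (eval p z))
  where
  lemma : ∀ a b z p → a * b + z * (a * p) ≡ a * (b + z * p)
  lemma = solve-∀ ringℚ

eval-* : ∀ p q z → eval (p *ₚ q) z ≡ eval p z * eval q z
eval-* []      q z = sym (ℚ.*-zeroˡ (eval q z))
eval-* (a ∷ p) q z = trans (eval-+ (map (a *_) q) (0ℚ ∷ p *ₚ q) z)
  (trans (cong₂ (λ d e → d + (0ℚ + z * e)) (eval-map a q z) (eval-* p q z)) (lemma a z (eval p z) (eval q z)))
  where
  lemma : ∀ a z p q → a * q + (0ℚ + z * (p * q)) ≡ (a + z * p) * q
  lemma = solve-∀ ringℚ

-- Degrees, units and irreducible cubics

degree-tail : ∀ {a p n} → HasDegree (a ∷ p) (suc n) → HasDegree p n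
degree-tail (lead , high) = lead , λ m n<m → high (suc m) (ℕ.s≤s n<m)

degree-* : ∀ p q {m n} → HasDegree p m → HasDegree q n → HasDegree (p *ₚ q) (m ℕ.+ n)
degree-* [] q (lead , _) _ = ⊥-elim (lead refl)
degree-* (a ∷ p) q {zero} {n} (lead , high) (lead′ , high′) =
  (λ eq → *-≢0 lead lead′ (trans (sym (coefficient n)) eq)) ,
  λ m n<m → trans (coefficient m) (trans (cong (a *_) (high′ m n<m)) (ℚ.*-zeroʳ a))
  where
  tail : ∀ m → coeff (0ℚ ∷ p *ₚ q) m ≡ 0ℚ
  tail zero    = refl
  tail (suc m) = zero-*ˡ p q (λ k → high (suc k) ℕ.z<s) m
  coefficient : ∀ m → coeff ((a ∷ p) *ₚ q) m ≡ a * coeff q m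
  coefficient m = trans (coeff-∷-* a p q m) (trans (cong (λ c → a * coeff q m + c) (tail m)) (ℚ.+-identityʳ (a * coeff q m)))
degree-* (a ∷ p) q {suc m} {n} deg deg′@(_ , high′) =
  (λ eq → proj₁ rec (trans (sym (coefficient (m ℕ.+ n) (ℕ.m≤n+m n m))) eq)) , high-zero
  where
  rec = degree-* p q (degree-tail deg) deg′
  coefficient : ∀ k → n ℕ.≤ k → coeff ((a ∷ p) *ₚ q) (suc k) ≡ coeff (p *ₚ q) k
  coefficient k n≤k = trans (coeff-∷-* a p q (suc k))
    (trans (cong (λ c → a * c + coeff (p *ₚ q) k) (high′ (suc k) (ℕ.s≤s n≤k)))
      (trans (cong (_+ coeff (p *ₚ q) k) (ℚ.*-zeroʳ a)) (ℚ.+-identityˡ (coeff (p *ₚ q) k))))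
  high-zero : ∀ k → suc m ℕ.+ n ℕ.< k → coeff ((a ∷ p) *ₚ q) k ≡ 0ℚ
  high-zero (suc k) (ℕ.s≤s m+n<k) = trans (coefficient k (ℕ.≤-trans (ℕ.m≤n+m n m) (ℕ.<⇒≤ m+n<k))) (proj₂ rec k m+n<k)

degree-unique : ∀ p {m n} → HasDegree p m → HasDegree p n → m ≡ n
degree-unique p {m} {n} (lead , high) (lead′ , high′) with ℕ.<-cmp m n
... | Tri.tri< m<n _ _ = ⊥-elim (lead′ (high n m<n))
... | Tri.tri≈ _ m≡n _ = m≡n
... | Tri.tri> _ _ n<m = ⊥-elim (lead (high′ m n<m))

degree-cong : ∀ {p q n} → p ≈ₚ q → HasDegree p n → HasDegree q n
degree-cong h (lead , high) = (λ eq → lead (trans (coeff-≡ h _) eq)) , λ m n<m → trans (sym (coeff-≡ h m)) (high m n<m)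

zero-or-degree : ∀ p → IsZero p ⊎ ∃ (HasDegree p)
zero-or-degree [] = inj₁ λ _ → refl
zero-or-degree (a ∷ p) = [ (λ h → constant h (a ℚ.≟ 0ℚ)) , step ]′ (zero-or-degree p)
  where
  step : ∃ (HasDegree p) → IsZero (a ∷ p) ⊎ ∃ (HasDegree (a ∷ p))
  step (n , lead , high) = inj₂ (suc n , lead , λ { (suc m) (ℕ.s≤s n<m) → high m n<m })
  constant : IsZero p → Dec (a ≡ 0ℚ) → IsZero (a ∷ p) ⊎ ∃ (HasDegree (a ∷ p))
  constant h (yes a≡0) = inj₁ λ { zero → a≡0 ; (suc n) → h n }
  constant h (no a≢0)  = inj₂ (0 , a≢0 , λ { (suc m) _ → h m })

factor-degrees : ∀ {p n} → HasDegree p n → ∀ q r → p ≈ₚ q *ₚ r →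
  ∃₂ λ k l → HasDegree q k × HasDegree r l × k ℕ.+ l ≡ n
factor-degrees {p} {n} deg q r h = go (zero-or-degree q) (zero-or-degree r)
  where
  Goal = ∃₂ λ k l → HasDegree q k × HasDegree r l × k ℕ.+ l ≡ n
  go : IsZero q ⊎ ∃ (HasDegree q) → IsZero r ⊎ ∃ (HasDegree r) → Goal
  go (inj₁ z) _ = ⊥-elim (proj₁ deg (trans (coeff-≡ h n) (zero-*ˡ q r z n)))
  go (inj₂ _) (inj₁ z) = ⊥-elim (proj₁ deg (trans (coeff-≡ h n) (zero-*ʳ q r z n)))
  go (inj₂ (k , dq)) (inj₂ (l , dr)) = k , l , dq , dr , degree-unique (q *ₚ r) (degree-* q r dq dr) (degree-cong h deg)

degree-1 : HasDegree (C 1ℚ) 0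
degree-1 = (λ ()) , λ { (suc m) _ → refl }

unit⇒degree : ∀ {p} → p ∣ₚ C 1ℚ → HasDegree p 0
unit⇒degree {p} (q , h) = go (factor-degrees degree-1 q p (≈-sym h))
  where
  go : (∃₂ λ k l → HasDegree q k × HasDegree p l × k ℕ.+ l ≡ 0) → HasDegree p 0
  go (k , l , _ , dp , k+l≡0) = subst (HasDegree p) (ℕ.m+n≡0⇒n≡0 k k+l≡0) dp

degree⇒unit : ∀ {p} → HasDegree p 0 → p ∣ₚ C 1ℚ
degree⇒unit {p} (lead , high) = C c , mk≈ λ n → trans (coeff-C-* c p n) (go n)
  where
  c = 1ℚ /[ coeff p 0 , lead ]
  go : ∀ n → c * coeff p n ≡ coeff (C 1ℚ) n
  go zero    = ÷-cancel 1ℚ (coeff p 0) lead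
  go (suc n) = trans (cong (c *_) (high (suc n) ℕ.z<s)) (ℚ.*-zeroʳ c)

linear-root : ∀ p → HasDegree p 1 → ∃ λ z → eval p z ≡ 0ℚ
linear-root p (lead , high) = z , trans (eval-cong p≈ z) (trans (lemma p₀ p₁ z) (trans (cong (λ e → p₀ + e) (÷-cancel (- p₀) p₁ lead)) (ℚ.+-inverseʳ p₀)))
  where
  p₀ = coeff p 0
  p₁ = coeff p 1
  z = (- p₀) /[ p₁ , lead ]
  p≈ : p ≈ₚ p₀ ∷ p₁ ∷ []
  p≈ = mk≈ λ { zero → refl ; (suc zero) → refl ; (suc (suc n)) → high (suc (suc n)) (ℕ.s≤s ℕ.z<s) }
  lemma : ∀ a b z → a + z * (b + z * 0ℚ) ≡ a + z * b
  lemma = solve-∀ ringℚ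

root-of-factorˡ : ∀ {p} q r → p ≈ₚ q *ₚ r → ∀ z → eval q z ≡ 0ℚ → eval p z ≡ 0ℚ
root-of-factorˡ q r h z eq = trans (eval-cong h z) (trans (eval-* q r z) (trans (cong (_* eval r z) eq) (ℚ.*-zeroˡ (eval r z))))

root-of-factorʳ : ∀ {p} q r → p ≈ₚ q *ₚ r → ∀ z → eval r z ≡ 0ℚ → eval p z ≡ 0ℚ
root-of-factorʳ q r h z eq = trans (eval-cong h z) (trans (eval-* q r z) (trans (cong (eval q z *_) eq) (ℚ.*-zeroʳ (eval q z))))

NoRoot : Poly → Set
NoRoot p = ∀ z → eval p z ≢ 0ℚ

no-root⇒irreducible : ∀ {p} → HasDegree p 3 → NoRoot p → Irreducible p
no-root⇒irreducible {p} deg noroot = record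
  { p∤1 = λ p∣1 → 3≢0 (degree-unique p deg (unit⇒degree p∣1))
  ; split-∣1 = λ {q} {r} h → cases q r h (factor-degrees deg q r h)
  }
  where
  3≢0 : 3 ≢ 0
  3≢0 ()
  cases : ∀ q r → p ≈ₚ q *ₚ r → (∃₂ λ k l → HasDegree q k × HasDegree r l × k ℕ.+ l ≡ 3) → q ∣ₚ C 1ℚ ⊎ r ∣ₚ C 1ℚ
  cases q r h (0 , l , dq , dr , _) = inj₁ (degree⇒unit dq)
  cases q r h (1 , l , dq , dr , _) = ⊥-elim (noroot (proj₁ root) (root-of-factorˡ q r h (proj₁ root) (proj₂ root)))
    where root = linear-root q dq
  cases q r h (2 , .1 , dq , dr , refl) = ⊥-elim (noroot (proj₁ root) (root-of-factorʳ q r h (proj₁ root) (proj₂ root)))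
    where root = linear-root r dr
  cases q r h (3 , .0 , dq , dr , refl) = inj₂ (degree⇒unit dr)

cubic-coefficients : ∀ p → HasDegree p 3 → p ≈ₚ coeff p 0 ∷ coeff p 1 ∷ coeff p 2 ∷ coeff p 3 ∷ []
cubic-coefficients p (lead , high) = mk≈ λ where
  0 → refl
  1 → refl
  2 → refl
  3 → refl
  (suc (suc (suc (suc n)))) → high _ (ℕ.s≤s (ℕ.s≤s (ℕ.s≤s ℕ.z<s)))

irreducible⇒no-root : ∀ {p} → HasDegree p 3 → Irreducible p → NoRoot p
irreducible⇒no-root {p} deg irr z eq = [ linear-unit , quadratic-unit ]′ (SemiringDefs.Irreducible.split-∣1 irr p≈)
  where
  a = coeff p 0
  b = coeff p 1
  c = coeff p 2
  d = coeff p 3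
  linear cofactor : Poly
  linear = - z ∷ 1ℚ ∷ []
  -- The quotient by x - z from Horner's scheme; the remainder is the value at z.
  cofactor = b + z * (c + z * d) ∷ c + z * d ∷ d ∷ []
  constant : ∀ a b c d z → a ≡ - z * (b + z * (c + z * d)) + 0ℚ + (a + z * (b + z * (c + z * (d + z * 0ℚ))) - 0ℚ) * 1ℚ
  constant = solve-∀ ringℚ
  first : ∀ b e z → b ≡ - z * e + (1ℚ * (b + z * e) + 0ℚ)
  first = solve-∀ ringℚ
  third : ∀ d → d ≡ 1ℚ * d
  third = solve-∀ ringℚ
  p≈ : p ≈ₚ linear *ₚ cofactor
  p≈ = ≈-trans (cubic-coefficients p deg) (mk≈ λ where
    0 → modulo (trans (sym (eval-cong (cubic-coefficients p deg) z)) eq) _ (constant a b c d z)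
    1 → first b (c + z * d) z
    2 → second c d z
    3 → third d
    (suc (suc (suc (suc n)))) → refl)
    where
    second : ∀ c d z → c ≡ - z * d + 1ℚ * (c + z * d)
    second = solve-∀ ringℚ
  linear-unit : ¬ linear ∣ₚ C 1ℚ
  linear-unit h = contra (degree-unique linear ((λ ()) , λ { (suc (suc m)) _ → refl ; 1 (ℕ.s≤s ()) }) (unit⇒degree h))
    where
    contra : 1 ≢ 0
    contra ()
  quadratic-unit : ¬ cofactor ∣ₚ C 1ℚ
  quadratic-unit h = contra (degree-unique cofactor (proj₁ deg , λ { (suc (suc (suc m))) _ → refl ; 1 (ℕ.s≤s ()) ; 2 (ℕ.s≤s (ℕ.s≤s ())) }) (unit⇒degree h))
    where
    contra : 2 ≢ 0
    contra ()

-- The sextic quotient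

trinomial-coeff : ∀ p a q b n → coeff (p +ₚ C a *ₚ q +ₚ C b) n ≡ coeff p n + a * coeff q n + coeff (C b) n
trinomial-coeff p a q b n = trans (coeff-+ (p +ₚ C a *ₚ q) (C b) n)
  (cong (_+ coeff (C b) n) (trans (coeff-+ p (C a *ₚ q) n) (cong (λ c → coeff p n + c) (coeff-C-* a q n))))

term₀ : ∀ a b → 0ℚ + a * 0ℚ + b ≡ b
term₀ = solve-∀ ringℚ
term₁ : ∀ a → 0ℚ + a * 1ℚ + 0ℚ ≡ a
term₁ = solve-∀ ringℚ
term₂ : ∀ a → 1ℚ + a * 0ℚ + 0ℚ ≡ 1ℚ
term₂ = solve-∀ ringℚ
term₃ : ∀ a → - 1ℚ + a * 0ℚ + 0ℚ ≡ - 1ℚ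
term₃ = solve-∀ ringℚ

-- Coefficient lists without the zero products and trailing zeros that the defining expressions
-- produce; products are compared on these.
quadratic-list quartic-list quintic-list decic-list : Quadruple → Poly
quadratic-list (quad A B u v) = v ∷ u ∷ 1ℚ ∷ []
quartic-list (quad A B u v) = v ∷ 0ℚ ∷ u ∷ 0ℚ ∷ 1ℚ ∷ []
quintic-list (quad A B u v) = B ∷ A ∷ 0ℚ ∷ 0ℚ ∷ 0ℚ ∷ 1ℚ ∷ []
decic-list (quad A B u v) = B ∷ 0ℚ ∷ A ∷ 0ℚ ∷ 0ℚ ∷ 0ℚ ∷ 0ℚ ∷ 0ℚ ∷ 0ℚ ∷ 0ℚ ∷ 1ℚ ∷ []

quadratic≈ : ∀ t → quadratic t ≈ₚ quadratic-list t
quadratic≈ (quad A B u v) = mk≈ λ n → trans (trinomial-coeff (x ^ₚ 2) u x v n) (go n)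
  where
  go : ∀ n → coeff (x ^ₚ 2) n + u * coeff x n + coeff (C v) n ≡ coeff (v ∷ u ∷ 1ℚ ∷ []) n
  go 0 = term₀ u v
  go 1 = term₁ u
  go 2 = term₂ u
  go (suc (suc (suc n))) = trans (cong (λ c → c + u * 0ℚ + 0ℚ) (high n)) (term₀ u 0ℚ)
    where
    high : ∀ n → coeff (x ^ₚ 2) (suc (suc (suc n))) ≡ 0ℚ
    high 0 = refl
    high (suc n) = refl

quartic≈ : ∀ t → quartic t ≈ₚ quartic-list t
quartic≈ (quad A B u v) = mk≈ λ n → trans (trinomial-coeff (x ^ₚ 4) u (x ^ₚ 2) v n) (go n)
  where
  go : ∀ n → coeff (x ^ₚ 4) n + u * coeff (x ^ₚ 2) n + coeff (C v) n ≡ coeff (v ∷ 0ℚ ∷ u ∷ 0ℚ ∷ 1ℚ ∷ []) n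
  go 0 = term₀ u v
  go 1 = term₀ u 0ℚ
  go 2 = term₁ u
  go 3 = term₀ u 0ℚ
  go 4 = term₂ u
  go (suc (suc (suc (suc (suc n))))) = term₀ u 0ℚ

quintic≈ : ∀ t → quintic t ≈ₚ quintic-list t
quintic≈ (quad A B u v) = mk≈ λ n → trans (trinomial-coeff (x ^ₚ 5) A x B n) (go n)
  where
  go : ∀ n → coeff (x ^ₚ 5) n + A * coeff x n + coeff (C B) n ≡ coeff (B ∷ A ∷ 0ℚ ∷ 0ℚ ∷ 0ℚ ∷ 1ℚ ∷ []) n
  go 0 = term₀ A B
  go 1 = term₁ A
  go 2 = term₀ A 0ℚ
  go 3 = term₀ A 0ℚ
  go 4 = term₀ A 0ℚ
  go 5 = term₂ A
  go (suc (suc (suc (suc (suc (suc n)))))) = term₀ A 0ℚ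

decic≈ : ∀ t → decic t ≈ₚ decic-list t
decic≈ (quad A B u v) = mk≈ λ n → trans (trinomial-coeff (x ^ₚ 10) A (x ^ₚ 2) B n) (go n)
  where
  go : ∀ n → coeff (x ^ₚ 10) n + A * coeff (x ^ₚ 2) n + coeff (C B) n ≡ coeff (decic-list (quad A B u v)) n
  go 0 = term₀ A B
  go 1 = term₀ A 0ℚ
  go 2 = term₁ A
  go 3 = term₀ A 0ℚ
  go 4 = term₀ A 0ℚ
  go 5 = term₀ A 0ℚ
  go 6 = term₀ A 0ℚ
  go 7 = term₀ A 0ℚ
  go 8 = term₀ A 0ℚ
  go 9 = term₀ A 0ℚ
  go 10 = term₂ A
  go (suc (suc (suc (suc (suc (suc (suc (suc (suc (suc (suc n))))))))))) = term₀ A 0ℚ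

cubic : ℚ → ℚ → ℚ → Poly
cubic r s t = t ∷ s ∷ r ∷ 1ℚ ∷ []

cubic⁺≈ : ∀ X Y → cubic⁺ X Y ≈ₚ cubic 1ℚ (cubicS X) (cubicT X Y)
cubic⁺≈ X Y = mk≈ λ n → trans (trinomial-coeff (x ^ₚ 3 +ₚ x ^ₚ 2) s x t n) (go n)
  where
  s = cubicS X
  t = cubicT X Y
  go : ∀ n → coeff (x ^ₚ 3 +ₚ x ^ₚ 2) n + s * coeff x n + coeff (C t) n ≡ coeff (cubic 1ℚ s t) n
  go 0 = term₀ s t
  go 1 = term₁ s
  go 2 = term₂ s
  go 3 = term₂ s
  go (suc (suc (suc (suc n)))) = term₀ s 0ℚ

cubic⁻≈ : ∀ X Y → cubic⁻ X Y ≈ₚ cubic (- 1ℚ) (cubicS X) (- cubicT X Y)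
cubic⁻≈ X Y = mk≈ λ n → trans (trinomial-coeff (x ^ₚ 3 +ₚ C (- 1ℚ) *ₚ x ^ₚ 2) s x (- t) n) (go n)
  where
  s = cubicS X
  t = cubicT X Y
  go : ∀ n → coeff (x ^ₚ 3 +ₚ C (- 1ℚ) *ₚ x ^ₚ 2) n + s * coeff x n + coeff (C (- t)) n ≡ coeff (cubic (- 1ℚ) s (- t)) n
  go 0 = term₀ s (- t)
  go 1 = term₁ s
  go 2 = term₃ s
  go 3 = term₂ s
  go (suc (suc (suc (suc n)))) = term₀ s 0ℚ

cubic-degree : ∀ r s t → HasDegree (cubic r s t) 3
cubic-degree r s t = (λ ()) , λ where
  0 ()
  1 (ℕ.s≤s ())
  2 (ℕ.s≤s (ℕ.s≤s ()))
  3 (ℕ.s≤s (ℕ.s≤s (ℕ.s≤s ())))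
  (suc (suc (suc (suc m)))) _ → refl

sextic : ℚ → ℚ → Poly
sextic u v = # 2 * u * v - u * u * u ∷ 0ℚ ∷ u * u - v ∷ 0ℚ ∷ - u ∷ 0ℚ ∷ 1ℚ ∷ []

sextic-quartic : ∀ u v → sextic u v *ₚ quartic (withQuadratic u v) ≈ₚ decic (withQuadratic u v)
sextic-quartic u v = ≈-trans (*-congʳ (sextic u v) (quartic≈ (withQuadratic u v)))
  (≈-trans (mk≈ go) (≈-sym (decic≈ (withQuadratic u v))))
  where
  c₀ : ∀ u v → (# 2 * u * v - u * u * u) * v + (0ℚ) ≡ u * v * (# 2 * v - u * (u * 1ℚ))
  c₀ = solve-∀ ringℚ
  c₁ : ∀ u v → (# 2 * u * v - u * u * u) * 0ℚ + (0ℚ * v + (0ℚ)) ≡ 0ℚ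
  c₁ = solve-∀ ringℚ
  c₂ : ∀ u v → (# 2 * u * v - u * u * u) * u + (0ℚ * 0ℚ + ((u * u - v) * v + (0ℚ))) ≡ # 3 * (u * (u * 1ℚ)) * v - u * (u * (u * (u * 1ℚ))) - v * (v * 1ℚ)
  c₂ = solve-∀ ringℚ
  c₃ : ∀ u v → (# 2 * u * v - u * u * u) * 0ℚ + (0ℚ * u + ((u * u - v) * 0ℚ + (0ℚ * v + (0ℚ)))) ≡ 0ℚ
  c₃ = solve-∀ ringℚ
  c₄ : ∀ u v → (# 2 * u * v - u * u * u) * 1ℚ + (0ℚ * 0ℚ + ((u * u - v) * u + (0ℚ * 0ℚ + ((- u) * v + (0ℚ))))) ≡ 0ℚ
  c₄ = solve-∀ ringℚ
  c₅ : ∀ u v → 0ℚ * 1ℚ + ((u * u - v) * 0ℚ + (0ℚ * u + ((- u) * 0ℚ + (0ℚ * v + (0ℚ))))) ≡ 0ℚ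
  c₅ = solve-∀ ringℚ
  c₆ : ∀ u v → (u * u - v) * 1ℚ + (0ℚ * 0ℚ + ((- u) * u + (0ℚ * 0ℚ + (1ℚ * v + (0ℚ))))) ≡ 0ℚ
  c₆ = solve-∀ ringℚ
  c₇ : ∀ u v → 0ℚ * 1ℚ + ((- u) * 0ℚ + (0ℚ * u + (1ℚ * 0ℚ))) ≡ 0ℚ
  c₇ = solve-∀ ringℚ
  c₈ : ∀ u v → (- u) * 1ℚ + (0ℚ * 0ℚ + (1ℚ * u)) ≡ 0ℚ
  c₈ = solve-∀ ringℚ
  c₉ : ∀ u v → 0ℚ * 1ℚ + (1ℚ * 0ℚ) ≡ 0ℚ
  c₉ = solve-∀ ringℚ
  c₁₀ : ∀ u v → 1ℚ * 1ℚ ≡ 1ℚ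
  c₁₀ = solve-∀ ringℚ
  go : ∀ n → coeff (sextic u v *ₚ quartic-list (withQuadratic u v)) n ≡ coeff (decic-list (withQuadratic u v)) n
  go 0 = c₀ u v
  go 1 = c₁ u v
  go 2 = c₂ u v
  go 3 = c₃ u v
  go 4 = c₄ u v
  go 5 = c₅ u v
  go 6 = c₆ u v
  go 7 = c₇ u v
  go 8 = c₈ u v
  go 9 = c₉ u v
  go 10 = c₁₀ u v
  go (suc (suc (suc (suc (suc (suc (suc (suc (suc (suc (suc n))))))))))) = refl

quadratic∣quintic : ∀ u v → quadratic (withQuadratic u v) ∣ₚ quintic (withQuadratic u v)
quadratic∣quintic u v = cofactor , ≈-trans (*-congʳ cofactor (quadratic≈ (withQuadratic u v)))
  (≈-trans (mk≈ go) (≈-sym (quintic≈ (withQuadratic u v))))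
  where
  cofactor : Poly
  cofactor = # 2 * u * v - u * u * u ∷ u * u - v ∷ - u ∷ 1ℚ ∷ []
  c₀ : ∀ u v → (# 2 * u * v - u * u * u) * v + (0ℚ) ≡ u * v * (# 2 * v - u * (u * 1ℚ))
  c₀ = solve-∀ ringℚ
  c₁ : ∀ u v → (# 2 * u * v - u * u * u) * u + ((u * u - v) * v + (0ℚ)) ≡ # 3 * (u * (u * 1ℚ)) * v - u * (u * (u * (u * 1ℚ))) - v * (v * 1ℚ)
  c₁ = solve-∀ ringℚ
  c₂ : ∀ u v → (# 2 * u * v - u * u * u) * 1ℚ + ((u * u - v) * u + ((- u) * v + (0ℚ))) ≡ 0ℚ
  c₂ = solve-∀ ringℚ
  c₃ : ∀ u v → (u * u - v) * 1ℚ + ((- u) * u + (1ℚ * v + (0ℚ))) ≡ 0ℚ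
  c₃ = solve-∀ ringℚ
  c₄ : ∀ u v → (- u) * 1ℚ + (1ℚ * u) ≡ 0ℚ
  c₄ = solve-∀ ringℚ
  c₅ : ∀ u v → 1ℚ * 1ℚ ≡ 1ℚ
  c₅ = solve-∀ ringℚ
  go : ∀ n → coeff (cofactor *ₚ quadratic-list (withQuadratic u v)) n ≡ coeff (quintic-list (withQuadratic u v)) n
  go 0 = c₀ u v
  go 1 = c₁ u v
  go 2 = c₂ u v
  go 3 = c₃ u v
  go 4 = c₄ u v
  go 5 = c₅ u v
  go (suc (suc (suc (suc (suc (suc n)))))) = refl

-- The conditions on u, v under which the sextic is F(x) F⁻(x), where F = x³ + r x² + s x + t
-- and F⁻ = - F(- x).
record Splits (r s t u v : ℚ) : Set where
  field
    u≡ : u ≡ r * r - # 2 * s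
    v≡ : v ≡ u * u - s * s + # 2 * (r * t)
    t²≡ : t * t ≡ u * u * u - # 2 * u * v

splits-product : ∀ {r s t u v} → Splits r s t u v → cubic r s t *ₚ cubic (- r) s (- t) ≈ₚ sextic u v
splits-product {r} {s} {t} {u} {v} splits = mk≈ go
  where
  open Splits splits
  c₀ : ∀ r s t → t * (- t) + (0ℚ) ≡ - (t * t)
  c₀ = solve-∀ ringℚ
  c₁ : ∀ r s t → t * s + (s * (- t) + (0ℚ)) ≡ 0ℚ
  c₁ = solve-∀ ringℚ
  c₂ : ∀ r s t → t * (- r) + (s * s + (r * (- t) + (0ℚ))) ≡ s * s - # 2 * (r * t)
  c₂ = solve-∀ ringℚ
  c₃ : ∀ r s t → t * 1ℚ + (s * (- r) + (r * s + (1ℚ * (- t) + (0ℚ)))) ≡ 0ℚ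
  c₃ = solve-∀ ringℚ
  c₄ : ∀ r s t → s * 1ℚ + (r * (- r) + (1ℚ * s)) ≡ # 2 * s - r * r
  c₄ = solve-∀ ringℚ
  c₅ : ∀ r s t → r * 1ℚ + (1ℚ * (- r)) ≡ 0ℚ
  c₅ = solve-∀ ringℚ
  c₆ : ∀ r s t → 1ℚ * 1ℚ ≡ 1ℚ
  c₆ = solve-∀ ringℚ
  d₀ : ∀ t u v → - (t * t) ≡ # 2 * u * v - u * u * u + (t * t - (u * u * u - # 2 * u * v)) * - 1ℚ
  d₀ = solve-∀ ringℚ
  d₂ : ∀ r s t u v → s * s - # 2 * (r * t) ≡ u * u - v + (v - (u * u - s * s + # 2 * (r * t))) * 1ℚ
  d₂ = solve-∀ ringℚ
  d₄ : ∀ r s u → # 2 * s - r * r ≡ - u + (u - (r * r - # 2 * s)) * 1ℚ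
  d₄ = solve-∀ ringℚ
  go : ∀ n → coeff (cubic r s t *ₚ cubic (- r) s (- t)) n ≡ coeff (sextic u v) n
  go 0 = trans (c₀ r s t) (modulo t²≡ _ (d₀ t u v))
  go 1 = c₁ r s t
  go 2 = trans (c₂ r s t) (modulo v≡ _ (d₂ r s t u v))
  go 3 = c₃ r s t
  go 4 = trans (c₄ r s t) (modulo u≡ _ (d₄ r s u))
  go 5 = c₅ r s t
  go 6 = c₆ r s t
  go (suc (suc (suc (suc (suc (suc (suc n))))))) = refl

eval-reflect : ∀ r s t z → eval (cubic (- r) s (- t)) z ≡ - eval (cubic r s t) (- z)
eval-reflect = lemma
  where
  lemma : ∀ r s t z → - t + z * (s + z * (- r + z * (1ℚ + z * 0ℚ))) ≡ - (t + - z * (s + - z * (r + - z * (1ℚ + - z * 0ℚ))))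
  lemma = solve-∀ ringℚ

neg-≡0 : ∀ {p} → - p ≡ 0ℚ → p ≡ 0ℚ
neg-≡0 {p} eq = trans (lemma p) (cong -_ eq)
  where
  lemma : ∀ p → p ≡ - (- p)
  lemma = solve-∀ ringℚ

no-root-reflect : ∀ r s t → NoRoot (cubic r s t) → NoRoot (cubic (- r) s (- t))
no-root-reflect r s t noroot z eq = noroot (- z) (neg-≡0 (trans (sym (eval-reflect r s t z)) eq))

sextic-no-root : ∀ {r s t u v} → Splits r s t u v → NoRoot (cubic r s t) → NoRoot (sextic u v)
sextic-no-root {r} {s} {t} {u} {v} splits noroot z eq = *-≢0 (noroot z) (no-root-reflect r s t noroot z)
  (trans (sym (eval-* (cubic r s t) (cubic (- r) s (- t)) z)) (trans (eval-cong (splits-product splits) z) eq))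

*ₚ-identityʳ : ∀ p → p *ₚ C 1ℚ ≈ₚ p
*ₚ-identityʳ p = mk≈ (go p)
  where
  lemma : ∀ a → a * 1ℚ + 0ℚ ≡ a
  lemma = solve-∀ ringℚ
  lemma′ : ∀ a b → a * 0ℚ + b ≡ b
  lemma′ = solve-∀ ringℚ
  go : ∀ p n → coeff (p *ₚ C 1ℚ) n ≡ coeff p n
  go []      n       = refl
  go (a ∷ p) zero    = trans (coeff-∷-* a p (C 1ℚ) 0) (lemma a)
  go (a ∷ p) (suc n) = trans (coeff-∷-* a p (C 1ℚ) (suc n)) (trans (lemma′ a (coeff (p *ₚ C 1ℚ) n)) (go p n))

-- Comparing coefficients in an arbitrary factorization into cubics

module CubicProduct (a₀ a₁ a₂ a₃ b₀ b₁ b₂ b₃ : ℚ) where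
  list : Poly
  list = a₀ * b₀ ∷ a₀ * b₁ + a₁ * b₀ ∷ a₀ * b₂ + a₁ * b₁ + a₂ * b₀ ∷ a₀ * b₃ + a₁ * b₂ + a₂ * b₁ + a₃ * b₀ ∷ a₁ * b₃ + a₂ * b₂ + a₃ * b₁ ∷ a₂ * b₃ + a₃ * b₂ ∷ a₃ * b₃ ∷ []

  product≈ : (a₀ ∷ a₁ ∷ a₂ ∷ a₃ ∷ []) *ₚ (b₀ ∷ b₁ ∷ b₂ ∷ b₃ ∷ []) ≈ₚ list
  product≈ = mk≈ go
    where
    c₀ : ∀ a₀ a₁ a₂ a₃ b₀ b₁ b₂ b₃ → a₀ * b₀ + (0ℚ) ≡ a₀ * b₀
    c₀ = solve-∀ ringℚ
    c₁ : ∀ a₀ a₁ a₂ a₃ b₀ b₁ b₂ b₃ → a₀ * b₁ + (a₁ * b₀ + (0ℚ)) ≡ a₀ * b₁ + a₁ * b₀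
    c₁ = solve-∀ ringℚ
    c₂ : ∀ a₀ a₁ a₂ a₃ b₀ b₁ b₂ b₃ → a₀ * b₂ + (a₁ * b₁ + (a₂ * b₀ + (0ℚ))) ≡ a₀ * b₂ + a₁ * b₁ + a₂ * b₀
    c₂ = solve-∀ ringℚ
    c₃ : ∀ a₀ a₁ a₂ a₃ b₀ b₁ b₂ b₃ → a₀ * b₃ + (a₁ * b₂ + (a₂ * b₁ + (a₃ * b₀ + (0ℚ)))) ≡ a₀ * b₃ + a₁ * b₂ + a₂ * b₁ + a₃ * b₀
    c₃ = solve-∀ ringℚ
    c₄ : ∀ a₀ a₁ a₂ a₃ b₀ b₁ b₂ b₃ → a₁ * b₃ + (a₂ * b₂ + (a₃ * b₁)) ≡ a₁ * b₃ + a₂ * b₂ + a₃ * b₁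
    c₄ = solve-∀ ringℚ
    c₅ : ∀ a₀ a₁ a₂ a₃ b₀ b₁ b₂ b₃ → a₂ * b₃ + (a₃ * b₂) ≡ a₂ * b₃ + a₃ * b₂
    c₅ = solve-∀ ringℚ
    c₆ : ∀ a₀ a₁ a₂ a₃ b₀ b₁ b₂ b₃ → a₃ * b₃ ≡ a₃ * b₃
    c₆ = solve-∀ ringℚ
    go : ∀ n → coeff ((a₀ ∷ a₁ ∷ a₂ ∷ a₃ ∷ []) *ₚ (b₀ ∷ b₁ ∷ b₂ ∷ b₃ ∷ [])) n ≡ coeff list n
    go 0 = c₀ a₀ a₁ a₂ a₃ b₀ b₁ b₂ b₃
    go 1 = c₁ a₀ a₁ a₂ a₃ b₀ b₁ b₂ b₃
    go 2 = c₂ a₀ a₁ a₂ a₃ b₀ b₁ b₂ b₃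
    go 3 = c₃ a₀ a₁ a₂ a₃ b₀ b₁ b₂ b₃
    go 4 = c₄ a₀ a₁ a₂ a₃ b₀ b₁ b₂ b₃
    go 5 = c₅ a₀ a₁ a₂ a₃ b₀ b₁ b₂ b₃
    go 6 = c₆ a₀ a₁ a₂ a₃ b₀ b₁ b₂ b₃
    go (suc (suc (suc (suc (suc (suc (suc n))))))) = refl

record SexticQuotient (A B u v c₀ c₁ c₂ c₃ c₄ c₅ c₆ : ℚ) : Set where
  field
    c₆≡ : c₆ ≡ 1ℚ
    c₅≡ : c₅ ≡ 0ℚ
    c₄≡ : c₄ ≡ - u
    c₃≡ : c₃ ≡ 0ℚ
    c₂≡ : c₂ ≡ u * u - v
    c₁≡ : c₁ ≡ 0ℚ
    c₀≡ : c₀ ≡ # 2 * u * v - u * u * u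
    A≡  : A ≡ u * c₀ + v * c₂
    B≡  : B ≡ v * c₀

-- The coefficients of x¹⁰ down to x⁴ determine those of the quotient one after the other; the
-- coefficients of x² and of 1 then express A and B through u and v.
sextic-quotient : ∀ A B u v c₀ c₁ c₂ c₃ c₄ c₅ c₆ →
  (c₀ ∷ c₁ ∷ c₂ ∷ c₃ ∷ c₄ ∷ c₅ ∷ c₆ ∷ []) *ₚ quartic-list (quad A B u v) ≈ₚ decic-list (quad A B u v) →
  SexticQuotient A B u v c₀ c₁ c₂ c₃ c₄ c₅ c₆
sextic-quotient A B u v c₀ c₁ c₂ c₃ c₄ c₅ c₆ h = record
  { c₆≡ = E₁₀
  ; c₅≡ = E₉
  ; c₄≡ = c₄≡
  ; c₃≡ = modulo E₇ _ (modulo E₉ _ (f₃ u c₃ c₅))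
  ; c₂≡ = c₂≡
  ; c₁≡ = modulo E₅ _ (modulo E₇ _ (modulo E₉ _ (f₁ u v c₁ c₃ c₅)))
  ; c₀≡ = modulo E₄ _ (modulo c₂≡ _ (modulo c₄≡ _ (f₀ u v c₀ c₂ c₄)))
  ; A≡ = sym E₂
  ; B≡ = sym E₀
  }
  where
  e₀ : ∀ c₀ c₁ c₂ c₃ c₄ c₅ c₆ u v → c₀ * v + (0ℚ) ≡ v * c₀
  e₀ = solve-∀ ringℚ
  e₂ : ∀ c₀ c₁ c₂ c₃ c₄ c₅ c₆ u v → c₀ * u + (c₁ * 0ℚ + (c₂ * v + (0ℚ))) ≡ u * c₀ + v * c₂
  e₂ = solve-∀ ringℚ
  e₄ : ∀ c₀ c₁ c₂ c₃ c₄ c₅ c₆ u v → c₀ * 1ℚ + (c₁ * 0ℚ + (c₂ * u + (c₃ * 0ℚ + (c₄ * v + (0ℚ))))) ≡ c₀ + u * c₂ + v * c₄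
  e₄ = solve-∀ ringℚ
  e₅ : ∀ c₀ c₁ c₂ c₃ c₄ c₅ c₆ u v → c₁ * 1ℚ + (c₂ * 0ℚ + (c₃ * u + (c₄ * 0ℚ + (c₅ * v + (0ℚ))))) ≡ c₁ + u * c₃ + v * c₅
  e₅ = solve-∀ ringℚ
  e₆ : ∀ c₀ c₁ c₂ c₃ c₄ c₅ c₆ u v → c₂ * 1ℚ + (c₃ * 0ℚ + (c₄ * u + (c₅ * 0ℚ + (c₆ * v + (0ℚ))))) ≡ c₂ + u * c₄ + v * c₆
  e₆ = solve-∀ ringℚ
  e₇ : ∀ c₀ c₁ c₂ c₃ c₄ c₅ c₆ u v → c₃ * 1ℚ + (c₄ * 0ℚ + (c₅ * u + (c₆ * 0ℚ))) ≡ c₃ + u * c₅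
  e₇ = solve-∀ ringℚ
  e₈ : ∀ c₀ c₁ c₂ c₃ c₄ c₅ c₆ u v → c₄ * 1ℚ + (c₅ * 0ℚ + (c₆ * u)) ≡ c₄ + u * c₆
  e₈ = solve-∀ ringℚ
  e₉ : ∀ c₀ c₁ c₂ c₃ c₄ c₅ c₆ u v → c₅ * 1ℚ + (c₆ * 0ℚ) ≡ c₅
  e₉ = solve-∀ ringℚ
  e₁₀ : ∀ c₀ c₁ c₂ c₃ c₄ c₅ c₆ u v → c₆ * 1ℚ ≡ c₆
  e₁₀ = solve-∀ ringℚ
  E₀ : v * c₀ ≡ B
  E₀ = trans (sym (e₀ c₀ c₁ c₂ c₃ c₄ c₅ c₆ u v)) (coeff-≡ h 0)
  E₂ : u * c₀ + v * c₂ ≡ A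
  E₂ = trans (sym (e₂ c₀ c₁ c₂ c₃ c₄ c₅ c₆ u v)) (coeff-≡ h 2)
  E₄ : c₀ + u * c₂ + v * c₄ ≡ 0ℚ
  E₄ = trans (sym (e₄ c₀ c₁ c₂ c₃ c₄ c₅ c₆ u v)) (coeff-≡ h 4)
  E₅ : c₁ + u * c₃ + v * c₅ ≡ 0ℚ
  E₅ = trans (sym (e₅ c₀ c₁ c₂ c₃ c₄ c₅ c₆ u v)) (coeff-≡ h 5)
  E₆ : c₂ + u * c₄ + v * c₆ ≡ 0ℚ
  E₆ = trans (sym (e₆ c₀ c₁ c₂ c₃ c₄ c₅ c₆ u v)) (coeff-≡ h 6)
  E₇ : c₃ + u * c₅ ≡ 0ℚ
  E₇ = trans (sym (e₇ c₀ c₁ c₂ c₃ c₄ c₅ c₆ u v)) (coeff-≡ h 7)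
  E₈ : c₄ + u * c₆ ≡ 0ℚ
  E₈ = trans (sym (e₈ c₀ c₁ c₂ c₃ c₄ c₅ c₆ u v)) (coeff-≡ h 8)
  E₉ : c₅ ≡ 0ℚ
  E₉ = trans (sym (e₉ c₀ c₁ c₂ c₃ c₄ c₅ c₆ u v)) (coeff-≡ h 9)
  E₁₀ : c₆ ≡ 1ℚ
  E₁₀ = trans (sym (e₁₀ c₀ c₁ c₂ c₃ c₄ c₅ c₆ u v)) (coeff-≡ h 10)
  f₄ : ∀ u c₄ c₆ → c₄ ≡ - u + (c₄ + u * c₆ - 0ℚ) * 1ℚ + (c₆ - 1ℚ) * - u
  f₄ = solve-∀ ringℚ
  f₃ : ∀ u c₃ c₅ → c₃ ≡ 0ℚ + (c₃ + u * c₅ - 0ℚ) * 1ℚ + (c₅ - 0ℚ) * - u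
  f₃ = solve-∀ ringℚ
  f₂ : ∀ u v c₂ c₄ c₆ → c₂ ≡ u * u - v + (c₂ + u * c₄ + v * c₆ - 0ℚ) * 1ℚ + (c₄ - - u) * - u + (c₆ - 1ℚ) * - v
  f₂ = solve-∀ ringℚ
  f₁ : ∀ u v c₁ c₃ c₅ → c₁ ≡ 0ℚ + (c₁ + u * c₃ + v * c₅ - 0ℚ) * 1ℚ + (c₃ + u * c₅ - 0ℚ) * - u + (c₅ - 0ℚ) * (u * u - v)
  f₁ = solve-∀ ringℚ
  f₀ : ∀ u v c₀ c₂ c₄ → c₀ ≡ # 2 * u * v - u * u * u + (c₀ + u * c₂ + v * c₄ - 0ℚ) * 1ℚ + (c₂ - (u * u - v)) * - u + (c₄ - - u) * - v
  f₀ = solve-∀ ringℚ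
  c₄≡ : c₄ ≡ - u
  c₄≡ = modulo E₈ _ (modulo E₁₀ _ (f₄ u c₄ c₆))
  c₂≡ : c₂ ≡ u * u - v
  c₂≡ = modulo E₆ _ (modulo c₄≡ _ (modulo E₁₀ _ (f₂ u v c₂ c₄ c₆)))

-- If s′ ≠ s then t = r s, and - r is a root.
symmetric : ∀ r s t r′ s′ t′ → NoRoot (cubic r s t) → r + r′ ≡ 0ℚ → t + t′ + (r * s′ + s * r′) ≡ 0ℚ →
  s * t′ + t * s′ ≡ 0ℚ → s′ ≡ s
symmetric r s t r′ s′ t′ noroot e₂ e₁ e₀ = [ (λ h → ⊥-elim (noroot (- r) (trans (lemma′ r s t) h))) , (λ h → minus≡0 s′ s h) ]′
  (*-≡0-⊎ {t - r * s} {s′ - s} (modulo e₀ _ (modulo e₁ _ (modulo e₂ _ (lemma r s t r′ s′ t′)))))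
  where
  lemma : ∀ r s t r′ s′ t′ → (t - r * s) * (s′ - s) ≡ 0ℚ + (s * t′ + t * s′ - 0ℚ) * 1ℚ
    + (t + t′ + (r * s′ + s * r′) - 0ℚ) * - s + (r + r′ - 0ℚ) * (s * s)
  lemma = solve-∀ ringℚ
  lemma′ : ∀ r s t → t + - r * (s + - r * (r + - r * (1ℚ + - r * 0ℚ))) ≡ t - r * s
  lemma′ = solve-∀ ringℚ

symmetric-splits : ∀ u v r s t r′ s′ t′ → NoRoot (cubic r s t) → r + r′ ≡ 0ℚ → t + t′ + (r * s′ + s * r′) ≡ 0ℚ →
  s * t′ + t * s′ ≡ 0ℚ → s + s′ + r * r′ ≡ - u → r * t′ + t * r′ + s * s′ ≡ u * u - v →
  t * t′ ≡ # 2 * u * v - u * u * u → Splits r s t u v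
symmetric-splits u v r s t r′ s′ t′ noroot m₅ m₃ m₁ m₄ m₂ m₀ = record
  { u≡ = modulo m₄ _ (modulo s′≡ _ (modulo r′≡ _ (g₄ u r s r′ s′)))
  ; v≡ = modulo m₂ _ (modulo t′≡ _ (modulo r′≡ _ (modulo s′≡ _ (g₂ u v r s t r′ s′ t′))))
  ; t²≡ = modulo m₀ _ (modulo t′≡ _ (g₀ u v t t′))
  }
  where
  g₅ : ∀ r r′ → r′ ≡ - r + (r + r′ - 0ℚ) * 1ℚ
  g₅ = solve-∀ ringℚ
  g₃ : ∀ r s t r′ s′ t′ → t′ ≡ - t + (t + t′ + (r * s′ + s * r′) - 0ℚ) * 1ℚ + (r + r′ - 0ℚ) * - s + (s′ - s) * - r
  g₃ = solve-∀ ringℚ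
  g₄ : ∀ u r s r′ s′ → u ≡ r * r - # 2 * s + (s + s′ + r * r′ - - u) * 1ℚ + (s′ - s) * - 1ℚ + (r′ - - r) * - r
  g₄ = solve-∀ ringℚ
  g₂ : ∀ u v r s t r′ s′ t′ → v ≡ u * u - s * s + # 2 * (r * t) + (r * t′ + t * r′ + s * s′ - (u * u - v)) * 1ℚ
    + (t′ - - t) * - r + (r′ - - r) * - t + (s′ - s) * - s
  g₂ = solve-∀ ringℚ
  g₀ : ∀ u v t t′ → t * t ≡ u * u * u - # 2 * u * v + (t * t′ - (# 2 * u * v - u * u * u)) * - 1ℚ + (t′ - - t) * t
  g₀ = solve-∀ ringℚ
  s′≡ : s′ ≡ s
  s′≡ = symmetric r s t r′ s′ t′ noroot m₅ m₃ m₁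
  r′≡ : r′ ≡ - r
  r′≡ = modulo m₅ _ (g₅ r r′)
  t′≡ : t′ ≡ - t
  t′≡ = modulo m₃ _ (modulo m₅ _ (modulo s′≡ _ (g₃ r s t r′ s′ t′)))

quad-cong : ∀ {A B A′ B′ u v} → A ≡ A′ → B ≡ B′ → quad A B u v ≡ quad A′ B′ u v
quad-cong refl refl = refl

record MonicSplitting (t : Quadruple) : Set where
  open Quadruple t
  field
    r s τ  : ℚ
    splits : Splits r s τ u v
    noroot : NoRoot (cubic r s τ)
    quad≡  : t ≡ withQuadratic u v

-- The leading coefficients satisfy a₃ b₃ = 1, so multiplying the first factor by b₃ and the second
-- by a₃ makes both monic and preserves the product.
monic-splitting : ∀ A B u v a₀ a₁ a₂ a₃ b₀ b₁ b₂ b₃ → let open CubicProduct a₀ a₁ a₂ a₃ b₀ b₁ b₂ b₃ in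
  list *ₚ quartic-list (quad A B u v) ≈ₚ decic-list (quad A B u v) → NoRoot (a₀ ∷ a₁ ∷ a₂ ∷ a₃ ∷ []) →
  MonicSplitting (quad A B u v)
monic-splitting A B u v a₀ a₁ a₂ a₃ b₀ b₁ b₂ b₃ h noroot = record
  { r = a₂ * b₃ ; s = a₁ * b₃ ; τ = a₀ * b₃
  ; splits = symmetric-splits u v (a₂ * b₃) (a₁ * b₃) (a₀ * b₃) (b₂ * a₃) (b₁ * a₃) (b₀ * a₃) noroot′
      (trans (m₅ a₂ a₃ b₂ b₃) c₅≡)
      (trans (modulo c₆≡ _ (m₃ a₀ a₁ a₂ a₃ b₀ b₁ b₂ b₃)) c₃≡)
      (trans (modulo c₆≡ _ (m₁ a₀ a₁ a₃ b₀ b₁ b₃)) c₁≡)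
      (trans (modulo c₆≡ _ (m₄ a₁ a₂ a₃ b₁ b₂ b₃)) c₄≡)
      (trans (modulo c₆≡ _ (m₂ a₀ a₁ a₂ a₃ b₀ b₁ b₂ b₃)) c₂≡)
      (trans (modulo c₆≡ _ (m₀ a₀ a₃ b₀ b₃)) c₀≡)
  ; noroot = noroot′
  ; quad≡ = quad-cong (trans A≡ (trans (cong₂ (λ c₀ c₂ → u * c₀ + v * c₂) c₀≡ c₂≡) (A-lemma u v)))
      (trans B≡ (trans (cong (v *_) c₀≡) (B-lemma u v)))
  }
  where
  open SexticQuotient (sextic-quotient A B u v
    (a₀ * b₀) (a₀ * b₁ + a₁ * b₀) (a₀ * b₂ + a₁ * b₁ + a₂ * b₀) (a₀ * b₃ + a₁ * b₂ + a₂ * b₁ + a₃ * b₀)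
    (a₁ * b₃ + a₂ * b₂ + a₃ * b₁) (a₂ * b₃ + a₃ * b₂) (a₃ * b₃) h)
  m₅ : ∀ a₂ a₃ b₂ b₃ → a₂ * b₃ + b₂ * a₃ ≡ a₂ * b₃ + a₃ * b₂
  m₅ = solve-∀ ringℚ
  m₄ : ∀ a₁ a₂ a₃ b₁ b₂ b₃ → a₁ * b₃ + b₁ * a₃ + a₂ * b₃ * (b₂ * a₃) ≡ a₁ * b₃ + a₂ * b₂ + a₃ * b₁ + (a₃ * b₃ - 1ℚ) * (a₂ * b₂)
  m₄ = solve-∀ ringℚ
  m₃ : ∀ a₀ a₁ a₂ a₃ b₀ b₁ b₂ b₃ → a₀ * b₃ + b₀ * a₃ + (a₂ * b₃ * (b₁ * a₃) + a₁ * b₃ * (b₂ * a₃)) ≡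
    a₀ * b₃ + a₁ * b₂ + a₂ * b₁ + a₃ * b₀ + (a₃ * b₃ - 1ℚ) * (a₂ * b₁ + a₁ * b₂)
  m₃ = solve-∀ ringℚ
  m₂ : ∀ a₀ a₁ a₂ a₃ b₀ b₁ b₂ b₃ → a₂ * b₃ * (b₀ * a₃) + a₀ * b₃ * (b₂ * a₃) + a₁ * b₃ * (b₁ * a₃) ≡
    a₀ * b₂ + a₁ * b₁ + a₂ * b₀ + (a₃ * b₃ - 1ℚ) * (a₂ * b₀ + a₀ * b₂ + a₁ * b₁)
  m₂ = solve-∀ ringℚ
  m₁ : ∀ a₀ a₁ a₃ b₀ b₁ b₃ → a₁ * b₃ * (b₀ * a₃) + a₀ * b₃ * (b₁ * a₃) ≡ a₀ * b₁ + a₁ * b₀ + (a₃ * b₃ - 1ℚ) * (a₁ * b₀ + a₀ * b₁)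
  m₁ = solve-∀ ringℚ
  m₀ : ∀ a₀ a₃ b₀ b₃ → a₀ * b₃ * (b₀ * a₃) ≡ a₀ * b₀ + (a₃ * b₃ - 1ℚ) * (a₀ * b₀)
  m₀ = solve-∀ ringℚ
  A-lemma : ∀ u v → u * (# 2 * u * v - u * u * u) + v * (u * u - v) ≡
    # 3 * (u * (u * 1ℚ)) * v - u * (u * (u * (u * 1ℚ))) - v * (v * 1ℚ)
  A-lemma = solve-∀ ringℚ
  B-lemma : ∀ u v → v * (# 2 * u * v - u * u * u) ≡ u * v * (# 2 * v - u * (u * 1ℚ))
  B-lemma = solve-∀ ringℚ
  eval-lemma : ∀ a₀ a₁ a₂ a₃ b₃ z → a₀ + z * (a₁ + z * (a₂ + z * (a₃ + z * 0ℚ))) ≡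
    a₃ * (a₀ * b₃ + z * (a₁ * b₃ + z * (a₂ * b₃ + z * (1ℚ + z * 0ℚ)))) + (a₃ * b₃ - 1ℚ) * - (a₀ + z * (a₁ + z * a₂))
  eval-lemma = solve-∀ ringℚ
  noroot′ : NoRoot (cubic (a₂ * b₃) (a₁ * b₃) (a₀ * b₃))
  noroot′ z eq = noroot z (trans (modulo c₆≡ _ (eval-lemma a₀ a₁ a₂ a₃ b₃ z))
    (trans (cong (a₃ *_) eq) (ℚ.*-zeroʳ a₃)))

type33⇒splitting : ∀ t → IsType33 t → MonicSplitting t
type33⇒splitting t@(quad A B u v) (_ , q , q*quartic≈ , _ , f₁ ∷ f₂ ∷ [] , (irr₁ , deg₁) ∷ (irr₂ , deg₂) ∷ [] , q≈) =
  monic-splitting A B u v (coeff f₁ 0) (coeff f₁ 1) (coeff f₁ 2) (coeff f₁ 3) (coeff f₂ 0) (coeff f₂ 1) (coeff f₂ 2) (coeff f₂ 3)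
    (≈-trans (*-congˡ (quartic-list t) (≈-sym q≈list))
      (≈-trans (*-congʳ q (≈-sym (quartic≈ t))) (≈-trans q*quartic≈ (decic≈ t))))
    (λ z eq → irreducible⇒no-root deg₁ irr₁ z (trans (eval-cong (cubic-coefficients f₁ deg₁) z) eq))
  where
  open CubicProduct (coeff f₁ 0) (coeff f₁ 1) (coeff f₁ 2) (coeff f₁ 3) (coeff f₂ 0) (coeff f₂ 1) (coeff f₂ 2) (coeff f₂ 3)
  list₁ list₂ : Poly
  list₁ = coeff f₁ 0 ∷ coeff f₁ 1 ∷ coeff f₁ 2 ∷ coeff f₁ 3 ∷ []
  list₂ = coeff f₂ 0 ∷ coeff f₂ 1 ∷ coeff f₂ 2 ∷ coeff f₂ 3 ∷ []
  q≈list : q ≈ₚ list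
  q≈list = ≈-trans q≈ (≈-trans (*-congʳ f₁ (*ₚ-identityʳ f₂)) (≈-trans (*-congˡ f₂ (cubic-coefficients f₁ deg₁))
    (≈-trans (*-congʳ list₁ (cubic-coefficients f₂ deg₂)) product≈)))

-- The factorization attached to a point of the curve

paramU : ℚ → ℚ
paramU X = - X ÷ # 2

paramV : ℚ → ℚ → ℚ
paramV X Y = (# 3 * X ^ℚ 2 + # 28 * X - # 4 + # 8 * Y) ÷ # 16

-- With s = (X + 2) / 4 and t = X + Y / 4 the condition on t² is the curve equation divided by 16;
-- the other two conditions hold identically.
param-splits : ∀ X Y → OnCurve X Y → Splits 1ℚ (cubicS X) (cubicT X Y) (paramU X) (paramV X Y)
param-splits X Y p = record
  { u≡ = lemma₁ X
  ; v≡ = lemma₂ X Y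
  ; t²≡ = modulo p _ (lemma₃ X Y)
  }
  where
  lemma₁ : ∀ X → - X * (1/ # 2) ≡ 1ℚ * 1ℚ - # 2 * ((X + # 2) * (1/ # 4))
  lemma₁ = solve-∀ ringℚ
  lemma₂ : ∀ X Y → (# 3 * (X * (X * 1ℚ)) + # 28 * X - # 4 + # 8 * Y) * (1/ # 16) ≡
    - X * (1/ # 2) * (- X * (1/ # 2)) - (X + # 2) * (1/ # 4) * ((X + # 2) * (1/ # 4)) + # 2 * (1ℚ * (X + Y * (1/ # 4)))
  lemma₂ = solve-∀ ringℚ
  lemma₃ : ∀ X Y →
    let u = - X * (1/ # 2)
        v = (# 3 * (X * (X * 1ℚ)) + # 28 * X - # 4 + # 8 * Y) * (1/ # 16)
        t = X + Y * (1/ # 4)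
    in t * t ≡ u * u * u - # 2 * u * v
      + (Y * Y - (X * X * X + # 12 * X * X + (- # 4) * X + 0ℚ)) * (1/ # 16)
  lemma₃ = solve-∀ ringℚ

param-factorization : ∀ X Y → OnCurve X Y →
  (cubic⁺ X Y *ₚ cubic⁻ X Y) *ₚ quartic (param X Y) ≈ₚ decic (param X Y)
param-factorization X Y p = ≈-trans (*-congˡ (quartic (param X Y))
    (≈-trans (*-congˡ (cubic⁻ X Y) (cubic⁺≈ X Y))
      (≈-trans (*-congʳ (cubic 1ℚ (cubicS X) (cubicT X Y)) (cubic⁻≈ X Y)) (splits-product (param-splits X Y p)))))
  (sextic-quartic (paramU X) (paramV X Y))

nonzero-root : ∀ r s t → NoRoot (cubic r s t) → t ≢ 0ℚ
nonzero-root r s t noroot t≡0 = noroot 0ℚ (trans (lemma r s t) t≡0)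
  where
  lemma : ∀ r s t → t + 0ℚ * (s + 0ℚ * (r + 0ℚ * (1ℚ + 0ℚ * 0ℚ))) ≡ t
  lemma = solve-∀ ringℚ

-- A vanishes only if 5 is a square; v = 0 makes x² - u a factor of the sextic with u = (t / u)²,
-- and 2 v = u² makes x a factor.
withQuadratic-nonzero : ∀ {r s t u v} → Splits r s t u v → NoRoot (cubic r s t) →
  let open Quadruple (withQuadratic u v) in A * B ≢ 0ℚ
withQuadratic-nonzero {r} {s} {t} {u} {v} splits noroot = *-≢0 A≢0 B≢0
  where
  open Splits splits
  t≢0 = nonzero-root r s t noroot
  u≢0 : u ≢ 0ℚ
  u≢0 u≡0 = t≢0 (square-≡0 (trans t²≡ (modulo u≡0 _ (lemma u v))))
    where
    lemma : ∀ u v → u * u * u - # 2 * u * v ≡ 0ℚ + (u - 0ℚ) * (u * u - # 2 * v)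
    lemma = solve-∀ ringℚ
  2v≢u² : # 2 * v - u * (u * 1ℚ) ≢ 0ℚ
  2v≢u² eq = t≢0 (square-≡0 (trans t²≡ (modulo eq _ (lemma u v))))
    where
    lemma : ∀ u v → u * u * u - # 2 * u * v ≡ 0ℚ + (# 2 * v - u * (u * 1ℚ) - 0ℚ) * - u
    lemma = solve-∀ ringℚ
  v≢0 : v ≢ 0ℚ
  v≢0 v≡0 = sextic-no-root splits noroot k (modulo v≡0 _ (modulo k²≡u _ (lemma u v k)))
    where
    k = t /[ u , u≢0 ]
    k²≡u : k * k ≡ u
    k²≡u = *-cancelʳ _ _ (u * u) (square-≢0 u≢0) (trans (lemma₁ k u) (trans (cong₂ _*_ (÷-cancel t u u≢0) (÷-cancel t u u≢0))
      (trans t²≡ (modulo v≡0 _ (lemma₂ u v)))))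
      where
      lemma₁ : ∀ k u → k * k * (u * u) ≡ k * u * (k * u)
      lemma₁ = solve-∀ ringℚ
      lemma₂ : ∀ u v → u * u * u - # 2 * u * v ≡ u * (u * u) + (v - 0ℚ) * - (# 2 * u)
      lemma₂ = solve-∀ ringℚ
    lemma : ∀ u v k → # 2 * u * v - u * u * u + k * (0ℚ + k * (u * u - v + k * (0ℚ + k * (- u + k * (0ℚ + k * (1ℚ + k * 0ℚ)))))) ≡
      0ℚ + (v - 0ℚ) * (# 2 * u - k * k) + (k * k - u) * (k * k * (k * k) + u * u)
    lemma = solve-∀ ringℚ
  B≢0 : u * v * (# 2 * v - u * (u * 1ℚ)) ≢ 0ℚ
  B≢0 = *-≢0 (*-≢0 u≢0 v≢0) 2v≢u²
  A≢0 : # 3 * (u * (u * 1ℚ)) * v - u * (u * (u * (u * 1ℚ))) - v * (v * 1ℚ) ≢ 0ℚ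
  A≢0 eq = √5-irrational q (*-cancelʳ _ _ (u * u * (u * u)) (square-≢0 (square-≢0 u≢0)) (trans (lemma₁ q u)
    (trans (cong₂ _*_ q≡ q≡) (modulo eq _ (lemma₂ u v)))))
    where
    -- Completing the square in A = 3 u² v - u⁴ - v² gives (2 v - 3 u²)² = 5 u⁴ - 4 A.
    q = (# 2 * v - # 3 * (u * u)) /[ u * u , square-≢0 u≢0 ]
    q≡ : q * (u * u) ≡ # 2 * v - # 3 * (u * u)
    q≡ = ÷-cancel (# 2 * v - # 3 * (u * u)) (u * u) (square-≢0 u≢0)
    lemma₁ : ∀ q u → q * q * (u * u * (u * u)) ≡ q * (u * u) * (q * (u * u))
    lemma₁ = solve-∀ ringℚ
    lemma₂ : ∀ u v → (# 2 * v - # 3 * (u * u)) * (# 2 * v - # 3 * (u * u)) ≡ # 5 * (u * u * (u * u))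
      + (# 3 * (u * (u * 1ℚ)) * v - u * (u * (u * (u * 1ℚ))) - v * (v * 1ℚ) - 0ℚ) * - (# 4)
    lemma₂ = solve-∀ ringℚ

no-root-cong : ∀ {p q} → p ≈ₚ q → NoRoot p → NoRoot q
no-root-cong h noroot z eq = noroot z (trans (eval-cong h z) eq)

cubic⁺-degree : ∀ X Y → HasDegree (cubic⁺ X Y) 3
cubic⁺-degree X Y = degree-cong (≈-sym (cubic⁺≈ X Y)) (cubic-degree 1ℚ (cubicS X) (cubicT X Y))

cubic⁻-degree : ∀ X Y → HasDegree (cubic⁻ X Y) 3
cubic⁻-degree X Y = degree-cong (≈-sym (cubic⁻≈ X Y)) (cubic-degree (- 1ℚ) (cubicS X) (- cubicT X Y))

no-root⇒type33 : ∀ X Y → OnCurve X Y → NoRoot (cubic 1ℚ (cubicS X) (cubicT X Y)) → IsType33 (param X Y)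
no-root⇒type33 X Y p noroot =
  (withQuadratic-nonzero (param-splits X Y p) noroot , quadratic∣quintic (paramU X) (paramV X Y)) ,
  cubic⁺ X Y *ₚ cubic⁻ X Y , param-factorization X Y p , ℕ.≤-refl ∷ [-] , cubic⁺ X Y ∷ cubic⁻ X Y ∷ [] ,
  (no-root⇒irreducible (cubic⁺-degree X Y) (no-root-cong (≈-sym (cubic⁺≈ X Y)) noroot) , cubic⁺-degree X Y) ∷
  (no-root⇒irreducible (cubic⁻-degree X Y) (no-root-cong (≈-sym (cubic⁻≈ X Y)) (no-root-reflect 1ℚ (cubicS X) (cubicT X Y) noroot)) , cubic⁻-degree X Y) ∷ [] ,
  *-congʳ (cubic⁺ X Y) (≈-sym (*ₚ-identityʳ (cubic⁻ X Y)))

-- The factors that witness the type are not assumed to be `cubic⁺` and `cubic⁻`. Any splitting into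
-- irreducible cubics shows that the sextic has no rational root, and a root of `cubic⁺` would be
-- one.
type33⇒no-root : ∀ X Y → OnCurve X Y → IsType33 (param X Y) → NoRoot (cubic 1ℚ (cubicS X) (cubicT X Y))
type33⇒no-root X Y p type33 z eq = sextic-no-root splits noroot z
  (trans (sym (eval-cong (splits-product (param-splits X Y p)) z))
    (trans (eval-* (cubic 1ℚ s t) (cubic (- 1ℚ) s (- t)) z)
      (trans (cong (_* eval (cubic (- 1ℚ) s (- t)) z) eq) (ℚ.*-zeroˡ (eval (cubic (- 1ℚ) s (- t)) z)))))
  where
  s = cubicS X
  t = cubicT X Y
  open MonicSplitting (type33⇒splitting (param X Y) type33) hiding (s; r)

type33⇔irreducible : ∀ X Y → OnCurve X Y → IsType33 (param X Y) ⇔ Irreducible (cubic⁺ X Y)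
type33⇔irreducible X Y p = mk⇔
  (λ h → no-root⇒irreducible (cubic⁺-degree X Y) (no-root-cong (≈-sym (cubic⁺≈ X Y)) (type33⇒no-root X Y p h)))
  (λ irr → no-root⇒type33 X Y p (no-root-cong (cubic⁺≈ X Y) (irreducible⇒no-root (cubic⁺-degree X Y) irr)))

-- Normalization and uniqueness of the parameters

reciprocal : ∀ {p} → p ≢ 0ℚ → ∃ λ q → q * p ≡ 1ℚ × q ≢ 0ℚ
reciprocal {p} p≢0 = q , qp≡1 , λ q≡0 → 1≢0 (trans (sym qp≡1) (trans (cong (_* p) q≡0) (ℚ.*-zeroˡ p)))
  where
  q = 1ℚ /[ p , p≢0 ]
  qp≡1 = ÷-cancel 1ℚ p p≢0
  1≢0 : 1ℚ ≢ 0ℚ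
  1≢0 ()

-- If r = 0 then t² = 4 s³, and - t / (2 s) is a root.
r≢0 : ∀ {r s t u v} → Splits r s t u v → NoRoot (cubic r s t) → r ≢ 0ℚ
r≢0 {r} {s} {t} {u} {v} splits noroot r≡0 = noroot (- k) (modulo k2s≡t _ (modulo s≡k² _ (modulo r≡0 _ (root k r s t))))
  where
  open Splits splits
  t²≡4s³ : t * t ≡ # 4 * (s * (s * s))
  t²≡4s³ = modulo t²≡ _ (modulo v≡ _ (modulo u≡ _ (modulo r≡0 _ (lemma r s t u v))))
    where
    lemma : ∀ r s t u v → t * t ≡ # 4 * (s * (s * s))
      + (t * t - (u * u * u - # 2 * u * v)) * 1ℚ
      + (v - (u * u - s * s + # 2 * (r * t))) * - (# 2 * u)
      + (u - (r * r - # 2 * s)) * (# 2 * (s * s) - (u * u + u * (r * r - # 2 * s) + (r * r - # 2 * s) * (r * r - # 2 * s)))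
      + (r - 0ℚ) * (# 2 * (r * (s * s)) - # 4 * (u * t) - r * (r * r * (r * r) - # 6 * (r * r * s) + # 12 * (s * s)))
    lemma = solve-∀ ringℚ
  s≢0 : s ≢ 0ℚ
  s≢0 s≡0 = nonzero-root r s t noroot (square-≡0 (trans t²≡4s³ (modulo s≡0 _ (lemma s))))
    where
    lemma : ∀ s → # 4 * (s * (s * s)) ≡ 0ℚ + (s - 0ℚ) * (# 4 * (s * s))
    lemma = solve-∀ ringℚ
  2s≢0 = *-≢0 {# 2} {s} (λ ()) s≢0
  k = t /[ # 2 * s , 2s≢0 ]
  k2s≡t : k * (# 2 * s) ≡ t
  k2s≡t = ÷-cancel t (# 2 * s) 2s≢0
  s≡k² : s ≡ k * k
  s≡k² = *-cancelʳ _ _ (# 4 * (s * s)) (*-≢0 {# 4} (λ ()) (square-≢0 s≢0)) (trans (lemma₁ s) (trans (sym t²≡4s³)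
    (trans (cong₂ _*_ (sym k2s≡t) (sym k2s≡t)) (lemma₂ k s))))
    where
    lemma₁ : ∀ s → s * (# 4 * (s * s)) ≡ # 4 * (s * (s * s))
    lemma₁ = solve-∀ ringℚ
    lemma₂ : ∀ k s → k * (# 2 * s) * (k * (# 2 * s)) ≡ k * k * (# 4 * (s * s))
    lemma₂ = solve-∀ ringℚ
  root : ∀ k r s t → t + - k * (s + - k * (r + - k * (1ℚ + - k * 0ℚ))) ≡ 0ℚ
    + (k * (# 2 * s) - t) * - 1ℚ + (s - k * k) * k + (r - 0ℚ) * (k * k)
  root = solve-∀ ringℚ

-- The three equations are homogeneous when r, s, t, u, v have weights 1, 2, 3, 2, 4.
scale-splits : ∀ {r s t u v} l → Splits r s t u v →
  Splits (l * r) (l * l * s) (l * l * l * t) (l * l * u) (l * l * (l * l) * v)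
scale-splits {r} {s} {t} {u} {v} l splits = record
  { u≡ = modulo u≡ _ (lemma₁ l r s u)
  ; v≡ = modulo v≡ _ (lemma₂ l r s t u v)
  ; t²≡ = modulo t²≡ _ (lemma₃ l t u v)
  }
  where
  open Splits splits
  lemma₁ : ∀ l r s u → l * l * u ≡ l * r * (l * r) - # 2 * (l * l * s) + (u - (r * r - # 2 * s)) * (l * l)
  lemma₁ = solve-∀ ringℚ
  lemma₂ : ∀ l r s t u v → l * l * (l * l) * v ≡ l * l * u * (l * l * u) - l * l * s * (l * l * s) + # 2 * (l * r * (l * l * l * t))
    + (v - (u * u - s * s + # 2 * (r * t))) * (l * l * (l * l))
  lemma₂ = solve-∀ ringℚ
  lemma₃ : ∀ l t u v → l * l * l * t * (l * l * l * t) ≡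
    l * l * u * (l * l * u) * (l * l * u) - # 2 * (l * l * u) * (l * l * (l * l) * v)
    + (t * t - (u * u * u - # 2 * u * v)) * (l * l * l * (l * l * l))
  lemma₃ = solve-∀ ringℚ

-- If z is a root of the scaled cubic, then z / l is a root of the original one; k stands for 1 / l.
scale-no-root : ∀ {r s t} l k → k * l ≡ 1ℚ → NoRoot (cubic r s t) → NoRoot (cubic (l * r) (l * l * s) (l * l * l * t))
scale-no-root {r} {s} {t} l k kl≡1 noroot z eq = noroot (k * z) (modulo kl≡1 _ (trans (identity k l r s t z)
  (cong (λ e → e + (k * l - 1ℚ) * remainder) (trans (cong (k * k * k *_) eq) (ℚ.*-zeroʳ (k * k * k))))))
  where
  remainder : ℚ
  remainder = - ((k * k * l * l + k * l + 1ℚ) * t + k * z * (k * l + 1ℚ) * s + k * k * z * z * r)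
  identity : ∀ k l r s t z → t + k * z * (s + k * z * (r + k * z * (1ℚ + k * z * 0ℚ))) ≡
    k * k * k * (l * l * l * t + z * (l * l * s + z * (l * r + z * (1ℚ + z * 0ℚ))))
    + (k * l - 1ℚ) * - ((k * k * l * l + k * l + 1ℚ) * t + k * z * (k * l + 1ℚ) * s + k * k * z * z * r)
  identity = solve-∀ ringℚ

withQuadratic-∼ : ∀ u v u′ v′ l → l ≢ 0ℚ → u′ ≡ l * l * u → v′ ≡ l * l * (l * l) * v → withQuadratic u v ∼ withQuadratic u′ v′
withQuadratic-∼ u v _ _ l l≢0 refl refl = l , l≢0 , lemma₁ u v l , lemma₂ u v l , lemma₃ u l , lemma₄ v l
  where
  lemma₁ : ∀ u v l → let u′ = l * l * u; v′ = l * l * (l * l) * v in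
    # 3 * (u′ * (u′ * 1ℚ)) * v′ - u′ * (u′ * (u′ * (u′ * 1ℚ))) - v′ * (v′ * 1ℚ) ≡
    (# 3 * (u * (u * 1ℚ)) * v - u * (u * (u * (u * 1ℚ))) - v * (v * 1ℚ)) * (l * (l * (l * (l * (l * (l * (l * (l * 1ℚ))))))))
  lemma₁ = solve-∀ ringℚ
  lemma₂ : ∀ u v l → let u′ = l * l * u; v′ = l * l * (l * l) * v in
    u′ * v′ * (# 2 * v′ - u′ * (u′ * 1ℚ)) ≡
    u * v * (# 2 * v - u * (u * 1ℚ)) * (l * (l * (l * (l * (l * (l * (l * (l * (l * (l * 1ℚ))))))))))
  lemma₂ = solve-∀ ringℚ
  lemma₃ : ∀ u l → l * l * u ≡ l * (l * 1ℚ) * u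
  lemma₃ = solve-∀ ringℚ
  lemma₄ : ∀ v l → l * l * (l * l) * v ≡ l * (l * (l * (l * 1ℚ))) * v
  lemma₄ = solve-∀ ringℚ

-- The inverse of param on the normalized data r = 1.
splits-X : ℚ → ℚ
splits-X s = # 4 * s - # 2

splits-Y : ℚ → ℚ → ℚ
splits-Y s t = # 4 * (t - splits-X s)

splits-onCurve : ∀ {s t u v} → Splits 1ℚ s t u v → OnCurve (splits-X s) (splits-Y s t)
splits-onCurve {s} {t} {u} {v} splits = modulo t²≡ _ (modulo v≡ _ (modulo u≡ _ (lemma s t u v)))
  where
  open Splits splits
  lemma : ∀ s t u v →
    let X = # 4 * s - # 2
        Y = # 4 * (t - X)
        w = 1ℚ * 1ℚ - # 2 * s
    in Y * Y ≡ X * X * X + # 12 * X * X + (- # 4) * X + 0ℚ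
      + (t * t - (u * u * u - # 2 * u * v)) * # 16
      + (v - (u * u - s * s + # 2 * (1ℚ * t))) * - (# 32 * u)
      + (u - w) * (# 32 * (s * s) - # 64 * t - # 16 * (u * u + u * w + w * w))
  lemma = solve-∀ ringℚ

splits-paramU : ∀ {s t u v} → Splits 1ℚ s t u v → paramU (splits-X s) ≡ u
splits-paramU {s} {t} {u} splits = modulo (Splits.u≡ splits) _ (lemma s u)
  where
  lemma : ∀ s u → - (# 4 * s - # 2) * (1/ # 2) ≡ u + (u - (1ℚ * 1ℚ - # 2 * s)) * - 1ℚ
  lemma = solve-∀ ringℚ

splits-paramV : ∀ {s t u v} → Splits 1ℚ s t u v → paramV (splits-X s) (splits-Y s t) ≡ v
splits-paramV {s} {t} {u} {v} splits = modulo (Splits.v≡ splits) _ (modulo (Splits.u≡ splits) _ (lemma s t u v))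
  where
  lemma : ∀ s t u v →
    let X = # 4 * s - # 2
        Y = # 4 * (t - X)
        w = 1ℚ * 1ℚ - # 2 * s
    in (# 3 * (X * (X * 1ℚ)) + # 28 * X - # 4 + # 8 * Y) * (1/ # 16) ≡
      v + (v - (u * u - s * s + # 2 * (1ℚ * t))) * - 1ℚ + (u - w) * - (u + w)
  lemma = solve-∀ ringℚ

-- If the polynomial x³ + λ x² + s′ x + t divides the same sextic as x³ + x² + s x + t and λ ≠ 1,
-- then - (λ + 1) / 2 is a root of the latter.
leading-coefficient : ∀ l s t s′ u v → NoRoot (cubic 1ℚ s t) → Splits 1ℚ s t u v → Splits l s′ t u v → l ≡ 1ℚ
leading-coefficient l s t s′ u v noroot splits splits′ = [ (λ h → minus≡0 l 1ℚ h) , (λ h → ⊥-elim (noroot z h)) ]′ (*-≡0-⊎ product)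
  where
  module S = Splits splits
  module S′ = Splits splits′
  z = - ((l + 1ℚ) * (1/ # 2))
  product : (l - 1ℚ) * eval (cubic 1ℚ s t) z ≡ 0ℚ
  product = modulo S.v≡ _ (modulo S′.v≡ _ (modulo S.u≡ _ (modulo S′.u≡ _ (lemma l s t s′ u v))))
    where
    lemma : ∀ l s t s′ u v → let z = - ((l + 1ℚ) * (1/ # 2)); w = (l * l - 1ℚ) * (1/ # 2) in
      (l - 1ℚ) * (t + z * (s + z * (1ℚ + z * (1ℚ + z * 0ℚ)))) ≡ 0ℚ
      + (v - (u * u - s * s + # 2 * (1ℚ * t))) * (1/ # 2)
      + (v - (u * u - s′ * s′ + # 2 * (l * t))) * - (1/ # 2)
      + (u - (1ℚ * 1ℚ - # 2 * s)) * - ((s′ + s + w) * (1/ # 4))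
      + (u - (l * l - # 2 * s′)) * ((s′ + s + w) * (1/ # 4))
    lemma = solve-∀ ringℚ

-- The values u and v fix t′ up to sign. Replacing a cubic F by - F(- x) changes the signs of l and
-- t′ together and keeps l², which reduces the case t′ = - t to t′ = t.
leading-coefficient-± : ∀ l s t s′ t′ u v → NoRoot (cubic 1ℚ s t) → Splits 1ℚ s t u v → Splits l s′ t′ u v → l * l ≡ 1ℚ
leading-coefficient-± l s t s′ t′ u v noroot splits splits′ =
  cases (equal-squares (trans (Splits.t²≡ splits′) (sym (Splits.t²≡ splits))))
  where
  negate : t′ ≡ - t → Splits (- l) s′ t u v
  negate refl = record
    { u≡ = trans (Splits.u≡ splits′) (lemma₁ l s′)
    ; v≡ = trans (Splits.v≡ splits′) (lemma₂ l s′ t u)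
    ; t²≡ = Splits.t²≡ splits
    }
    where
    lemma₁ : ∀ l s → l * l - # 2 * s ≡ - l * - l - # 2 * s
    lemma₁ = solve-∀ ringℚ
    lemma₂ : ∀ l s t u → u * u - s * s + # 2 * (l * - t) ≡ u * u - s * s + # 2 * (- l * t)
    lemma₂ = solve-∀ ringℚ
  cases : t′ ≡ t ⊎ t′ ≡ - t → l * l ≡ 1ℚ
  cases (inj₁ t′≡t) = cong (λ l → l * l) (leading-coefficient l s t s′ u v noroot splits (subst (λ t → Splits l s′ t u v) t′≡t splits′))
  cases (inj₂ t′≡-t) = trans (lemma l) (cong (λ l → l * l) (leading-coefficient (- l) s t s′ u v noroot splits (negate t′≡-t)))
    where
    lemma : ∀ l → l * l ≡ - l * - l
    lemma = solve-∀ ringℚ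

Parametrized : Quadruple → Set
Parametrized t = ∃ λ X → ∃ λ Y → OnCurve X Y × t ∼ param X Y
  × (∀ X′ Y′ → OnCurve X′ Y′ → t ∼ param X′ Y′ → X′ ≡ X × Y′ ≡ Y)

parametrization : ∀ t → IsType33 t → Parametrized t
parametrization t@(quad A B u v) type33 = go (reciprocal r≢0′)
  where
  open MonicSplitting (type33⇒splitting t type33)
  r≢0′ = r≢0 splits noroot
  go : (∃ λ l → l * r ≡ 1ℚ × l ≢ 0ℚ) → Parametrized t
  go (l , lr≡1 , l≢0) = X , Y , splits-onCurve normalized , equivalent , unique
    where
    s₁ = l * l * s
    t₁ = l * l * l * τ
    u₁ = l * l * u
    v₁ = l * l * (l * l) * v
    normalized : Splits 1ℚ s₁ t₁ u₁ v₁
    normalized = subst (λ r → Splits r s₁ t₁ u₁ v₁) lr≡1 (scale-splits l splits)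
    noroot₁ : NoRoot (cubic 1ℚ s₁ t₁)
    noroot₁ = subst (λ r → NoRoot (cubic r s₁ t₁)) lr≡1 (scale-no-root l r (trans (ℚ.*-comm r l) lr≡1) noroot)
    X = splits-X s₁
    Y = splits-Y s₁ t₁
    equivalent : t ∼ param X Y
    equivalent = subst (_∼ param X Y) (sym quad≡)
      (withQuadratic-∼ u v (paramU X) (paramV X Y) l l≢0 (splits-paramU normalized) (splits-paramV normalized))
    unique : ∀ X′ Y′ → OnCurve X′ Y′ → t ∼ param X′ Y′ → X′ ≡ X × Y′ ≡ Y
    unique X′ Y′ p′ (l′ , l′≢0 , _ , _ , u′≡ , v′≡) = compare (reciprocal l′≢0)
      where
      lemma₁ : ∀ u l l′ k → l * l * u ≡ l * k * (l * k) * (l′ * (l′ * 1ℚ) * u) + (k * l′ - 1ℚ) * - (l * l * u * (k * l′ + 1ℚ))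
      lemma₁ = solve-∀ ringℚ
      lemma₂ : ∀ v l l′ k → l * l * (l * l) * v ≡ l * k * (l * k) * (l * k * (l * k)) * (l′ * (l′ * (l′ * (l′ * 1ℚ))) * v)
        + (k * l′ - 1ℚ) * - (l * l * (l * l) * v * (k * l′ + 1ℚ) * (k * k * l′ * l′ + 1ℚ))
      lemma₂ = solve-∀ ringℚ
      lemma₃ : ∀ X → X ≡ - (# 2) * (- X * (1/ # 2))
      lemma₃ = solve-∀ ringℚ
      lemma₄ : ∀ X Y → Y ≡ (# 16 * ((# 3 * (X * (X * 1ℚ)) + # 28 * X - # 4 + # 8 * Y) * (1/ # 16)) - (# 3 * (X * X) + # 28 * X - # 4)) * (1/ # 8)
      lemma₄ = solve-∀ ringℚ
      lemma₅ : ∀ m u → u ≡ m * u + (m - 1ℚ) * - u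
      lemma₅ = solve-∀ ringℚ
      lemma₆ : ∀ m v → v ≡ m * m * v + (m - 1ℚ) * - ((m + 1ℚ) * v)
      lemma₆ = solve-∀ ringℚ
      compare : (∃ λ k → k * l′ ≡ 1ℚ × k ≢ 0ℚ) → X′ ≡ X × Y′ ≡ Y
      compare (k , kl′≡1 , _) = X′≡X , Y′≡Y
        where
        -- Scaling by m = l / l′ carries the data of `param X′ Y′` to the normalized data. As u and
        -- v have weights 2 and 4, m² = 1 is enough to make them agree, and X and then Y are
        -- recovered from u and v linearly.
        m = l * k
        u₁≡ : u₁ ≡ m * m * paramU X′
        u₁≡ = trans (modulo kl′≡1 _ (lemma₁ u l l′ k)) (cong (λ z → m * m * z) (sym u′≡))
        v₁≡ : v₁ ≡ m * m * (m * m) * paramV X′ Y′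
        v₁≡ = trans (modulo kl′≡1 _ (lemma₂ v l l′ k)) (cong (λ z → m * m * (m * m) * z) (sym v′≡))
        m²≡1 : m * m ≡ 1ℚ
        m²≡1 = trans (lemma m) (leading-coefficient-± (m * 1ℚ) s₁ t₁ (m * m * cubicS X′) (m * m * m * cubicT X′ Y′) u₁ v₁ noroot₁ normalized
          (subst₂ (Splits (m * 1ℚ) (m * m * cubicS X′) (m * m * m * cubicT X′ Y′)) (sym u₁≡) (sym v₁≡) (scale-splits m (param-splits X′ Y′ p′))))
          where
          lemma : ∀ m → m * m ≡ m * 1ℚ * (m * 1ℚ)
          lemma = solve-∀ ringℚ
        U≡ : paramU X′ ≡ paramU X
        U≡ = trans (modulo m²≡1 _ (lemma₅ (m * m) (paramU X′))) (trans (sym u₁≡) (sym (splits-paramU normalized)))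
        V≡ : paramV X′ Y′ ≡ paramV X Y
        V≡ = trans (modulo m²≡1 _ (lemma₆ (m * m) (paramV X′ Y′))) (trans (sym v₁≡) (sym (splits-paramV normalized)))
        X′≡X : X′ ≡ X
        X′≡X = trans (lemma₃ X′) (trans (cong (λ z → - (# 2) * z) U≡) (sym (lemma₃ X)))
        Y′≡Y : Y′ ≡ Y
        Y′≡Y = trans (lemma₄ X′ Y′) (trans (cong₂ (λ V X → (# 16 * V - (# 3 * (X * X) + # 28 * X - # 4)) * (1/ # 8)) V≡ X′≡X) (sym (lemma₄ X Y)))

-- The infinite family

infixl 6 _⟨+⟩_
infixl 7 _⟨*⟩_

_⟨+⟩_ : ∀ {m n p q} → fromℤ m ≡ p → fromℤ n ≡ q → fromℤ (m ℤ.+ n) ≡ p + q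
_⟨+⟩_ {m} {n} h k = trans (fromℤ-+ m n) (cong₂ _+_ h k)

_⟨*⟩_ : ∀ {m n p q} → fromℤ m ≡ p → fromℤ n ≡ q → fromℤ (m ℤ.* n) ≡ p * q
_⟨*⟩_ {m} {n} h k = trans (fromℤ-* m n) (cong₂ _*_ h k)

-- Reduction modulo 11 in weighted homogeneous coordinates x = b / a, y = m / a². The fractions need
-- not be in lowest terms, which allows a to be normalized to 1 modulo 11.
record Residue (P : 𝕁) (β μ : ℤ) : Set where
  field
    a b m : ℤ
    ξ≡  : ξ P * fromℤ a ≡ fromℤ b
    η≡  : η P * (fromℤ a * fromℤ a) ≡ fromℤ m
    a≈1 : a ≈ + 1 [mod 11 ]
    b≈β : b ≈ β [mod 11 ]
    m≈μ : m ≈ μ [mod 11 ]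

sum-a sum-b sum-m : (a₁ b₁ m₁ a₂ b₂ m₂ : ℤ) → ℤ
sum-a a₁ b₁ m₁ a₂ b₂ m₂ = a₁ ℤ.* a₁ ℤ.* (a₂ ℤ.* a₂) ℤ.+ -[1+ 9 ] ℤ.* (b₁ ℤ.* b₁ ℤ.* (b₂ ℤ.* b₂))
sum-b a₁ b₁ m₁ a₂ b₂ m₂ = a₁ ℤ.* b₁ ℤ.* m₂ ℤ.+ a₂ ℤ.* b₂ ℤ.* m₁
sum-m a₁ b₁ m₁ a₂ b₂ m₂ =
  (m₁ ℤ.* m₂ ℤ.+ -[1+ 5 ] ℤ.* (a₁ ℤ.* b₁ ℤ.* (a₂ ℤ.* b₂))) ℤ.*
  (a₁ ℤ.* a₁ ℤ.* (a₂ ℤ.* a₂) ℤ.+ + 10 ℤ.* (b₁ ℤ.* b₁ ℤ.* (b₂ ℤ.* b₂)))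
  ℤ.+ + 20 ℤ.* (a₁ ℤ.* b₁ ℤ.* (a₂ ℤ.* b₂)) ℤ.* (b₁ ℤ.* b₁ ℤ.* (a₂ ℤ.* a₂) ℤ.+ b₂ ℤ.* b₂ ℤ.* (a₁ ℤ.* a₁))

-- The addition law in the coordinates (a, b, m) is polynomial over ℤ, hence compatible with
-- congruences. Since Q reduces to the neutral element, b₂ vanishes modulo 11 and the new a is again
-- 1.
residue-∙ : ∀ {P Q β μ} → Residue P β μ → Residue Q (+ 0) (+ 1) →
  Residue (P ∙ Q) (sum-b (+ 1) β μ (+ 1) (+ 0) (+ 1)) (sum-m (+ 1) β μ (+ 1) (+ 0) (+ 1))
residue-∙ {P} {Q} {β} {μ} R S = record
  { a = sum-a a₁ b₁ m₁ a₂ b₂ m₂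
  ; b = sum-b a₁ b₁ m₁ a₂ b₂ m₂
  ; m = sum-m a₁ b₁ m₁ a₂ b₂ m₂
  ; ξ≡ = trans (cong (ξ (P ∙ Q) *_) fromℤ-a) (trans (lemma₁ z x₁ x₂ α₁ α₂) (trans (cong (_* (α₁ * α₁ * (α₂ * α₂))) (ξ-∙ P Q))
      (trans (lemma₂ x₁ y₁ x₂ y₂ α₁ α₂) (sym fromℤ-b))))
  ; η≡ = trans (cong (λ a → η (P ∙ Q) * (a * a)) fromℤ-a) (trans (lemma₃ w x₁ x₂ α₁ α₂)
      (trans (cong (_* (α₁ * α₁ * (α₂ * α₂) * (α₁ * α₁ * (α₂ * α₂)))) (η-∙ P Q)) (trans (lemma₄ x₁ y₁ x₂ y₂ α₁ α₂) (sym fromℤ-m))))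
  ; a≈1 = a≈ (≈-+ (≈-* (≈-* a₁≈ a₁≈) (≈-* a₂≈ a₂≈)) (≈-* (≈-refl -[1+ 9 ]) (≈-* (≈-* b₁≈ b₁≈) (≈-* b₂≈ b₂≈))))
  ; b≈β = ≈-+ (≈-* (≈-* a₁≈ b₁≈) m₂≈) (≈-* (≈-* a₂≈ b₂≈) m₁≈)
  ; m≈μ = ≈-+ (≈-* (≈-+ (≈-* m₁≈ m₂≈) (≈-* (≈-refl -[1+ 5 ]) ab≈)) (≈-+ (≈-* (≈-* a₁≈ a₁≈) (≈-* a₂≈ a₂≈)) (≈-* (≈-refl (+ 10)) (≈-* (≈-* b₁≈ b₁≈) (≈-* b₂≈ b₂≈)))))
      (≈-* (≈-* (≈-refl (+ 20)) ab≈) (≈-+ (≈-* (≈-* b₁≈ b₁≈) (≈-* a₂≈ a₂≈)) (≈-* (≈-* b₂≈ b₂≈) (≈-* a₁≈ a₁≈))))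
  }
  where
  open Residue R renaming (a to a₁; b to b₁; m to m₁; ξ≡ to ξ₁≡; η≡ to η₁≡; a≈1 to a₁≈; b≈β to b₁≈; m≈μ to m₁≈)
  open Residue S renaming (a to a₂; b to b₂; m to m₂; ξ≡ to ξ₂≡; η≡ to η₂≡; a≈1 to a₂≈; b≈β to b₂≈; m≈μ to m₂≈)
  a≈ : ∀ {n} → n ≈ + 1 ℤ.* + 1 ℤ.* (+ 1 ℤ.* + 1) ℤ.+ -[1+ 9 ] ℤ.* (β ℤ.* β ℤ.* (+ 0 ℤ.* + 0)) [mod 11 ] → n ≈ + 1 [mod 11 ]
  a≈ {n} = subst (λ k → n ≈ k [mod 11 ]) (lemma β)
    where
    lemma : ∀ β → + 1 ℤ.* + 1 ℤ.* (+ 1 ℤ.* + 1) ℤ.+ -[1+ 9 ] ℤ.* (β ℤ.* β ℤ.* (+ 0 ℤ.* + 0)) ≡ + 1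
    lemma = ℤSolver.solve-∀
  ab≈ = ≈-* (≈-* a₁≈ b₁≈) (≈-* a₂≈ b₂≈)
  x₁ = ξ P
  y₁ = η P
  x₂ = ξ Q
  y₂ = η Q
  z = ξ (P ∙ Q)
  w = η (P ∙ Q)
  α₁ = fromℤ a₁
  α₂ = fromℤ a₂
  B₁ : fromℤ b₁ ≡ x₁ * α₁
  B₁ = sym ξ₁≡
  B₂ : fromℤ b₂ ≡ x₂ * α₂
  B₂ = sym ξ₂≡
  M₁ : fromℤ m₁ ≡ y₁ * (α₁ * α₁)
  M₁ = sym η₁≡
  M₂ : fromℤ m₂ ≡ y₂ * (α₂ * α₂)
  M₂ = sym η₂≡
  A₁ : fromℤ a₁ ≡ α₁
  A₁ = refl
  A₂ : fromℤ a₂ ≡ α₂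
  A₂ = refl
  K : ∀ k → fromℤ k ≡ fromℤ k
  K k = refl
  fromℤ-a = A₁ ⟨*⟩ A₁ ⟨*⟩ (A₂ ⟨*⟩ A₂) ⟨+⟩ K -[1+ 9 ] ⟨*⟩ (B₁ ⟨*⟩ B₁ ⟨*⟩ (B₂ ⟨*⟩ B₂))
  fromℤ-b = A₁ ⟨*⟩ B₁ ⟨*⟩ M₂ ⟨+⟩ A₂ ⟨*⟩ B₂ ⟨*⟩ M₁
  fromℤ-m = (M₁ ⟨*⟩ M₂ ⟨+⟩ K -[1+ 5 ] ⟨*⟩ (A₁ ⟨*⟩ B₁ ⟨*⟩ (A₂ ⟨*⟩ B₂))) ⟨*⟩
    (A₁ ⟨*⟩ A₁ ⟨*⟩ (A₂ ⟨*⟩ A₂) ⟨+⟩ K (+ 10) ⟨*⟩ (B₁ ⟨*⟩ B₁ ⟨*⟩ (B₂ ⟨*⟩ B₂)))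
    ⟨+⟩ K (+ 20) ⟨*⟩ (A₁ ⟨*⟩ B₁ ⟨*⟩ (A₂ ⟨*⟩ B₂)) ⟨*⟩ (B₁ ⟨*⟩ B₁ ⟨*⟩ (A₂ ⟨*⟩ A₂) ⟨+⟩ B₂ ⟨*⟩ B₂ ⟨*⟩ (A₁ ⟨*⟩ A₁))
  lemma₁ : ∀ z x₁ x₂ a₁ a₂ → z * (a₁ * a₁ * (a₂ * a₂) + - (# 10) * (x₁ * a₁ * (x₁ * a₁) * (x₂ * a₂ * (x₂ * a₂)))) ≡
    z * (1ℚ - # 10 * ((x₁ * x₁) * (x₂ * x₂))) * (a₁ * a₁ * (a₂ * a₂))
  lemma₁ = solve-∀ ringℚ
  lemma₂ : ∀ x₁ y₁ x₂ y₂ a₁ a₂ → (x₁ * y₂ + x₂ * y₁) * (a₁ * a₁ * (a₂ * a₂)) ≡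
    a₁ * (x₁ * a₁) * (y₂ * (a₂ * a₂)) + a₂ * (x₂ * a₂) * (y₁ * (a₁ * a₁))
  lemma₂ = solve-∀ ringℚ
  lemma₃ : ∀ z x₁ x₂ a₁ a₂ →
    let A = a₁ * a₁ * (a₂ * a₂) + - (# 10) * (x₁ * a₁ * (x₁ * a₁) * (x₂ * a₂ * (x₂ * a₂)))
        D = 1ℚ - # 10 * ((x₁ * x₁) * (x₂ * x₂))
    in z * (A * A) ≡ z * (D * D) * (a₁ * a₁ * (a₂ * a₂) * (a₁ * a₁ * (a₂ * a₂)))
  lemma₃ = solve-∀ ringℚ
  lemma₄ : ∀ x₁ y₁ x₂ y₂ a₁ a₂ →
    ((y₁ * y₂ - # 6 * (x₁ * x₂)) * (1ℚ + # 10 * ((x₁ * x₁) * (x₂ * x₂))) + # 20 * (x₁ * x₂) * (x₁ * x₁ + x₂ * x₂))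
      * (a₁ * a₁ * (a₂ * a₂) * (a₁ * a₁ * (a₂ * a₂))) ≡
    (y₁ * (a₁ * a₁) * (y₂ * (a₂ * a₂)) + - (# 6) * (a₁ * (x₁ * a₁) * (a₂ * (x₂ * a₂)))) *
    (a₁ * a₁ * (a₂ * a₂) + # 10 * (x₁ * a₁ * (x₁ * a₁) * (x₂ * a₂ * (x₂ * a₂))))
    + # 20 * (a₁ * (x₁ * a₁) * (a₂ * (x₂ * a₂))) * (x₁ * a₁ * (x₁ * a₁) * (a₂ * a₂) + x₂ * a₂ * (x₂ * a₂) * (a₁ * a₁))
  lemma₄ = solve-∀ ringℚ

residue-P₀ : Residue P₀ (+ 8) (+ 3)
residue-P₀ = record
  -- 2 / 3 = 8 / 12 and 5 / 9 = 80 / 144, expanded by 4 because 12 is 1 modulo 11.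
  { a = + 12 ; b = + 8 ; m = + 80 ; ξ≡ = refl ; η≡ = refl
  ; a≈1 = congruent (+ 1) refl ; b≈β = congruent (+ 0) refl ; m≈μ = congruent (+ 7) refl }

2P₀ 3P₀ : 𝕁
2P₀ = point (- # 60 ÷ # 79) (# 5809 ÷ # 6241) refl
3P₀ = point (- # 3718 ÷ # 29277) (# 815789285 ÷ # 857142729) refl

3·P₀≡ : 3 · P₀ ≡ 3P₀
3·P₀≡ = trans (cong (λ S → P₀ ∙ (P₀ ∙ S)) (∙-identityʳ P₀))
  (trans (cong (P₀ ∙_) (∙-unique {P₀} {P₀} {2P₀} refl refl)) (∙-unique {P₀} {2P₀} {3P₀} refl refl))

residue-3P₀ : Residue 3P₀ (+ 0) (+ 1)
residue-3P₀ = record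
  -- The fraction for x is expanded by 2 because 2 · 29277 is 1 modulo 11. The numerator - 7436 = -
  -- 676 · 11 is what makes 3 P₀ reduce to the neutral element.
  { a = + 58554 ; b = ℤ.- + 7436 ; m = + 3263157140 ; ξ≡ = refl ; η≡ = refl
  ; a≈1 = congruent (+ 5323) refl ; b≈β = congruent (ℤ.- + 676) refl ; m≈μ = congruent (+ 296650649) refl }

-- The points (3 n + 1) P₀.
progression : ℕ → 𝕁
progression zero    = P₀
progression (suc n) = progression n ∙ 3P₀

residue-progression : ∀ n → Residue (progression n) (+ 8) (+ 3)
residue-progression zero    = residue-P₀
-- The residues produced by `residue-∙` compute to 8 and 3 again.
residue-progression (suc n) = residue-∙ (residue-progression n) residue-3P₀

progression-+ : ∀ m d → progression (d ℕ.+ m) ≡ progression m ∙ d · 3P₀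
progression-+ m zero    = sym (∙-identityʳ (progression m))
progression-+ m (suc d) = begin
  progression (d ℕ.+ m) ∙ 3P₀             ≡⟨ cong (_∙ 3P₀) (progression-+ m d) ⟩
  progression m ∙ d · 3P₀ ∙ 3P₀           ≡⟨ ∙-assoc (progression m) (d · 3P₀) 3P₀ ⟩
  progression m ∙ (d · 3P₀ ∙ 3P₀)         ≡⟨ cong (progression m ∙_) (∙-comm (d · 3P₀) 3P₀) ⟩
  progression m ∙ (suc d · 3P₀)           ∎
  where open ≡-Reasoning

-- Equality would give 3 (n - m) P₀ = `O`, against `P₀-torsion-free`.
progression-< : ∀ {m n} → m ℕ.< n → progression m ≢ progression n
progression-< {m} {n} m<n eq = contra (P₀-torsion-free (suc d ℕ.* 3) (begin
  (suc d ℕ.* 3) · P₀                                         ≡⟨ ×-assocˡ P₀ (suc d) 3 ⟨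
  suc d · (3 · P₀)                                           ≡⟨ cong (suc d ·_) 3·P₀≡ ⟩
  suc d · 3P₀                                                ≡⟨ cancelʳ (suc d · 3P₀) (progression m) ⟨
  suc d · 3P₀ ∙ progression m ∙ progression m ⁻¹             ≡⟨ cong (_∙ progression m ⁻¹) (∙-comm (suc d · 3P₀) (progression m)) ⟩
  progression m ∙ suc d · 3P₀ ∙ progression m ⁻¹             ≡⟨ cong (_∙ progression m ⁻¹) (progression-+ m (suc d)) ⟨
  progression (suc d ℕ.+ m) ∙ progression m ⁻¹               ≡⟨ cong (λ k → progression k ∙ progression m ⁻¹) suc-d+m≡n ⟩
  progression n ∙ progression m ⁻¹                           ≡⟨ cong (_∙ progression m ⁻¹) eq ⟨
  progression m ∙ progression m ⁻¹                           ≡⟨ ∙-inverseʳ (progression m) ⟩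
  O                                                          ∎))
  where
  open ≡-Reasoning
  d = n ℕ.∸ suc m
  suc-d+m≡n : suc d ℕ.+ m ≡ n
  suc-d+m≡n = trans (sym (ℕ.+-suc d m)) (ℕ.m∸n+n≡m m<n)
  contra : suc d ℕ.* 3 ≢ 0
  contra ()

progression-injective : ∀ m n → m ≢ n → progression m ≢ progression n
progression-injective m n m≢n eq with ℕ.<-cmp m n
... | Tri.tri< m<n _ _ = progression-< m<n eq
... | Tri.tri≈ _ m≡n _ = m≢n m≡n
... | Tri.tri> _ _ n<m = progression-< n<m (sym eq)

-- The inverse of j away from O and T.
module Affine (P : 𝕁) (ξ≢0 : ξ P ≢ 0ℚ) where
  w : ℚ
  w = 1ℚ + η P - # 3 * (ξ P * ξ P)

  X Y : ℚ
  X = (# 2 * w) /[ ξ P * ξ P , square-≢0 ξ≢0 ]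
  Y = (# 2 * X) /[ ξ P , ξ≢0 ]

  X≡ : X * (ξ P * ξ P) ≡ # 2 * w
  X≡ = ÷-cancel (# 2 * w) (ξ P * ξ P) (square-≢0 ξ≢0)

  Y≡ : Y * ξ P ≡ # 2 * X
  Y≡ = ÷-cancel (# 2 * X) (ξ P) ξ≢0

  onCurve : OnCurve X Y
  onCurve = *-cancelʳ _ _ (ξ P * ξ P * (ξ P * ξ P) * (ξ P * ξ P)) (*-≢0 (square-≢0 (square-≢0 ξ≢0)) (square-≢0 ξ≢0))
    (modulo Y≡ _ (modulo X≡ _ (modulo (on P) _ (lemma X Y (ξ P) (η P)))))
    where
    lemma : ∀ X Y x y →
      let w = 1ℚ + y - # 3 * (x * x)
          V = X * (x * x)
          W = # 2 * w
      in Y * Y * (x * x * (x * x) * (x * x)) ≡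
        (X * X * X + # 12 * X * X + (- # 4) * X + 0ℚ) * (x * x * (x * x) * (x * x))
        + (Y * x - # 2 * X) * ((Y * x + # 2 * X) * (x * x * (x * x)))
        + (V - W) * (# 4 * (V + W) - (V * V + V * W + W * W) - # 12 * (V + W) * (x * x) + # 4 * (x * x * (x * x)))
        + (y * y - (1ℚ - # 6 * (x * x) + # 10 * ((x * x) * (x * x)))) * - (# 8 * w)
    lemma = solve-∀ ringℚ

-- For Y ≠ 0 the relation Y x = 2 X determines x, and then X x² = 2 (1 + y - 3 x²) is linear in y.
same-affine : ∀ P Q (p : ξ P ≢ 0ℚ) (q : ξ Q ≢ 0ℚ) → Affine.X P p ≡ Affine.X Q q → Affine.Y P p ≡ Affine.Y Q q →
  Affine.Y P p ≢ 0ℚ → P ≡ Q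
same-affine P Q p q X≡ Y≡ Y≢0 = J-≡ ξ-eq (η-eq (ξ P) (η P) (ξ Q) (η Q) (Affine.X P p) ξ-eq (Affine.X≡ P p)
    (trans (cong (_* (ξ Q * ξ Q)) X≡) (Affine.X≡ Q q)))
  where
  ξ-eq : ξ P ≡ ξ Q
  ξ-eq = *-cancelˡ (Affine.Y P p) Y≢0 (trans (Affine.Y≡ P p) (trans (cong (# 2 *_) X≡)
    (trans (sym (Affine.Y≡ Q q)) (cong (_* ξ Q) (sym Y≡)))))
  η-eq : ∀ x y x′ y′ X → x ≡ x′ → X * (x * x) ≡ # 2 * (1ℚ + y - # 3 * (x * x)) → X * (x′ * x′) ≡ # 2 * (1ℚ + y′ - # 3 * (x′ * x′)) → y ≡ y′
  η-eq x y _ y′ X refl h h′ = modulo h _ (modulo h′ _ (lemma x y y′ X))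
    where
    lemma : ∀ x y y′ X → y ≡ y′ + (X * (x * x) - # 2 * (1ℚ + y - # 3 * (x * x))) * - (1/ # 2)
      + (X * (x * x) - # 2 * (1ℚ + y′ - # 3 * (x * x))) * (1/ # 2)
    lemma = solve-∀ ringℚ

-- 2 b³ q³ (z³ + z² + s z + t) for z = p / q.
cleared : (a b m p q : ℤ) → ℤ
cleared a b m p q =
  + 2 ℤ.* (b ℤ.* (b ℤ.* b)) ℤ.* (p ℤ.* p ℤ.* (p ℤ.+ q))
  ℤ.+ b ℤ.* (W ℤ.+ b ℤ.* b) ℤ.* (p ℤ.* (q ℤ.* q))
  ℤ.+ + 2 ℤ.* W ℤ.* (+ 2 ℤ.* b ℤ.+ a) ℤ.* (q ℤ.* (q ℤ.* q))
  where W = a ℤ.* a ℤ.+ m ℤ.+ -[1+ 2 ] ℤ.* (b ℤ.* b)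

cleared-≈ : ∀ {a b m p q a′ b′ m′ p′ q′} → a ≈ a′ [mod 11 ] → b ≈ b′ [mod 11 ] → m ≈ m′ [mod 11 ] → p ≈ p′ [mod 11 ] → q ≈ q′ [mod 11 ] →
  cleared a b m p q ≈ cleared a′ b′ m′ p′ q′ [mod 11 ]
cleared-≈ a b m p q = ≈-+ (≈-+
    (≈-* (≈-* (≈-refl (+ 2)) (≈-* b (≈-* b b))) (≈-* (≈-* p p) (≈-+ p q)))
    (≈-* (≈-* b (≈-+ W (≈-* b b))) (≈-* p (≈-* q q))))
    (≈-* (≈-* (≈-* (≈-refl (+ 2)) W) (≈-+ (≈-* (≈-refl (+ 2)) b) a)) (≈-* q (≈-* q q)))
  where W = ≈-+ (≈-+ (≈-* a a) m) (≈-* (≈-refl -[1+ 2 ]) (≈-* b b))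

-- The arguments 1, 8, 3 are the residues of the progression. Numerator p and denominator q of a
-- root are reduced separately, as q may be divisible by 11; coprimality later excludes that both
-- are.
no-root-mod-11 : ∀ (p q : Fin 11) → 11 ℕ.∣ ℤ.∣ cleared (+ 1) (+ 8) (+ 3) (+ toℕ p) (+ toℕ q) ∣ → 11 ℕ.∣ toℕ p × 11 ℕ.∣ toℕ q
no-root-mod-11 = from-yes (Fin.all? λ (p : Fin 11) → Fin.all? λ (q : Fin 11) →
  (11 ℕ.∣? ℤ.∣ cleared (+ 1) (+ 8) (+ 3) (+ toℕ p) (+ toℕ q) ∣) →-dec ((11 ℕ.∣? toℕ p) ×-dec (11 ℕ.∣? toℕ q)))

cleared-root : ∀ P (ξ≢0 : ξ P ≢ 0ℚ) (R : Residue P (+ 8) (+ 3)) → let open Affine P ξ≢0; open Residue R in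
  ∀ z → eval (cubic 1ℚ (cubicS X) (cubicT X Y)) z ≡ 0ℚ → cleared a b m (↥ z) (↧ z) ≡ ℤ.0ℤ
cleared-root P ξ≢0 R z eq = fromℤ-injective (trans fromℤ-cleared (modulo X≡ _ (modulo Y≡ _
    (modulo eq _ (identity (ξ P) (η P) X Y α z q)))))
  where
  open Affine P ξ≢0
  open Residue R
  α = fromℤ a
  q = fromℤ (↧ z)
  A : fromℤ a ≡ α
  A = refl
  B : fromℤ b ≡ ξ P * α
  B = sym ξ≡
  M : fromℤ m ≡ η P * (α * α)
  M = sym η≡
  Pz : fromℤ (↥ z) ≡ z * q
  Pz = sym (*-↧ z)
  Q : fromℤ (↧ z) ≡ q
  Q = refl
  K : ∀ k → fromℤ k ≡ fromℤ k
  K k = refl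
  Wz = A ⟨*⟩ A ⟨+⟩ M ⟨+⟩ K -[1+ 2 ] ⟨*⟩ (B ⟨*⟩ B)
  fromℤ-cleared = K (+ 2) ⟨*⟩ (B ⟨*⟩ (B ⟨*⟩ B)) ⟨*⟩ (Pz ⟨*⟩ Pz ⟨*⟩ (Pz ⟨+⟩ Q))
    ⟨+⟩ B ⟨*⟩ (Wz ⟨+⟩ B ⟨*⟩ B) ⟨*⟩ (Pz ⟨*⟩ (Q ⟨*⟩ Q))
    ⟨+⟩ K (+ 2) ⟨*⟩ Wz ⟨*⟩ (K (+ 2) ⟨*⟩ B ⟨+⟩ A) ⟨*⟩ (Q ⟨*⟩ (Q ⟨*⟩ Q))
  identity : ∀ x y X Y a z q →
    let b = x * a
        m = y * (a * a)
        p = z * q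
        W = a * a + m + - (# 3) * (b * b)
        s = (X + # 2) * (1/ # 4)
        t = X + Y * (1/ # 4)
        q³ = q * (q * q)
        a³ = a * (a * a)
    in # 2 * (b * (b * b)) * (p * p * (p + q)) + b * (W + b * b) * (p * (q * q)) + # 2 * W * (# 2 * b + a) * (q * (q * q)) ≡
      0ℚ
      + (X * (x * x) - # 2 * (1ℚ + y - # 3 * (x * x))) * - (a³ * q³ * (x * z * (1/ # 2) + # 2 * x + 1ℚ))
      + (Y * x - # 2 * X) * - (a³ * q³ * (x * x) * (1/ # 2))
      + (t + z * (s + z * (1ℚ + z * (1ℚ + z * 0ℚ))) - 0ℚ) * (# 2 * (b * (b * b)) * q³)
  identity = solve-∀ ringℚ

residue-no-root : ∀ P (ξ≢0 : ξ P ≢ 0ℚ) → Residue P (+ 8) (+ 3) → let open Affine P ξ≢0 in NoRoot (cubic 1ℚ (cubicS X) (cubicT X Y))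
residue-no-root P ξ≢0 R z eq = contra (no-root-mod-11 (proj₁ rp) (proj₁ rq) (≈0⇒∣ reduced (cleared-root P ξ≢0 R z eq)))
  where
  open Residue R
  rp = ≈-residue 11 (↥ z)
  rq = ≈-residue 11 (↧ z)
  reduced : cleared a b m (↥ z) (↧ z) ≈ cleared (+ 1) (+ 8) (+ 3) (+ toℕ (proj₁ rp)) (+ toℕ (proj₁ rq)) [mod 11 ]
  reduced = cleared-≈ {a} {b} {m} {↥ z} {↧ z} {+ 1} {+ 8} {+ 3} {+ toℕ (proj₁ rp)} {+ toℕ (proj₁ rq)} a≈1 b≈β m≈μ (proj₂ rp) (proj₂ rq)
  contra : ¬ (11 ℕ.∣ toℕ (proj₁ rp) × 11 ℕ.∣ toℕ (proj₁ rq))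
  contra (11∣p , 11∣q) = coprime⇒¬∣ (∣∙∣-coprime z) (λ ()) (∣-≈ (proj₂ rp) ℕ.∣-refl 11∣p) (∣-≈ (proj₂ rq) ℕ.∣-refl 11∣q)

residue-ξ≢0 : ∀ {P} → Residue P (+ 8) (+ 3) → ξ P ≢ 0ℚ
residue-ξ≢0 R ξ≡0 = from-no (11 ℕ.∣? 8) (≈0⇒∣ b≈β (fromℤ-injective (trans (sym ξ≡) (trans (cong (_* fromℤ a) ξ≡0) (ℚ.*-zeroˡ (fromℤ a))))))
  where open Residue R

-- Quadruples from the progression and their inequivalence

family-ξ≢0 : ∀ n → ξ (progression n) ≢ 0ℚ
family-ξ≢0 n = residue-ξ≢0 (residue-progression n)

module Family (n : ℕ) = Affine (progression n) (family-ξ≢0 n)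

family : ℕ → Quadruple
family n = param (Family.X n) (Family.Y n)

family-no-root : ∀ n → NoRoot (cubic 1ℚ (cubicS (Family.X n)) (cubicT (Family.X n) (Family.Y n)))
family-no-root n = residue-no-root (progression n) (family-ξ≢0 n) (residue-progression n)

family-type33 : ∀ n → IsType33 (family n)
family-type33 n = no-root⇒type33 (Family.X n) (Family.Y n) (Family.onCurve n) (family-no-root n)

-- Y = 0 forces X = 0, and then the constant term X + Y / 4 of the cubic vanishes, so that 0 is a
-- root.
family-Y≢0 : ∀ n → Family.Y n ≢ 0ℚ
family-Y≢0 n Y≡0 = nonzero-root 1ℚ (cubicS X) (cubicT X Y) (family-no-root n)
  (trans (cong₂ (λ X Y → X + Y * (1/ # 4)) X≡0 Y≡0) refl)
  where
  open Family n
  X≡0 : X ≡ 0ℚ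
  X≡0 = Y≡0⇒X≡0 (subst (OnCurve X) Y≡0 onCurve)

withQuadratic-∼-refl : ∀ u v → withQuadratic u v ∼ withQuadratic u v
withQuadratic-∼-refl u v = withQuadratic-∼ u v u v 1ℚ (λ ()) (lemma₁ u) (lemma₂ v)
  where
  lemma₁ : ∀ u → u ≡ 1ℚ * 1ℚ * u
  lemma₁ = solve-∀ ringℚ
  lemma₂ : ∀ v → v ≡ 1ℚ * 1ℚ * (1ℚ * 1ℚ) * v
  lemma₂ = solve-∀ ringℚ

-- An equivalence would make the curve points of both indices parameters of `family m`. Uniqueness
-- identifies them, and `same-affine` carries the equality back to the progression.
family-inequivalent : ∀ m n → m ≢ n → ¬ (family m ∼ family n)
family-inequivalent m n m≢n equivalent = go (parametrization (family m) (family-type33 m))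
  where
  go : ¬ Parametrized (family m)
  go (X , Y , _ , _ , unique) = progression-injective m n m≢n
    (same-affine (progression m) (progression n) (family-ξ≢0 m) (family-ξ≢0 n)
      (trans (proj₁ at-m) (sym (proj₁ at-n))) (trans (proj₂ at-m) (sym (proj₂ at-n))) (family-Y≢0 m))
    where
    at-m = unique (Family.X m) (Family.Y m) (Family.onCurve m) (withQuadratic-∼-refl (paramU (Family.X m)) (paramV (Family.X m) (Family.Y m)))
    at-n = unique (Family.X n) (Family.Y n) (Family.onCurve n) equivalent

theorem6p2 : (∃ λ (t : ℕ → Quadruple) →
    (∀ n → IsType33 (t n)) × (∀ m n → m ≢ n → ¬ (t m ∼ t n)))
    × (∀ X Y → OnCurve X Y →
    quadratic (param X Y) ∣ₚ quintic (param X Y)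
    × (cubic⁺ X Y *ₚ cubic⁻ X Y) *ₚ quartic (param X Y) ≈ₚ decic (param X Y)
    × (IsType33 (param X Y) ⇔ Irreducible (cubic⁺ X Y)))
    × (∀ t → IsType33 t →
    ∃ λ X → ∃ λ Y → OnCurve X Y × t ∼ param X Y
    × (∀ X′ Y′ → OnCurve X′ Y′ → t ∼ param X′ Y′ → X′ ≡ X × Y′ ≡ Y))
    × HasMordellWeilRank E₃₃ 1
theorem6p2 =
  (family , family-type33 , family-inequivalent) ,
  (λ X Y p → quadratic∣quintic (paramU X) (paramV X Y) , param-factorization X Y p , type33⇔irreducible X Y p) ,
  parametrization ,
  rank-one
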